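{- For every property $\Pi$ in $k$-SHPP (semi-homogeneous graph partition properties with exactly $k$ parts), the sample complexity of $\epsilon$-testing $\Pi$ satisfies $$\mathcal{S}_{\Pi}(n,\epsilon) = O\left(\frac{k}{\epsilon}\,\ln^2\!\left(\frac{k}{\epsilon}\right)\right).$$ That is, there is an absolute constant $K$ such that for all integers $k\ge 1$, $n\ge 1$, all $0<\epsilon<1$ and every $\Pi$ in $k$-SHPP, there is a canonical $\epsilon$-tester for $\Pi$ on graphs over $n$ vertices whose sample complexity is at most $K\,\frac{k}{\epsilon}\ln^2(k/\epsilon)$.
   Context: A graph property $\Pi$ is a $k$-partition property if it is described by parameters $0\le \ell_{i,j}\le u_{i,j}\le 1$ ($i,j\in[k]$) such that a graph $G$ has property $\Pi$ if and only if its vertex set can be partitioned into sets $V_1,\dots,V_k$ such that $\ell_{i,j}\le \frac{e_G(V_i,V_j)}{|V_i|\cdot|V_j|}\le u_{i,j}$ for all $i\ne j$, where $e_G(V_i,V_j)$ is the number of edges between $V_i$ and $V_j$, and $\ell_{i,i}\le e_G(V_i)/\binom{|V_i|}{2}\le u_{i,i}$ for all $i$, where $e_G(V_i)$ is the number of edges of $G[V_i]$ (a condition whose denominator is $0$ is considered vacuous; parts may be empty). $\Pi$ is semi-homogeneous if all $\ell_{i,j},u_{i,j}\in\{0,1\}$. $k$-SHPP is the set of semi-homogeneous partition properties with exactly $k$ parts. A graph $G$ on $n$ vertices is $\epsilon$-far from $\Pi$ if at least $\epsilon n^2$ edges need to be added or removed to turn it into a graph with property $\Pi$. A canonical tester with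 sample complexity $s$ samples a uniformly random set $S$ of $s$ vertices (all vertices, if $s\ge n$) and accepts if and only if the induced subgraph $G[S]$ satisfies some fixed predicate. It is an $\epsilon$-tester for a property if, for absolute constants $0\le c_0<c_1\le 1$, it accepts every graph having the property with probability at least $c_1$ and accepts every graph that is $\epsilon$-far from the property with probability at most $c_0$. $\mathcal{S}_{\Pi}(n,\epsilon)$ is the minimum sample complexity of a canonical $\epsilon$-tester for $\Pi$ on graphs over $n$ vertices. -}

module Defs where

open import Data.Bool.Base using (Bool; true; false)
import Data.Bool.Properties as Bool
open import Data.Fin.Base as Fin using (Fin; zero; suc)
import Data.Fin.Properties as Fin
open import Data.Fin.Permutation using (Permutation′; _⟨$⟩ʳ_)
open import Data.Fin.Subset using (Subset; inside; outside; ∣_∣)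
open import Data.Fin.Subset.Properties using (_∈?_)
open import Data.Integer.Base using (+_)
open import Data.List.Base using (List; []; _∷_; [_]; _++_; map; length; filter; filterᵇ; allFin; cartesianProduct)
open import Data.Nat.Base as ℕ using (ℕ; zero; suc; _⊓_)
import Data.Nat.Properties as ℕ
open import Data.Nat.Combinatorics using (_C_)
open import Data.Product.Base using (Σ; ∃; _×_; _,_; Σ-syntax; ∃-syntax)
open import Data.Rational.Base using (ℚ; 0ℚ; 1ℚ; _+_; _*_; _/_; _≤_; _<_)
open import Data.Sum.Base using (_⊎_)
open import Data.Vec.Base as Vec using ([]; _∷_)
open import Function.Bundles using (_⇔_)
open import Relation.Binary.PropositionalEquality using (_≡_; _≢_)
open import Relation.Nullary using (¬_; does; ¬?; _×-dec_)

fromℕ : ℕ → ℚ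
fromℕ n = + n / 1

------------------------------------------------------------------------
-- Real numbers

-- Dedekind cuts of ℚ.

record ℝ : Set₁ where
  field
    Lower Upper     : ℚ → Set
    lower-inhabited : ∃ Lower
    upper-inhabited : ∃ Upper
    lower-rounded   : ∀ q → Lower q ⇔ (∃[ r ] q < r × Lower r)
    upper-rounded   : ∀ q → Upper q ⇔ (∃[ r ] r < q × Upper r)
    disjoint        : ∀ q → ¬ (Lower q × Upper q)
    located         : ∀ {q r} → q < r → Lower q ⊎ Upper r

infix 4 _<ℝ_ _ℝ<_ _ℝ*_≤_

_<ℝ_ : ℚ → ℝ → Set
q <ℝ x = ℝ.Lower x q

_ℝ<_ : ℝ → ℚ → Set
x ℝ< q = ℝ.Upper x q

-- x · m ≤ d, for naturals m and d: it holds iff q · m ≤ d for every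
-- rational q < x.

_ℝ*_≤_ : ℝ → ℕ → ℕ → Set
x ℝ* m ≤ d = ∀ q → q <ℝ x → q * fromℕ m ≤ fromℕ d

-- Quantities derived from a real are given by their upper cuts: the
-- set of rationals strictly above them.

UpperCut : Set₁
UpperCut = ℚ → Set

-- k / ε for ε > 0:  k/ε < a  iff  k < a e for some rational 0 < e < ε,
-- provided k > 0.

quotient : ℕ → ℝ → UpperCut
quotient k ε a = ∃[ e ] 0ℚ < e × e <ℝ ε × fromℕ k < a * e

-- expTerm j b = bʲ / j!   and   expSum N b = Σ_{j < N} bʲ / j!

expTerm : ℕ → ℚ → ℚ
expTerm zero    b = 1ℚ
expTerm (suc j) b = expTerm j b * (b * (+ 1 / suc j))

expSum : ℕ → ℚ → ℚ
expSum zero    b = 0ℚ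
expSum (suc N) b = expSum N b + expTerm N b

-- Natural logarithm of a number x ≥ 1.  Since ln x ≥ 0, only b > 0 can
-- lie above it, and then ln x < b iff x < exp b.  As the partial sums
-- increase strictly to exp b, this says that x lies below one of them.

ln : UpperCut → UpperCut
ln x b = 0ℚ < b × ∃[ N ] x (expSum N b)

-- s ≤ K · x · y² for x, y ≥ 0: by monotonicity and continuity, it holds
-- iff s ≤ K a b² for all rationals a > x and b > y.

_≤_·_·_² : ℕ → ℕ → UpperCut → UpperCut → Set
s ≤ K · x · y ² = ∀ a b → x a → y b → fromℕ s ≤ fromℕ K * (a * (b * b))

------------------------------------------------------------------------
-- Finite simple graphs on the vertex set Fin n

record Graph (n : ℕ) : Set where
  field
    adj         : Fin n → Fin n → Bool
    symmetric   : ∀ x y → adj x y ≡ adj y x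
    irreflexive : ∀ x → adj x x ≡ false

open Graph public using (adj)

_≅_ : ∀ {n} → Graph n → Graph n → Set
_≅_ {n} G H =
  Σ[ π ∈ Permutation′ n ] (∀ x y → adj G x y ≡ adj H (π ⟨$⟩ʳ x) (π ⟨$⟩ʳ y))

vertexPairs : ∀ n → List (Fin n × Fin n)
vertexPairs n = cartesianProduct (allFin n) (allFin n)

-- The number of edges between A and B, for disjoint A and B.

edgesBetween : ∀ {n} → Graph n → Subset n → Subset n → ℕ
edgesBetween {n} G A B = length
  (filter (λ (x , y) → x ∈? A ×-dec y ∈? B ×-dec adj G x y Bool.≟ true)
          (vertexPairs n))

-- The number of edges of G[A].

edgesInside : ∀ {n} → Graph n → Subset n → ℕ
edgesInside {n} G A = length
  (filter (λ (x , y) → x Fin.<? y ×-dec x ∈? A ×-dec y ∈? A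
                         ×-dec adj G x y Bool.≟ true)
          (vertexPairs n))

-- The number of edges to add or remove to turn G into H.

editDistance : ∀ {n} → Graph n → Graph n → ℕ
editDistance {n} G H = length
  (filter (λ (x , y) → x Fin.<? y ×-dec ¬? (adj G x y Bool.≟ adj H x y))
          (vertexPairs n))

-- The elements of S in increasing order.

element : ∀ {n} (S : Subset n) → Fin ∣ S ∣ → Fin n
element (inside  ∷ S) zero    = zero
element (inside  ∷ S) (suc i) = suc (element S i)
element (outside ∷ S) i       = suc (element S i)

induced : ∀ {n} → Graph n → (S : Subset n) → Graph ∣ S ∣
induced G S = record
  { adj         = λ i j → adj G (element S i) (element S j)
  ; symmetric   = λ i j → Graph.symmetric G (element S i) (element S j)
  ; irreflexive = λ i → Graph.irreflexive G (element S i)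
  }

------------------------------------------------------------------------
-- Partition properties

GraphProperty : Set₁
GraphProperty = ∀ {n} → Graph n → Set

-- Rational bounds lose nothing here: only the values 0 and 1 survive in
-- semi-homogeneous properties.  The bounds need not be symmetric in i
-- and j; both the (i , j) and the (j , i) condition are imposed.

record PartitionParameters (k : ℕ) : Set where
  field
    ℓ u : Fin k → Fin k → ℚ
    0≤ℓ : ∀ i j → 0ℚ ≤ ℓ i j
    ℓ≤u : ∀ i j → ℓ i j ≤ u i j
    u≤1 : ∀ i j → u i j ≤ 1ℚ

-- lo ≤ e / d ≤ hi, vacuous when d = 0.

RatioWithin : ℚ → ℚ → ℕ → ℕ → Set
RatioWithin lo hi e d = .{{_ : ℕ.NonZero d}} → lo ≤ + e / d × + e / d ≤ hi

-- A partition into k possibly empty parts is given by the function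
-- sending each vertex to the index of its part.

part : ∀ {n k} → (Fin n → Fin k) → Fin k → Subset n
part c i = Vec.tabulate (λ x → does (c x Fin.≟ i))

record IsGoodPartition {n k} (P : PartitionParameters k) (G : Graph n)
                       (c : Fin n → Fin k) : Set where
  open PartitionParameters P
  V : Fin k → Subset n
  V = part c
  field
    between : ∀ i j → i ≢ j →
      RatioWithin (ℓ i j) (u i j) (edgesBetween G (V i) (V j)) (∣ V i ∣ ℕ.* ∣ V j ∣)
    within  : ∀ i →
      RatioWithin (ℓ i i) (u i i) (edgesInside G (V i)) (∣ V i ∣ C 2)

Describes : ∀ {k} → PartitionParameters k → GraphProperty → Set
Describes {k} P Π = ∀ {n} (G : Graph n) →
  Π G ⇔ (Σ[ c ∈ (Fin n → Fin k) ] IsGoodPartition P G c)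

SemiHomogeneous : ∀ {k} → PartitionParameters k → Set
SemiHomogeneous P = ∀ i j → (ℓ i j ≡ 0ℚ ⊎ ℓ i j ≡ 1ℚ) × (u i j ≡ 0ℚ ⊎ u i j ≡ 1ℚ)
  where open PartitionParameters P

SHPP : ℕ → GraphProperty → Set
SHPP k Π = Σ[ P ∈ PartitionParameters k ] SemiHomogeneous P × Describes P Π

------------------------------------------------------------------------
-- Canonical testers

Far : ∀ {n} → ℝ → GraphProperty → Graph n → Set
Far {n} ε Π G = ∀ (H : Graph n) → Π H → ε ℝ* n ℕ.^ 2 ≤ editDistance G H

subsets : ∀ n → List (Subset n)
subsets zero    = [ [] ]
subsets (suc n) = map (inside ∷_) (subsets n) ++ map (outside ∷_) (subsets n)

subsetsOfSize : ∀ n → ℕ → List (Subset n)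
subsetsOfSize n m = filter (λ S → ∣ S ∣ ℕ.≟ m) (subsets n)

-- The probability of p under the uniform distribution on a non-empty
-- list of distinct elements; the value at [] is a dummy.

probability : ∀ {A : Set} → List A → (A → Bool) → ℚ
probability []       p = 0ℚ
probability (x ∷ xs) p = + length (filterᵇ p (x ∷ xs)) / length (x ∷ xs)

-- The predicate is a property of unlabelled graphs, so the labelling
-- chosen by `induced` is irrelevant.

record CanonicalTester : Set where
  field
    sampleComplexity : ℕ
    accepts          : ∀ {m} → Graph m → Bool
    accepts-≅        : ∀ {m} (G H : Graph m) → G ≅ H → accepts G ≡ accepts H

acceptanceProbability : CanonicalTester → ∀ {n} → Graph n → ℚ
acceptanceProbability T {n} G =
  probability (subsetsOfSize n (sampleComplexity ⊓ n)) (λ S → accepts (induced G S))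
  where open CanonicalTester T

-- T is an ε-tester for Π on graphs over n vertices, with acceptance
-- thresholds c₀ and c₁.

record IsTester (c₀ c₁ : ℚ) (ε : ℝ) (Π : GraphProperty) (n : ℕ)
                (T : CanonicalTester) : Set where
  field
    complete : ∀ (G : Graph n) → Π G → c₁ ≤ acceptanceProbability T G
    sound    : ∀ (G : Graph n) → Far ε Π G → acceptanceProbability T G ≤ c₀

{-# OPTIONS --safe #-}

-- A good partition of an induced subgraph G[S] is a labelling of S without
-- conflicts, a conflict being a pair of labelled vertices whose adjacency
-- is forbidden.  Given such a labelling c, using the set I of labels, add
-- vertices v of S with their labels to a fingerprint φ one at a time, always
-- choosing v so that (v , c v) kills the largest number of the pairs
-- (vertex , label in I) still alive, that is, not in conflict with φ.  There
-- are at most n k pairs, so after t = k 2ʲ steps each further vertex of S kills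
-- at most n / 2ʲ pairs.  Hence S lies in the container at level j, which
-- depends only on (I , φ): the vertices with an alive label of degree at most
-- n / 2ʲ.  Take the levels j ≤ J with 2ᴶ of order 1 / ε.
--
-- If every level j excludes less than the fraction 1 / (2ᴶ⁻ʲ (J + 1)) of the
-- vertices, give each vertex the low-degree label of the last level before
-- the first one that excludes it.  Each level then accounts for O(n² / (2ᴶ J))
-- conflicts, altogether O(n² / 2ᴶ) edits, and G is not ε-far from Π.
--
-- Otherwise S contains a fingerprint and lies in its small container.  There
-- are 2ᵏ (n choose t) kᵗ fingerprints of size t ≥ k, and a union bound shows
-- that this has probability at most 1/2 once |S| is of order
-- (k / ε) J log (k / ε).

module Submission where

open import Defs
open import Data.Bool.Base using (Bool; true; false; if_then_else_; _∧_; _∨_; not)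
import Data.Bool.Properties as Bool
open import Data.Fin.Base as Fin using (Fin; zero; suc; toℕ)
open import Data.Fin.Permutation as Perm using (_⟨$⟩ʳ_; _⟨$⟩ˡ_; inverseˡ; inverseʳ)
import Data.Fin.Properties as Fin
open import Data.Fin.Subset using (Subset; inside; outside; ∣_∣; _∈_)
open import Data.Fin.Subset.Properties using (_∈?_; drop-there; ∣p∣≡n⇒p≡⊤; ∈⊤)
import Data.Integer.Base as ℤ
import Data.Integer.Properties as ℤ
open import Data.List.Base as List using (List; []; _∷_; _++_; map; length; filter; filterᵇ; allFin; tabulate; cartesianProduct; cartesianProductWith)
import Data.List.Membership.Propositional as List using (_∈_)
import Data.List.Membership.Propositional.Properties as ∈
import Data.List.Properties as List
open import Data.List.Relation.Unary.Any using (here; there)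
open import Data.Maybe.Base using (Maybe; just; nothing)
import Data.Maybe.Relation.Unary.All as Maybe
open import Data.Nat.Base as ℕ using (ℕ; zero; suc; _+_; _*_; _^_; _∸_; _⊓_; _!; _≤_; _<_; z≤n; s≤s; NonZero)
open import Data.Nat.Combinatorics using (_C_; nCk+nC[k+1]≡[n+1]C[k+1]; nC1≡n; nCk≡n!/k![n-k]!; k![n∸k]!∣n!; k>n⇒nCk≡0)
open import Data.Nat.DivMod using (m/n*n≡m)
open import Data.Nat.ListAction using (sum)
open import Data.Nat.ListAction.Properties using (sum-++)
import Data.Nat.Properties as ℕ
open import Data.Nat.Tactic.RingSolver using (solve-∀)
open import Data.Product.Base using (∃; _×_; _,_; proj₁; proj₂; Σ-syntax; ∃-syntax)
open import Data.Rational.Base as ℚ using (ℚ; mkℚ; 0ℚ; 1ℚ; _/_) renaming (_≤_ to _≤ℚ_; _<_ to _<ℚ_; _*_ to _*ℚ_; _+_ to _+ℚ_)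
import Data.Rational.Properties as ℚ
open import Data.Rational.Solver using (module +-*-Solver)
import Data.Rational.Unnormalised.Base as ℚᵘ
import Data.Rational.Unnormalised.Properties as ℚᵘ
open import Data.Sum.Base using (_⊎_; inj₁; inj₂)
open import Data.Vec.Base as Vec using (Vec; []; _∷_; lookup)
import Data.Vec.Properties as Vec
open import Function.Base using (_∘_; id)
open import Function.Bundles using (mk⇔; Equivalence)
open import Relation.Binary.Definitions using (tri<; tri≈; tri>)
open import Relation.Binary.PropositionalEquality hiding (J; [_])
open import Relation.Nullary using (¬_; Dec; yes; no; does; ¬?; _×-dec_; contradiction)
open import Relation.Nullary.Decidable using (dec-true; dec-false; _→-dec_; map′; does-⇔)
open import Algebra.Properties.Semiring.Sum ℕ.+-*-semiring
  using (sum-syntax; sum-cong-≗; ∑-distrib-+; ∑-comm; *-distribˡ-sum; *-distribʳ-sum; sum-replicate-zero)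
open +-*-Solver using (solve; _:*_; _:+_; _:=_)

-- The bounds at (i , j) and at (j , i) are independent, so together they may forbid both adjacency
-- values, and then no edit repairs a conflict between these two labels. A labelling of the whole
-- graph may therefore combine only labels that already occur together in an accepted sample. This
-- is why `I` belongs to the fingerprint, at the price of a factor 2ᵏ.
--
-- The levels are balanced against each other. The number of further samples that level j needs is
-- the size k 2ʲ of its fingerprint, times the inverse 2ᴶ⁻ʲ (J + 1) of the excluded fraction, times
-- a logarithm B, and this is the same k 2ᴶ (J + 1) B for every j. A single level would pay k / ε
-- for the fingerprint and a further 1 / ε for the excluded fraction. One logarithm of the bound is
-- J + 1, the other is B.
--
-- As ln (k / ε) vanishes when k / ε tends to 1, values of ε close to 1 cannot be absorbed in the
-- constant. Above 1/2, however, no graph is far, and a tester without samples suffices.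

private variable
  A B P Q : Set
  n k : ℕ

-- Iverson brackets and finite sums

⟦_⟧ : Bool → ℕ
⟦ b ⟧ = if b then 1 else 0

1[_] : Dec P → ℕ
1[ p ] = ⟦ does p ⟧

1[]-yes : (p : Dec P) → P → 1[ p ] ≡ 1
1[]-yes p x = cong ⟦_⟧ (dec-true p x)

1[]-no : (p : Dec P) → ¬ P → 1[ p ] ≡ 0
1[]-no p ¬x = cong ⟦_⟧ (dec-false p ¬x)

⟦⟧≤1 : ∀ b → ⟦ b ⟧ ≤ 1
⟦⟧≤1 true  = ℕ.≤-refl
⟦⟧≤1 false = z≤n

1[]-mono : (p : Dec P) (q : Dec Q) → (P → Q) → 1[ p ] ≤ 1[ q ]
1[]-mono (yes x) q f = ℕ.≤-reflexive (sym (1[]-yes q (f x)))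
1[]-mono (no _)  q f = z≤n

1[]-cong : (p : Dec P) (q : Dec Q) → (P → Q) → (Q → P) → 1[ p ] ≡ 1[ q ]
1[]-cong p q f g = ℕ.≤-antisym (1[]-mono p q f) (1[]-mono q p g)

1[]-× : (p : Dec P) (q : Dec Q) → 1[ p ×-dec q ] ≡ 1[ p ] * 1[ q ]
1[]-× (yes _) (yes _) = refl
1[]-× (yes _) (no _)  = refl
1[]-× (no _)  _       = refl

∑-mono : {f g : Fin n → ℕ} → (∀ i → f i ≤ g i) → ∑[ i < n ] f i ≤ ∑[ i < n ] g i
∑-mono {zero}  f≤g = z≤n
∑-mono {suc n} f≤g = ℕ.+-mono-≤ (f≤g zero) (∑-mono (f≤g ∘ suc))

∑-const : ∀ n c → ∑[ i < n ] c ≡ n * c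
∑-const zero    c = refl
∑-const (suc n) c = cong (c +_) (∑-const n c)

∑-bound : {f : Fin n → ℕ} {c : ℕ} → (∀ i → f i ≤ c) → ∑[ i < n ] f i ≤ n * c
∑-bound {n} {c = c} f≤c = ℕ.≤-trans (∑-mono f≤c) (ℕ.≤-reflexive (∑-const n c))

term≤∑ : (f : Fin n → ℕ) (i : Fin n) → f i ≤ ∑[ j < n ] f j
term≤∑ f zero    = ℕ.m≤m+n _ _
term≤∑ f (suc i) = ℕ.≤-trans (term≤∑ (f ∘ suc) i) (ℕ.m≤n+m _ (f zero))

∑-zero : {f : Fin n → ℕ} → (∀ i → f i ≡ 0) → ∑[ i < n ] f i ≡ 0
∑-zero {n} f≡0 = trans (sum-cong-≗ f≡0) (sum-replicate-zero n)

sum-map-mono : {f g : A → ℕ} (xs : List A) → (∀ {x} → x List.∈ xs → f x ≤ g x) →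
               sum (map f xs) ≤ sum (map g xs)
sum-map-mono []       f≤g = z≤n
sum-map-mono (x ∷ xs) f≤g = ℕ.+-mono-≤ (f≤g (here refl)) (sum-map-mono xs (f≤g ∘ there))

sum-map-cong : {f g : A → ℕ} (xs : List A) → (∀ x → f x ≡ g x) → sum (map f xs) ≡ sum (map g xs)
sum-map-cong xs f≡g = cong sum (List.map-cong f≡g xs)

sum-map-zero : {f : A → ℕ} (xs : List A) → (∀ x → f x ≡ 0) → sum (map f xs) ≡ 0
sum-map-zero []       f≡0 = refl
sum-map-zero (x ∷ xs) f≡0 = cong₂ _+_ (f≡0 x) (sum-map-zero xs f≡0)

sum-map-+ : (f g : A → ℕ) (xs : List A) →
            sum (map (λ x → f x + g x) xs) ≡ sum (map f xs) + sum (map g xs)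
sum-map-+ f g []       = refl
sum-map-+ f g (x ∷ xs) rewrite sum-map-+ f g xs =
  swap (f x) (g x) (sum (map f xs)) (sum (map g xs))
  where
  swap : ∀ a b c d → a + b + (c + d) ≡ a + c + (b + d)
  swap = solve-∀

sum-map-comm : (f : A → B → ℕ) (xs : List A) (ys : List B) →
               sum (map (λ x → sum (map (f x) ys)) xs) ≡ sum (map (λ y → sum (map (λ x → f x y) xs)) ys)
sum-map-comm f []       ys = sym (sum-map-zero ys λ _ → refl)
sum-map-comm f (x ∷ xs) ys =
  trans (cong (sum (map (f x) ys) +_) (sum-map-comm f xs ys)) (sym (sum-map-+ (f x) _ ys))

sum-map-∑ : (f : A → Fin n → ℕ) (xs : List A) →
            sum (map (λ x → ∑[ i < n ] f x i) xs) ≡ ∑[ i < n ] sum (map (λ x → f x i) xs)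
sum-map-∑ {n = zero}  f xs = sum-map-zero xs λ _ → refl
sum-map-∑ {n = suc n} f xs =
  trans (sum-map-+ (λ x → f x zero) _ xs) (cong (sum (map (λ x → f x zero) xs) +_) (sum-map-∑ (λ x → f x ∘ suc) xs))

term≤sum-map : (f : A → ℕ) {x : A} {xs : List A} → x List.∈ xs → f x ≤ sum (map f xs)
term≤sum-map f (here refl) = ℕ.m≤m+n _ _
term≤sum-map f {xs = y ∷ _} (there p) = ℕ.≤-trans (term≤sum-map f p) (ℕ.m≤n+m _ (f y))

length-filterᵇ : (p : A → Bool) (xs : List A) → length (filterᵇ p xs) ≡ sum (map (⟦_⟧ ∘ p) xs)
length-filterᵇ p []       = refl
length-filterᵇ p (x ∷ xs) with p x
... | true  = cong suc (length-filterᵇ p xs)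
... | false = length-filterᵇ p xs

length-filter : {R : A → Set} (R? : ∀ x → Dec (R x)) (xs : List A) →
                length (filter R? xs) ≡ sum (map (λ x → 1[ R? x ]) xs)
length-filter R? []       = refl
length-filter R? (x ∷ xs) with does (R? x)
... | true  = cong suc (length-filter R? xs)
... | false = length-filter R? xs

sum-map-tabulate : (f : A → ℕ) (g : Fin n → A) → sum (map f (tabulate g)) ≡ ∑[ i < n ] f (g i)
sum-map-tabulate {n = zero}  f g = refl
sum-map-tabulate {n = suc n} f g = cong (f (g zero) +_) (sum-map-tabulate f (g ∘ suc))

sum-map-∘ : (f : B → ℕ) (g : A → B) (xs : List A) → sum (map f (map g xs)) ≡ sum (map (f ∘ g) xs)
sum-map-∘ f g xs = cong sum (sym (List.map-∘ xs))

sum-map-++ : (f : A → ℕ) (xs ys : List A) → sum (map f (xs ++ ys)) ≡ sum (map f xs) + sum (map f ys)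
sum-map-++ f xs ys = trans (cong sum (List.map-++ f xs ys)) (sum-++ (map f xs) (map f ys))

sum-map-cartesianProduct : (f : A × B → ℕ) (xs : List A) (ys : List B) →
  sum (map f (cartesianProduct xs ys)) ≡ sum (map (λ x → sum (map (λ y → f (x , y)) ys)) xs)
sum-map-cartesianProduct f []       ys = refl
sum-map-cartesianProduct f (x ∷ xs) ys =
  trans (sum-map-++ f (map (x ,_) ys) _) (cong₂ _+_ (sum-map-∘ f (x ,_) ys) (sum-map-cartesianProduct f xs ys))

length-filter-vertexPairs : {R : Fin n × Fin n → Set} (R? : ∀ p → Dec (R p)) →
  length (filter R? (vertexPairs n)) ≡ ∑[ x < n ] ∑[ y < n ] 1[ R? (x , y) ]
length-filter-vertexPairs {n} R? = begin
  length (filter R? (vertexPairs n))                                   ≡⟨ length-filter R? (vertexPairs n) ⟩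
  sum (map (λ p → 1[ R? p ]) (vertexPairs n))                          ≡⟨ sum-map-cartesianProduct (λ p → 1[ R? p ]) (allFin n) (allFin n) ⟩
  sum (map (λ x → sum (map (λ y → 1[ R? (x , y) ]) (allFin n))) (allFin n)) ≡⟨ sum-map-tabulate (λ x → sum (map (λ y → 1[ R? (x , y) ]) (allFin n))) (id {A = Fin n}) ⟩
  ∑[ x < n ] sum (map (λ y → 1[ R? (x , y) ]) (allFin n))              ≡⟨ sum-cong-≗ (λ x → sum-map-tabulate (λ y → 1[ R? (x , y) ]) id) ⟩
  ∑[ x < n ] ∑[ y < n ] 1[ R? (x , y) ]                                ∎
  where open ≡-Reasoning

-- Binomial coefficients

C-!-! : ∀ a b → ((a + b) C a) * (a ! * b !) ≡ (a + b) !
C-!-! a b = begin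
  ((a + b) C a) * (a ! * b !)                  ≡⟨ cong (λ c → ((a + b) C a) * (a ! * c !)) (ℕ.m+n∸m≡n a b) ⟨
  ((a + b) C a) * (a ! * (a + b ∸ a) !)        ≡⟨ cong (_* (a ! * (a + b ∸ a) !)) (nCk≡n!/k![n-k]! a≤a+b) ⟩
  _                                          ≡⟨ m/n*n≡m (k![n∸k]!∣n! a≤a+b) ⟩
  (a + b) !                                  ∎
  where
  open ≡-Reasoning
  a≤a+b = ℕ.m≤m+n a b
  instance _ = a ℕ.!* (a + b ∸ a) !≢0

-- Both sides are the multinomial coefficient `(t + (r + s)) ! / (t ! r ! s !)`: the r-set may be
-- chosen after the t-set, or the t-set inside the union of the two.
C-C-split : ∀ t r s → ((t + (r + s)) C t) * ((r + s) C r) ≡ ((t + (r + s)) C (t + r)) * ((t + r) C t)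
C-C-split t r s = ℕ.*-cancelʳ-≡ _ _ (t ! * (r ! * s !)) (begin
  (N C t) * ((r + s) C r) * (t ! * (r ! * s !))     ≡⟨ shuffle (N C t) ((r + s) C r) (t !) (r !) (s !) ⟩
  (N C t) * (t ! * (((r + s) C r) * (r ! * s !)))   ≡⟨ cong (λ z → (N C t) * (t ! * z)) (C-!-! r s) ⟩
  (N C t) * (t ! * (r + s) !)                     ≡⟨ C-!-! t (r + s) ⟩
  N !                                           ≡⟨ cong _! N≡ ⟨
  (t + r + s) !                                 ≡⟨ C-!-! (t + r) s ⟨
  ((t + r + s) C (t + r)) * ((t + r) ! * s !)     ≡⟨ cong₂ (λ u v → (u C (t + r)) * (v * s !)) N≡ (sym (C-!-! t r)) ⟩
  (N C (t + r)) * (((t + r) C t) * (t ! * r !) * s !) ≡⟨ shuffle′ (N C (t + r)) ((t + r) C t) (t !) (r !) (s !) ⟩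
  (N C (t + r)) * ((t + r) C t) * (t ! * (r ! * s !)) ∎)
  where
  open ≡-Reasoning
  N = t + (r + s)
  N≡ : t + r + s ≡ N
  N≡ = ℕ.+-assoc t r s
  shuffle : ∀ a b c d e → a * b * (c * (d * e)) ≡ a * (c * (b * (d * e)))
  shuffle = solve-∀
  shuffle′ : ∀ a b c d e → a * (b * (c * d) * e) ≡ a * b * (c * (d * e))
  shuffle′ = solve-∀
  instance
    _ = t ℕ.!≢0
    _ = r ℕ.!* s !≢0
    _ = ℕ.m*n≢0 (t !) (r ! * s !)

C≤^ : ∀ m t → m C t ≤ m ^ t
C≤^ m       zero    = ℕ.≤-refl
C≤^ zero    (suc t) = ℕ.≤-reflexive (k>n⇒nCk≡0 {0} {suc t} (s≤s z≤n))
C≤^ (suc m) (suc t) = begin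
  suc m C suc t         ≡⟨ nCk+nC[k+1]≡[n+1]C[k+1] m t ⟨
  m C t + m C suc t     ≤⟨ ℕ.+-mono-≤ (C≤^ m t) (C≤^ m (suc t)) ⟩
  suc m * m ^ t         ≤⟨ ℕ.*-monoʳ-≤ (suc m) (ℕ.^-monoˡ-≤ t (ℕ.n≤1+n m)) ⟩
  suc m * suc m ^ t     ∎
  where open ℕ.≤-Reasoning

-- A t-set followed by r of the other N elements is a (t + r)-set with a marked t-subset, and there
-- are at most `(t + r) ^ t` ways to mark it. This trades the number of fingerprint domains, which
-- depends on n, for a power of the sample size.
C-C≤ : ∀ t N r → ((t + N) C t) * (N C r) ≤ ((t + N) C (t + r)) * (t + r) ^ t
C-C≤ t N r with r ℕ.≤? N
... | no r≰N = ℕ.≤-trans (ℕ.≤-reflexive (trans (cong (((t + N) C t) *_) (k>n⇒nCk≡0 (ℕ.≰⇒> r≰N))) (ℕ.*-zeroʳ ((t + N) C t)))) z≤n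
... | yes r≤N = begin
  ((t + N) C t) * (N C r)                       ≡⟨ cong (λ M → ((t + M) C t) * (M C r)) (ℕ.m+[n∸m]≡n r≤N) ⟨
  ((t + (r + s)) C t) * ((r + s) C r)           ≡⟨ C-C-split t r s ⟩
  ((t + (r + s)) C (t + r)) * ((t + r) C t)     ≤⟨ ℕ.*-monoʳ-≤ ((t + (r + s)) C (t + r)) (C≤^ (t + r) t) ⟩
  ((t + (r + s)) C (t + r)) * (t + r) ^ t       ≡⟨ cong (λ M → ((t + M) C (t + r)) * (t + r) ^ t) (ℕ.m+[n∸m]≡n r≤N) ⟩
  ((t + N) C (t + r)) * (t + r) ^ t  ∎
  where
  open ℕ.≤-Reasoning
  s = N ∸ r

C-absorb : ∀ q r → suc r * (suc q C suc r) ≡ suc q * (q C r)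
C-absorb q r with r ℕ.≤? q
... | no r≰q rewrite k>n⇒nCk≡0 (ℕ.≰⇒> r≰q) | k>n⇒nCk≡0 (s≤s (ℕ.≰⇒> r≰q)) = trans (ℕ.*-zeroʳ (suc r)) (sym (ℕ.*-zeroʳ (suc q)))
... | yes r≤q = begin
  suc r * (suc q C suc r)         ≡⟨ ℕ.*-comm (suc r) _ ⟩
  (suc q C suc r) * suc r           ≡⟨ cong ((suc q C suc r) *_) (nC1≡n (suc r)) ⟨
  (suc q C suc r) * (suc r C 1)     ≡⟨ subst (λ z → (suc z C 1) * (z C r) ≡ (suc z C suc r) * (suc r C 1)) (ℕ.m+[n∸m]≡n r≤q) (C-C-split 1 r (q ∸ r)) ⟨
  (suc q C 1) * (q C r)             ≡⟨ cong (_* (q C r)) (nC1≡n (suc q)) ⟩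
  suc q * (q C r)                 ∎
  where open ≡-Reasoning

-- Each factor (q - i) / (N - i) of the quotient of the two binomials is at most w′ / (w′ + 1):
-- lowering q and N by one takes `suc w′` from the left of the hypothesis but only `w′` from the
-- right.
C-ratio : ∀ w′ q N r → suc w′ * q ≤ w′ * N → suc w′ ^ r * (q C r) ≤ w′ ^ r * (N C r)
C-ratio w′ q       N       zero    wq≤w′N = ℕ.≤-refl
C-ratio w′ zero    N       (suc r) wq≤w′N =
  ℕ.≤-trans (ℕ.≤-reflexive (trans (cong (suc w′ ^ suc r *_) (k>n⇒nCk≡0 {0} {suc r} (s≤s z≤n))) (ℕ.*-zeroʳ (suc w′ ^ suc r)))) z≤n
C-ratio w′ (suc q) zero    (suc r) wq≤w′N =
  contradiction (ℕ.≤-trans wq≤w′N (ℕ.≤-reflexive (ℕ.*-zeroʳ w′))) λ ()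
C-ratio w′ (suc q) (suc N) (suc r) wq≤w′N = ℕ.*-cancelˡ-≤ (suc r) (begin
  suc r * (w * w ^ r * (suc q C suc r))     ≡⟨ pull (suc r) w (w ^ r) _ ⟩
  w * w ^ r * (suc r * (suc q C suc r))     ≡⟨ cong (w * w ^ r *_) (C-absorb q r) ⟩
  w * w ^ r * (suc q * (q C r))             ≡⟨ swap w (w ^ r) (suc q) (q C r) ⟩
  w * suc q * (w ^ r * (q C r))             ≤⟨ ℕ.*-mono-≤ wq≤w′N (C-ratio w′ q N r wq≤w′N-1) ⟩
  w′ * suc N * (w′ ^ r * (N C r))           ≡⟨ swap w′ (w′ ^ r) (suc N) (N C r) ⟨
  w′ * w′ ^ r * (suc N * (N C r))           ≡⟨ cong (w′ * w′ ^ r *_) (C-absorb N r) ⟨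
  w′ * w′ ^ r * (suc r * (suc N C suc r))   ≡⟨ pull (suc r) w′ (w′ ^ r) _ ⟨
  suc r * (w′ * w′ ^ r * (suc N C suc r))   ∎)
  where
  open ℕ.≤-Reasoning
  w = suc w′
  pull : ∀ a b c d → a * (b * c * d) ≡ b * c * (a * d)
  pull = solve-∀
  swap : ∀ a b c d → a * b * (c * d) ≡ a * c * (b * d)
  swap = solve-∀
  wq≤w′N-1 : w * q ≤ w′ * N
  wq≤w′N-1 = ℕ.+-cancelˡ-≤ w′ _ _ (begin
    w′ + w * q     ≤⟨ ℕ.+-monoˡ-≤ (w * q) (ℕ.n≤1+n w′) ⟩
    w + w * q      ≡⟨ ℕ.*-suc w q ⟨
    w * suc q      ≤⟨ wq≤w′N ⟩
    w′ * suc N     ≡⟨ ℕ.*-suc w′ N ⟩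
    w′ + w′ * N    ∎)

-- Counting subsets

private
  filter-inside : ∀ m (Ss : List (Subset n)) →
    filter (λ S → ∣ S ∣ ℕ.≟ suc m) (map (inside ∷_) Ss) ≡ map (inside ∷_) (filter (λ S → ∣ S ∣ ℕ.≟ m) Ss)
  filter-inside m []       = refl
  filter-inside m (S ∷ Ss) with does (∣ S ∣ ℕ.≟ m)
  ... | true  = cong (_ ∷_) (filter-inside m Ss)
  ... | false = filter-inside m Ss

  filter-inside-0 : ∀ (Ss : List (Subset n)) → filter (λ S → ∣ S ∣ ℕ.≟ 0) (map (inside ∷_) Ss) ≡ []
  filter-inside-0 []       = refl
  filter-inside-0 (S ∷ Ss) = filter-inside-0 Ss

  filter-outside : ∀ m (Ss : List (Subset n)) →
    filter (λ S → ∣ S ∣ ℕ.≟ m) (map (outside ∷_) Ss) ≡ map (outside ∷_) (filter (λ S → ∣ S ∣ ℕ.≟ m) Ss)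
  filter-outside m []       = refl
  filter-outside m (S ∷ Ss) with does (∣ S ∣ ℕ.≟ m)
  ... | true  = cong (_ ∷_) (filter-outside m Ss)
  ... | false = filter-outside m Ss

subsetsOfSize-zero : ∀ n → subsetsOfSize (suc n) 0 ≡ map (outside ∷_) (subsetsOfSize n 0)
subsetsOfSize-zero n = trans (List.filter-++ _ (map (inside ∷_) (subsets n)) _)
  (cong₂ _++_ (filter-inside-0 (subsets n)) (filter-outside 0 (subsets n)))

subsetsOfSize-suc : ∀ n m → subsetsOfSize (suc n) (suc m) ≡
  map (inside ∷_) (subsetsOfSize n m) ++ map (outside ∷_) (subsetsOfSize n (suc m))
subsetsOfSize-suc n m = trans (List.filter-++ _ (map (inside ∷_) (subsets n)) _)
  (cong₂ _++_ (filter-inside m (subsets n)) (filter-outside (suc m) (subsets n)))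

sum-subsetsOfSize-zero : (f : Subset (suc n) → ℕ) →
  sum (map f (subsetsOfSize (suc n) 0)) ≡ sum (map (f ∘ (outside ∷_)) (subsetsOfSize n 0))
sum-subsetsOfSize-zero {n} f = trans (cong (sum ∘ map f) (subsetsOfSize-zero n)) (sum-map-∘ f _ (subsetsOfSize n 0))

sum-subsetsOfSize-suc : ∀ m (f : Subset (suc n) → ℕ) → sum (map f (subsetsOfSize (suc n) (suc m))) ≡
  sum (map (f ∘ (inside ∷_)) (subsetsOfSize n m)) + sum (map (f ∘ (outside ∷_)) (subsetsOfSize n (suc m)))
sum-subsetsOfSize-suc {n} m f = trans (cong (sum ∘ map f) (subsetsOfSize-suc n m))
  (trans (sum-map-++ f (map (inside ∷_) (subsetsOfSize n m)) _)
    (cong₂ _+_ (sum-map-∘ f _ (subsetsOfSize n m)) (sum-map-∘ f _ (subsetsOfSize n (suc m)))))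

length-subsetsOfSize : ∀ n m → length (subsetsOfSize n m) ≡ n C m
length-subsetsOfSize zero    zero    = refl
length-subsetsOfSize zero    (suc m) = sym (k>n⇒nCk≡0 {0} {suc m} (s≤s z≤n))
length-subsetsOfSize (suc n) zero    = trans (cong length (subsetsOfSize-zero n))
  (trans (List.length-map _ (subsetsOfSize n 0)) (length-subsetsOfSize n 0))
length-subsetsOfSize (suc n) (suc m) = begin
  length (subsetsOfSize (suc n) (suc m))                       ≡⟨ cong length (subsetsOfSize-suc n m) ⟩
  length (map (inside ∷_) (subsetsOfSize n m) ++ map (outside ∷_) (subsetsOfSize n (suc m)))
    ≡⟨ List.length-++ (map (inside ∷_) (subsetsOfSize n m)) ⟩
  length (map (inside ∷_) (subsetsOfSize n m)) + length (map (outside ∷_) (subsetsOfSize n (suc m)))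
    ≡⟨ cong₂ _+_ (List.length-map _ (subsetsOfSize n m)) (List.length-map _ (subsetsOfSize n (suc m))) ⟩
  length (subsetsOfSize n m) + length (subsetsOfSize n (suc m))
    ≡⟨ cong₂ _+_ (length-subsetsOfSize n m) (length-subsetsOfSize n (suc m)) ⟩
  n C m + n C suc m                                            ≡⟨ nCk+nC[k+1]≡[n+1]C[k+1] n m ⟩
  suc n C suc m                                                ∎
  where open ≡-Reasoning

length-subsets : ∀ n → length (subsets n) ≡ 2 ^ n
length-subsets zero    = refl
length-subsets (suc n) = trans (List.length-++ (map (inside ∷_) (subsets n)))
  (cong₂ _+_ (trans (List.length-map _ (subsets n)) (length-subsets n))
    (trans (List.length-map _ (subsets n)) (trans (length-subsets n) (sym (ℕ.+-identityʳ _)))))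

∈-subsets : (S : Subset n) → S List.∈ subsets n
∈-subsets []            = here refl
∈-subsets (inside ∷ S)  = ∈.∈-++⁺ˡ (∈.∈-map⁺ (inside ∷_) (∈-subsets S))
∈-subsets {suc n} (outside ∷ S) = ∈.∈-++⁺ʳ (map (inside ∷_) (subsets n)) (∈.∈-map⁺ (outside ∷_) (∈-subsets S))

-- Partial labellings

PartialLabelling : ℕ → ℕ → Set
PartialLabelling n k = Vec (Maybe (Fin k)) n

size : PartialLabelling n k → ℕ
size []            = 0
size (just _ ∷ φ)  = suc (size φ)
size (nothing ∷ φ) = size φ

partialLabellings : ∀ n k → ℕ → List (PartialLabelling n k)
partialLabellings zero    k zero    = [] ∷ []
partialLabellings zero    k (suc t) = []
partialLabellings (suc n) k zero    = map (nothing ∷_) (partialLabellings n k zero)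
partialLabellings (suc n) k (suc t) = map (nothing ∷_) (partialLabellings n k (suc t)) ++
  cartesianProductWith (λ i φ → just i ∷ φ) (allFin k) (partialLabellings n k t)

∈-partialLabellings : (φ : PartialLabelling n k) → φ List.∈ partialLabellings n k (size φ)
∈-partialLabellings []            = here refl
∈-partialLabellings {suc n} {k} (just i ∷ φ)  = ∈.∈-++⁺ʳ (map (nothing ∷_) (partialLabellings n k (suc (size φ))))
  (∈.∈-cartesianProductWith⁺ (λ i φ → just i ∷ φ) (∈.∈-allFin i) (∈-partialLabellings φ))
∈-partialLabellings (nothing ∷ φ) with size φ | ∈-partialLabellings φ
... | zero  | φ∈ = ∈.∈-map⁺ (nothing ∷_) φ∈
... | suc t | φ∈ = ∈.∈-++⁺ˡ (∈.∈-map⁺ (nothing ∷_) φ∈)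

length-cartesianProductWith : {R : Set} (f : A → B → R) (xs : List A) (ys : List B) →
  length (cartesianProductWith f xs ys) ≡ length xs * length ys
length-cartesianProductWith f []       ys = refl
length-cartesianProductWith f (x ∷ xs) ys = trans (List.length-++ (map (f x) ys))
  (cong₂ _+_ (List.length-map (f x) ys) (length-cartesianProductWith f xs ys))

length-partialLabellings : ∀ n k (t : ℕ) → length (partialLabellings n k t) ≡ (n C t) * k ^ t
length-partialLabellings zero    k zero    = refl
length-partialLabellings zero    k (suc t) = sym (cong (_* k ^ suc t) (k>n⇒nCk≡0 {0} {suc t} (s≤s z≤n)))
length-partialLabellings (suc n) k zero    =
  trans (List.length-map _ (partialLabellings n k 0)) (length-partialLabellings n k 0)
length-partialLabellings (suc n) k (suc t) = begin
  length (partialLabellings (suc n) k (suc t))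
    ≡⟨ List.length-++ (map (nothing ∷_) (partialLabellings n k (suc t))) ⟩
  length (map {B = PartialLabelling (suc n) k} (nothing ∷_) (partialLabellings n k (suc t))) +
    length (cartesianProductWith {C = PartialLabelling (suc n) k} (λ i φ → just i ∷ φ) (allFin k) (partialLabellings n k t))
    ≡⟨ cong₂ _+_ (List.length-map _ (partialLabellings n k (suc t)))
                 (length-cartesianProductWith _ (allFin k) (partialLabellings n k t)) ⟩
  length (partialLabellings n k (suc t)) + length (allFin k) * length (partialLabellings n k t)
    ≡⟨ cong₂ _+_ (length-partialLabellings n k (suc t))
                 (cong₂ _*_ (List.length-tabulate (id {A = Fin k})) (length-partialLabellings n k t)) ⟩
  (n C suc t) * (k * k ^ t) + k * ((n C t) * k ^ t)    ≡⟨ collect (n C suc t) k (k ^ t) (n C t) ⟩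
  (n C t + n C suc t) * (k * k ^ t)                ≡⟨ cong (_* (k * k ^ t)) (nCk+nC[k+1]≡[n+1]C[k+1] n t) ⟩
  (suc n C suc t) * (k * k ^ t)                      ∎
  where
  open ≡-Reasoning
  collect : ∀ a b c d → a * (b * c) + b * (d * c) ≡ (d + a) * (b * c)
  collect = solve-∀

-- Decides dom φ ⊆ S ⊆ D.

fits : PartialLabelling n k → (Fin n → Bool) → Subset n → Bool
fits []            D []      = true
fits (just _ ∷ φ)  D (s ∷ S) = s ∧ D zero ∧ fits φ (D ∘ suc) S
fits (nothing ∷ φ) D (s ∷ S) = (not s ∨ D zero) ∧ fits φ (D ∘ suc) S

fits-true : (φ : PartialLabelling n k) (D : Fin n → Bool) (S : Subset n) →
  (∀ x {i} → lookup φ x ≡ just i → x ∈ S) → (∀ {x} → x ∈ S → D x ≡ true) → fits φ D S ≡ true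
fits-true []            D []      dom⊆S S⊆D = refl
fits-true (just i ∷ φ)  D (s ∷ S) dom⊆S S⊆D with dom⊆S zero refl
... | Vec.here = cong₂ _∧_ (S⊆D Vec.here) (fits-true φ (D ∘ suc) S (λ x eq → drop-there (dom⊆S (suc x) eq)) (S⊆D ∘ Vec.there))
fits-true (nothing ∷ φ) D (s ∷ S) dom⊆S S⊆D = cong₂ _∧_ (ok s S⊆D) (fits-true φ (D ∘ suc) S (λ x eq → drop-there (dom⊆S (suc x) eq)) (S⊆D ∘ Vec.there))
  where
  ok : ∀ s → (∀ {x} → x ∈ (s ∷ S) → D x ≡ true) → not s ∨ D zero ≡ true
  ok true  S⊆D = S⊆D Vec.here
  ok false S⊆D = refl

isNothing : Maybe A → ℕ
isNothing (just _) = 0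
isNothing nothing  = 1

-- A set that fits φ and `D` is determined by its choice among these vertices, as those labelled by
-- φ are forced into it.
freeIn : PartialLabelling n k → (Fin n → Bool) → ℕ
freeIn {n} φ D = ∑[ x < n ] (isNothing (lookup φ x) * ⟦ D x ⟧)

-- shiftedC f m t is f C (m ∸ t), except that it vanishes for m < t.

shiftedC : ℕ → ℕ → ℕ → ℕ
shiftedC f m       zero    = f C m
shiftedC f zero    (suc t) = 0
shiftedC f (suc m) (suc t) = shiftedC f m t

shiftedC-Pascal : ∀ f m t → shiftedC f m t + shiftedC f (suc m) t ≡ shiftedC (suc f) (suc m) t
shiftedC-zero : ∀ f t → shiftedC f 0 t ≡ shiftedC (suc f) 0 t
shiftedC-Pascal f m       zero    = nCk+nC[k+1]≡[n+1]C[k+1] f m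
shiftedC-Pascal f zero    (suc t) = shiftedC-zero f t
shiftedC-Pascal f (suc m) (suc t) = shiftedC-Pascal f m t
shiftedC-zero f zero    = refl
shiftedC-zero f (suc t) = refl

shiftedC-+ : ∀ f t r → shiftedC f (t + r) t ≡ f C r
shiftedC-+ f zero    r = refl
shiftedC-+ f (suc t) r = shiftedC-+ f t r

-- With `size φ` elements forced, the others form an (m ∸ size φ)-subset of the free vertices. This
-- is only an inequality because nothing fits when φ labels a vertex outside `D`.
∑-fits : ∀ m (φ : PartialLabelling n k) (D : Fin n → Bool) →
  sum (map (λ S → ⟦ fits φ D S ⟧) (subsetsOfSize n m)) ≤ shiftedC (freeIn φ D) m (size φ)
∑-fits zero    []            D = ℕ.≤-refl
∑-fits (suc m) []            D = z≤n
∑-fits {suc n} zero    (just i ∷ φ)  D = ℕ.≤-reflexive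
  (trans (sum-subsetsOfSize-zero (λ S → ⟦ fits (just i ∷ φ) D S ⟧)) (sum-map-zero (subsetsOfSize n 0) λ _ → refl))
∑-fits {suc n} (suc m) (just i ∷ φ)  D = begin
  sum (map (λ S → ⟦ fits (just i ∷ φ) D S ⟧) (subsetsOfSize (suc n) (suc m)))
    ≡⟨ sum-subsetsOfSize-suc m (λ S → ⟦ fits (just i ∷ φ) D S ⟧) ⟩
  sum (map (λ S → ⟦ D zero ∧ fits φ (D ∘ suc) S ⟧) (subsetsOfSize n m)) + sum (map (λ S → 0) (subsetsOfSize n (suc m)))
    ≡⟨ cong (sum (map (λ S → ⟦ D zero ∧ fits φ (D ∘ suc) S ⟧) (subsetsOfSize n m)) +_) (sum-map-zero (subsetsOfSize n (suc m)) λ _ → refl) ⟩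
  sum (map (λ S → ⟦ D zero ∧ fits φ (D ∘ suc) S ⟧) (subsetsOfSize n m)) + 0
    ≡⟨ ℕ.+-identityʳ _ ⟩
  sum (map (λ S → ⟦ D zero ∧ fits φ (D ∘ suc) S ⟧) (subsetsOfSize n m))
    ≤⟨ sum-map-mono (subsetsOfSize n m) (λ {S} _ → ∧-drop (D zero) (fits φ (D ∘ suc) S)) ⟩
  sum (map (λ S → ⟦ fits φ (D ∘ suc) S ⟧) (subsetsOfSize n m))
    ≤⟨ ∑-fits m φ (D ∘ suc) ⟩
  shiftedC (freeIn φ (D ∘ suc)) m (size φ) ∎
  where
  open ℕ.≤-Reasoning
  ∧-drop : ∀ a b → ⟦ a ∧ b ⟧ ≤ ⟦ b ⟧
  ∧-drop true  b = ℕ.≤-refl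
  ∧-drop false b = z≤n
∑-fits {suc n} zero    (nothing ∷ φ) D = ℕ.≤-trans
  (ℕ.≤-reflexive (sum-subsetsOfSize-zero (λ S → ⟦ fits (nothing ∷ φ) D S ⟧)))
  (ℕ.≤-trans (∑-fits zero φ (D ∘ suc)) (ℕ.≤-reflexive (lem (D zero))))
  where
  lem : ∀ b → shiftedC (freeIn φ (D ∘ suc)) 0 (size φ) ≡ shiftedC (⟦ b ⟧ + 0 + freeIn φ (D ∘ suc)) 0 (size φ)
  lem true  = shiftedC-zero (freeIn φ (D ∘ suc)) (size φ)
  lem false = refl
∑-fits {suc n} (suc m) (nothing ∷ φ) D = begin
  sum (map (λ S → ⟦ fits (nothing ∷ φ) D S ⟧) (subsetsOfSize (suc n) (suc m)))
    ≡⟨ sum-subsetsOfSize-suc m (λ S → ⟦ fits (nothing ∷ φ) D S ⟧) ⟩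
  sum (map (λ S → ⟦ D zero ∧ fits φ (D ∘ suc) S ⟧) (subsetsOfSize n m)) + sum (map (λ S → ⟦ fits φ (D ∘ suc) S ⟧) (subsetsOfSize n (suc m)))
    ≤⟨ ℕ.+-monoʳ-≤ (sum (map (λ S → ⟦ D zero ∧ fits φ (D ∘ suc) S ⟧) (subsetsOfSize n m))) (∑-fits (suc m) φ (D ∘ suc)) ⟩
  sum (map (λ S → ⟦ D zero ∧ fits φ (D ∘ suc) S ⟧) (subsetsOfSize n m)) + shiftedC F (suc m) (size φ)
    ≤⟨ lem (D zero) ⟩
  shiftedC (⟦ D zero ⟧ + 0 + F) (suc m) (size φ) ∎
  where
  open ℕ.≤-Reasoning
  F = freeIn φ (D ∘ suc)
  lem : ∀ b → sum (map (λ S → ⟦ b ∧ fits φ (D ∘ suc) S ⟧) (subsetsOfSize n m)) + shiftedC F (suc m) (size φ)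
            ≤ shiftedC (⟦ b ⟧ + 0 + F) (suc m) (size φ)
  lem true  = ℕ.≤-trans (ℕ.+-monoˡ-≤ (shiftedC F (suc m) (size φ)) (∑-fits m φ (D ∘ suc)))
    (ℕ.≤-reflexive (shiftedC-Pascal F m (size φ)))
  lem false = ℕ.≤-reflexive (cong (_+ shiftedC F (suc m) (size φ)) (sum-map-zero (subsetsOfSize n m) λ _ → refl))

-- Containers

argmax : ∀ {n} {P : Fin n → Set} → (∀ x → Dec (P x)) → (f : Fin n → ℕ) → ∃ P →
         ∃[ x ] P x × (∀ y → P y → f y ≤ f x)
argmax {suc n} P? f (x , px) with Fin.any? (P? ∘ suc)
argmax P? f (zero  , p0) | no ∄ = zero , p0 , λ { zero _ → ℕ.≤-refl ; (suc y) py → contradiction (y , py) ∄ }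
argmax P? f (suc x , px) | no ∄ = contradiction (x , px) ∄
... | yes ∃P with argmax (P? ∘ suc) (f ∘ suc) ∃P
...   | m , pm , max with P? zero | f zero ℕ.≤? f (suc m)
...     | no ¬p0 | _       = suc m , pm , λ { zero p → contradiction p ¬p0 ; (suc y) → max y }
...     | yes p0 | yes ≤m  = suc m , pm , λ { zero _ → ≤m ; (suc y) → max y }
...     | yes p0 | no  ≰m  = zero , p0 , λ { zero _ → ℕ.≤-refl ; (suc y) py → ℕ.≤-trans (max y py) (ℕ.<⇒≤ (ℕ.≰⇒> ≰m)) }

size-update : ∀ {n k} (φ : PartialLabelling n k) v {i} → lookup φ v ≡ nothing →
              size (φ Vec.[ v ]≔ just i) ≡ suc (size φ)
size-update (nothing ∷ φ) zero    eq = refl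
size-update (just _ ∷ φ)  (suc v) eq = cong suc (size-update φ v eq)
size-update (nothing ∷ φ) (suc v) eq = size-update φ v eq

size-replicate : ∀ n {k} → size (Vec.replicate n (nothing {A = Fin k})) ≡ 0
size-replicate zero    = refl
size-replicate (suc n) = size-replicate n

∣∣≤size : ∀ {n k} (φ : PartialLabelling n k) (S : Subset n) →
          (∀ {x} → x ∈ S → lookup φ x ≢ nothing) → ∣ S ∣ ≤ size φ
∣∣≤size []            []            dom = z≤n
∣∣≤size (just _ ∷ φ)  (inside ∷ S)  dom = s≤s (∣∣≤size φ S (dom ∘ Vec.there))
∣∣≤size (just _ ∷ φ)  (outside ∷ S) dom = ℕ.m≤n⇒m≤1+n (∣∣≤size φ S (dom ∘ Vec.there))
∣∣≤size (nothing ∷ φ) (inside ∷ S)  dom = contradiction refl (dom Vec.here)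
∣∣≤size (nothing ∷ φ) (outside ∷ S) dom = ∣∣≤size φ S (dom ∘ Vec.there)

is-nothing? : (m : Maybe A) → Dec (m ≡ nothing)
is-nothing? (just _) = no λ ()
is-nothing? nothing  = yes refl

module Containers {n k : ℕ} (conf : Fin n → Fin k → Fin n → Fin k → Bool) where

  Alive : Subset k → PartialLabelling n k → Fin n → Fin k → Set
  Alive I φ u j = j ∈ I × (∀ v → Maybe.All (λ i → conf v i u j ≡ false) (lookup φ v))

  alive? : ∀ I φ u j → Dec (Alive I φ u j)
  alive? I φ u j = j ∈? I ×-dec Fin.all? (λ v → Maybe.dec (λ i → conf v i u j Bool.≟ false) (lookup φ v))

  alive# : Subset k → PartialLabelling n k → ℕ
  alive# I φ = ∑[ u < n ] ∑[ j < k ] 1[ alive? I φ u j ]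

  degree : Subset k → PartialLabelling n k → Fin n → Fin k → ℕ
  degree I φ v i = ∑[ u < n ] ∑[ j < k ] (1[ alive? I φ u j ] * ⟦ conf v i u j ⟧)

  degree-mono : ∀ I φ ψ → (∀ {u j} → Alive I ψ u j → Alive I φ u j) → ∀ v i → degree I ψ v i ≤ degree I φ v i
  degree-mono I φ ψ ψ⇒φ v i = ∑-mono λ u → ∑-mono λ j →
    ℕ.*-monoˡ-≤ ⟦ conf v i u j ⟧ (1[]-mono (alive? I ψ u j) (alive? I φ u j) ψ⇒φ)

  -- A pair in conflict with (v , i) is no longer alive once φ contains (v , i).
  degree-labelled : ∀ I φ {v i} → lookup φ v ≡ just i → degree I φ v i ≡ 0
  degree-labelled I φ {v} {i} eq = ∑-zero λ u → ∑-zero λ j → vanish u j (alive? I φ u j)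
    where
    unjust : ∀ {P : Fin k → Set} {m} → m ≡ just i → Maybe.All P m → P i
    unjust refl (Maybe.just p) = p
    vanish : ∀ u j (a? : Dec (Alive I φ u j)) → 1[ a? ] * ⟦ conf v i u j ⟧ ≡ 0
    vanish u j (yes a) = cong (λ b → ⟦ b ⟧ + 0) (unjust eq (proj₂ a v))
    vanish u j (no _)  = refl

  alive-update : ∀ {I} φ v {i} → lookup φ v ≡ nothing → ∀ {u j} →
    Alive I (φ Vec.[ v ]≔ just i) u j → Alive I φ u j × conf v i u j ≡ false
  alive-update φ v {i} eq {u} {j} (j∈I , ok) = (j∈I , ok′) , new
    where
    new : conf v i u j ≡ false
    new with subst (Maybe.All (λ l → conf v l u j ≡ false)) (Vec.lookup∘updateAt v φ) (ok v)
    ... | Maybe.just p = p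
    ok′ : ∀ x → Maybe.All (λ l → conf x l u j ≡ false) (lookup φ x)
    ok′ x with x Fin.≟ v
    ... | yes refl = subst (Maybe.All _) (sym eq) Maybe.nothing
    ... | no x≢v   = subst (Maybe.All _) (Vec.lookup∘update′ x≢v φ (just i)) (ok x)

  alive-update⁻ : ∀ {I} φ v {i u j} → Alive I φ u j → conf v i u j ≡ false → Alive I (φ Vec.[ v ]≔ just i) u j
  alive-update⁻ φ v {i} {u} {j} (j∈I , ok) new = j∈I , ok′
    where
    ok′ : ∀ x → Maybe.All (λ l → conf x l u j ≡ false) (lookup (φ Vec.[ v ]≔ just i) x)
    ok′ x with x Fin.≟ v
    ... | yes refl = subst (Maybe.All _) (sym (Vec.lookup∘updateAt v φ)) (Maybe.just new)
    ... | no x≢v   = subst (Maybe.All _) (sym (Vec.lookup∘update′ x≢v φ (just i))) (ok x)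

  alive#-update : ∀ I φ v i → lookup φ v ≡ nothing →
    alive# I (φ Vec.[ v ]≔ just i) + degree I φ v i ≡ alive# I φ
  alive#-update I φ v i eq = trans (sym (∑-distrib-+ {n} _ _)) (sum-cong-≗ λ u →
    trans (sym (∑-distrib-+ {k} _ _)) (sum-cong-≗ λ j → pointwise u j (conf v i u j) refl))
    where
    φ′ = φ Vec.[ v ]≔ just i
    pointwise : ∀ u j b → conf v i u j ≡ b → 1[ alive? I φ′ u j ] + 1[ alive? I φ u j ] * ⟦ b ⟧ ≡ 1[ alive? I φ u j ]
    pointwise u j true  c≡ = cong₂ _+_ (1[]-no (alive? I φ′ u j) (λ a → contradiction (trans (sym c≡) (proj₂ (alive-update φ v eq a))) λ ()))
      (ℕ.*-identityʳ _)
    pointwise u j false c≡ = trans (cong₂ _+_ (1[]-cong (alive? I φ′ u j) (alive? I φ u j) (proj₁ ∘ alive-update φ v eq) (λ a → alive-update⁻ φ v a c≡)) (ℕ.*-zeroʳ 1[ alive? I φ u j ]))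
      (ℕ.+-identityʳ _)

  alive#≤ : ∀ I φ → alive# I φ ≤ n * k
  alive#≤ I φ = ∑-bound {n} λ u → ℕ.≤-trans (∑-bound {k} {c = 1} (λ j → ⟦⟧≤1 (does (alive? I φ u j)))) (ℕ.≤-reflexive (ℕ.*-identityʳ k))

  Contained : ℕ → Subset k → PartialLabelling n k → Fin n → Set
  Contained j I φ v = ∃[ i ] Alive I φ v i × 2 ^ j * degree I φ v i ≤ n

  contained? : ∀ j I φ v → Dec (Contained j I φ v)
  contained? j I φ v = Fin.any? λ i → alive? I φ v i ×-dec 2 ^ j * degree I φ v i ℕ.≤? n

  container : ℕ → Subset k → PartialLabelling n k → Fin n → Bool
  container j I φ v = does (contained? j I φ v)

  excluded : ℕ → Subset k → PartialLabelling n k → ℕ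
  excluded j I φ = ∑[ v < n ] ⟦ not (container j I φ v) ⟧

  module Greedy {S : Subset n} {I : Subset k} (c : Fin n → Fin k)
                (c∈I : ∀ {x} → x ∈ S → c x ∈ I)
                (valid : ∀ {x y} → x ∈ S → y ∈ S → conf x (c x) y (c y) ≡ false) where

    -- `degree-bound` is a potential argument: each of the t steps killed at least as many pairs as
    -- any vertex of S would kill now, because degrees only decrease. When S runs out of unlabelled
    -- vertices, the labelling stays fixed while t still grows, hence the hypothesis of `φ-size`.
    record State (t : ℕ) : Set where
      field
        φ          : PartialLabelling n k
        φ-size     : t ≤ ∣ S ∣ → size φ ≡ t
        φ-agrees   : ∀ x {i} → lookup φ x ≡ just i → x ∈ S × i ≡ c x
        degree-bound : ∀ {x} → x ∈ S → alive# I φ + t * degree I φ x (c x) ≤ n * k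

    open State

    initial : State 0
    initial .φ = Vec.replicate n nothing
    initial .φ-size _ = size-replicate n
    initial .φ-agrees x eq = contradiction (trans (sym eq) (Vec.lookup-replicate x nothing)) λ ()
    initial .degree-bound _ = ℕ.≤-trans (ℕ.≤-reflexive (ℕ.+-identityʳ _)) (alive#≤ I (initial .φ))

    unlabelled? : ∀ φ → Dec (∃[ v ] v ∈ S × lookup φ v ≡ nothing)
    unlabelled? φ = Fin.any? λ v → v ∈? S ×-dec is-nothing? {A = Fin k} (lookup φ v)

    degree-outside : ∀ {t} (s : State t) {x i} → lookup (φ s) x ≡ just i → degree I (φ s) x (c x) ≡ 0
    degree-outside s {x} eq with refl ← proj₂ (φ-agrees s x eq) = degree-labelled I (φ s) eq

    step : ∀ {t} (s : State t) → Σ[ s′ ∈ State (suc t) ] (∀ {u j} → Alive I (φ s′) u j → Alive I (φ s) u j)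
    step {t} s with unlabelled? (φ s)
    ... | no ∄ = record
      { φ = φ s
      ; φ-size = λ t<S → contradiction (ℕ.≤-trans (∣∣≤size (φ s) S (λ x∈S eq → ∄ (_ , x∈S , eq))) (ℕ.≤-reflexive (φ-size s (ℕ.<⇒≤ t<S)))) (ℕ.<⇒≱ t<S)
      ; φ-agrees = φ-agrees s
      -- No vertex of S is unlabelled, so the degrees vanish whatever t is, and `alive#≤` is enough.
      ; degree-bound = λ {x} x∈S → ℕ.≤-trans (ℕ.≤-reflexive (trans (cong (λ d → alive# I (φ s) + suc t * d) (zero-degree x x∈S))
          (trans (cong (alive# I (φ s) +_) (ℕ.*-zeroʳ t)) (ℕ.+-identityʳ _)))) (alive#≤ I (φ s))
      } , λ a → a
      where
      zero-degree : ∀ x → x ∈ S → degree I (φ s) x (c x) ≡ 0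
      zero-degree x x∈S with lookup (φ s) x in eq
      ... | just _  = degree-outside s eq
      ... | nothing = contradiction (x , x∈S , eq) ∄
    ... | yes ∃v with argmax (λ v → v ∈? S ×-dec is-nothing? {A = Fin k} (lookup (φ s) v)) (λ v → degree I (φ s) v (c v)) ∃v
    ... | v , (v∈S , v∉dom) , maximal = record
      { φ = φ′
      ; φ-size = λ t<S → trans (size-update (φ s) v v∉dom) (cong suc (φ-size s (ℕ.<⇒≤ t<S)))
      ; φ-agrees = agrees
      ; degree-bound = bound
      } , shrink
      where
      φ′ = φ s Vec.[ v ]≔ just (c v)
      δ = degree I (φ s) v (c v)
      shrink : ∀ {u j} → Alive I φ′ u j → Alive I (φ s) u j
      shrink a = proj₁ (alive-update (φ s) v v∉dom a)
      agrees : ∀ x {i} → lookup φ′ x ≡ just i → x ∈ S × i ≡ c x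
      agrees x {i} eq with x Fin.≟ v
      ... | yes refl with refl ← trans (sym eq) (Vec.lookup∘updateAt v (φ s)) = v∈S , refl
      ... | no x≢v = φ-agrees s x (trans (sym (Vec.lookup∘update′ x≢v (φ s) (just (c v)))) eq)
      ≤δ : ∀ x → x ∈ S → degree I (φ s) x (c x) ≤ δ
      ≤δ x x∈S with lookup (φ s) x in eq
      ... | just _  = ℕ.≤-trans (ℕ.≤-reflexive (degree-outside s eq)) z≤n
      ... | nothing = maximal x (x∈S , eq)
      -- Every current degree is at most δ, the old degree of the chosen v. One copy of δ is what
      -- adding v killed; the other t copies are covered by the old bound at v itself.
      bound : ∀ {x} → x ∈ S → alive# I φ′ + suc t * degree I φ′ x (c x) ≤ n * k
      bound {x} x∈S = begin
        alive# I φ′ + suc t * degree I φ′ x (c x)  ≤⟨ ℕ.+-monoʳ-≤ (alive# I φ′) (ℕ.*-monoʳ-≤ (suc t) (ℕ.≤-trans (degree-mono I (φ s) φ′ shrink x (c x)) (≤δ x x∈S))) ⟩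
        alive# I φ′ + (δ + t * δ)                  ≡⟨ ℕ.+-assoc (alive# I φ′) δ (t * δ) ⟨
        alive# I φ′ + δ + t * δ                    ≡⟨ cong (_+ t * δ) (alive#-update I (φ s) v (c v) v∉dom) ⟩
        alive# I (φ s) + t * δ                     ≤⟨ degree-bound s v∈S ⟩
        n * k                                      ∎
        where open ℕ.≤-Reasoning

    run : ∀ t → State t
    run zero    = initial
    run (suc t) = proj₁ (step (run t))

    run-mono : ∀ {s t} → s ℕ.≤′ t → ∀ {u j} → Alive I (φ (run t)) u j → Alive I (φ (run s)) u j
    run-mono ℕ.≤′-refl     a = a
    run-mono (ℕ.≤′-step p) a = run-mono p (proj₂ (step (run _)) a)

    -- Stage 0 is the empty labelling, and level j is stage suc j.

    time : ℕ → ℕ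
    time zero    = 0
    time (suc j) = k * 2 ^ j

    time-mono : ∀ {r s} → r ≤ s → time r ≤ time s
    time-mono z≤n       = z≤n
    time-mono (s≤s r≤s) = ℕ.*-monoʳ-≤ k (ℕ.^-monoʳ-≤ 2 r≤s)

    stage : ℕ → PartialLabelling n k
    stage r = φ (run (time r))

    level : ℕ → PartialLabelling n k
    level j = stage (suc j)

    stage-mono : ∀ {r s} → r ≤ s → ∀ {u j} → Alive I (stage s) u j → Alive I (stage r) u j
    stage-mono r≤s = run-mono (ℕ.≤⇒≤′ (time-mono r≤s))

    size-level : ∀ j → k * 2 ^ j ≤ ∣ S ∣ → size (level j) ≡ k * 2 ^ j
    size-level j = φ-size (run (time (suc j)))

    S⊆container : .{{NonZero k}} → ∀ j {x} → x ∈ S → container j I (level j) x ≡ true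
    S⊆container j {x} x∈S = dec-true (contained? j I (level j) x) (c x , (c∈I x∈S , λ v → free v (lookup (level j) v) refl) , low)
      where
      s = run (time (suc j))
      free : ∀ v m → lookup (level j) v ≡ m → Maybe.All (λ i → conf v i x (c x) ≡ false) m
      free v nothing  eq = Maybe.nothing
      free v (just i) eq with refl ← proj₂ (φ-agrees s v eq) = Maybe.just (valid (proj₁ (φ-agrees s v eq)) x∈S)
      low : 2 ^ j * degree I (level j) x (c x) ≤ n
      low = ℕ.*-cancelˡ-≤ k (begin
        k * (2 ^ j * d)                        ≡⟨ ℕ.*-assoc k (2 ^ j) d ⟨
        k * 2 ^ j * d                          ≤⟨ ℕ.m≤n+m _ (alive# I (level j)) ⟩
        alive# I (level j) + k * 2 ^ j * d     ≤⟨ degree-bound s x∈S ⟩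
        n * k                                  ≡⟨ ℕ.*-comm n k ⟩
        k * n                                  ∎)
        where
        open ℕ.≤-Reasoning
        d = degree I (level j) x (c x)

    level-fits : .{{NonZero k}} → ∀ j → fits (level j) (container j I (level j)) S ≡ true
    level-fits j = fits-true (level j) (container j I (level j)) S
      (λ x eq → proj₁ (φ-agrees (run (time (suc j))) x eq)) (S⊆container j)

-- Rounding the containers to a labelling of all vertices

does⇒ : {P : Set} (p : Dec P) → does p ≡ true → P
does⇒ (yes x) _ = x

-- A container at level j is small if it excludes at least a 1 / weight j
-- fraction of the vertices.

module Levels (J : ℕ) where

  W : ℕ
  W = suc J

  weight : ℕ → ℕ
  weight j = 2 ^ (J ∸ j) * W

module Rounding {n k : ℕ} (conf : Fin n → Fin k → Fin n → Fin k → Bool)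
                (conf-sym : ∀ x i y j → conf x i y j ≡ conf y j x i)
                {S : Subset n} {I : Subset k} (c : Fin n → Fin k)
                (c∈I : ∀ {x} → x ∈ S → c x ∈ I)
                (valid : ∀ {x y} → x ∈ S → y ∈ S → conf x (c x) y (c y) ≡ false)
                (J : ℕ) {i₀ : Fin k} (i₀∈I : i₀ ∈ I) where

  open Containers conf
  open Greedy {S} {I} c c∈I valid

  open Levels J

  -- Ranks number stages. If `rank ≤ J`, the level of that number, which is the next stage, excludes
  -- v, while the label comes from the stage `rank`, one level earlier. At rank 0 this is the empty
  -- labelling, where every label in I is alive and only the trivial cost bound n is available. Rank
  -- `suc J` is for vertices that no level excludes.
  record Choice (v : Fin n) : Set where
    field
      rank       : ℕ
      rank≤      : rank ≤ suc J
      excluded-at : rank ≤ J → container rank I (level rank) v ≡ false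
      label      : Fin k
      alive      : Alive I (stage rank) v label
      cheap      : rank ≡ 0 ⊎ ∃[ j ] rank ≡ suc j × 2 ^ j * degree I (stage rank) v label ≤ n

  open Choice

  first-exclusion : ∀ v N → ∃[ r ] r ≤ N × (r < N → container r I (level r) v ≡ false) ×
    (r ≡ 0 ⊎ ∃[ j ] r ≡ suc j × container j I (level j) v ≡ true)
  first-exclusion v zero = 0 , z≤n , (λ ()) , inj₁ refl
  first-exclusion v (suc N) with first-exclusion v N
  ... | r , r≤N , out , before with ℕ.m≤n⇒m<n∨m≡n r≤N
  ...   | inj₁ r<N  = r , ℕ.m≤n⇒m≤1+n r≤N , (λ _ → out r<N) , before
  ...   | inj₂ refl with container N I (level N) v in eq
  ...     | true  = suc N , ℕ.≤-refl , (λ N<N → contradiction N<N (ℕ.<-irrefl refl)) , inj₂ (N , refl , eq)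
  ...     | false = N , ℕ.n≤1+n N , (λ _ → eq) , before

  choose : ∀ v → Choice v
  choose v with first-exclusion v (suc J)
  ... | r , r≤ , out , inj₁ refl = record
    { rank = 0 ; rank≤ = r≤ ; excluded-at = λ p → out (s≤s p) ; label = i₀
    ; alive = i₀∈I , λ x → subst (Maybe.All _) (sym (Vec.lookup-replicate x nothing)) Maybe.nothing
    ; cheap = inj₁ refl }
  ... | r , r≤ , out , inj₂ (j , refl , in-j) with does⇒ (contained? j I (level j) v) in-j
  ...   | i , a , low = record
    { rank = suc j ; rank≤ = r≤ ; excluded-at = λ p → out (s≤s p) ; label = i
    ; alive = a ; cheap = inj₂ (j , refl , low) }

  rk : Fin n → ℕ
  rk v = rank (choose v)

  assign : Fin n → Fin k
  assign v = label (choose v)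

  assign∈I : ∀ v → assign v ∈ I
  assign∈I v = proj₁ (alive (choose v))

  -- A conflict is charged to its endpoint of smaller rank, at whose
  -- stage the label of the other endpoint was still alive.

  charge : Fin n → Fin n → ℕ
  charge v u = 1[ rk v ℕ.≤? rk u ] * ⟦ conf v (assign v) u (assign u) ⟧

  charge≤1 : ∀ v u → charge v u ≤ 1
  charge≤1 v u = ℕ.*-mono-≤ (⟦⟧≤1 (does (rk v ℕ.≤? rk u))) (⟦⟧≤1 (conf v (assign v) u (assign u)))

  cost : Fin n → ℕ
  cost v = ∑[ u < n ] charge v u

  cost≤degree : ∀ v → cost v ≤ degree I (stage (rk v)) v (assign v)
  cost≤degree v = ∑-mono λ u → ℕ.≤-trans
    (ℕ.*-monoˡ-≤ ⟦ conf v (assign v) u (assign u) ⟧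
      (1[]-mono (rk v ℕ.≤? rk u) (alive? I (stage (rk v)) u (assign u)) (λ p → stage-mono p (alive (choose u)))))
    (term≤∑ (λ j → 1[ alive? I (stage (rk v)) u j ] * ⟦ conf v (assign v) u j ⟧) (assign u))

  cost≤n : ∀ v → cost v ≤ n
  cost≤n v = ℕ.≤-trans (∑-bound {n} {c = 1} (charge≤1 v)) (ℕ.≤-reflexive (ℕ.*-identityʳ n))

  -- The factor 2 absorbs the shift between stages and levels: rank `suc j` only guarantees degree
  -- at most n / 2ʲ.
  cost-rank : ∀ v → cost v * 2 ^ rk v ≤ 2 * n
  cost-rank v with cheap (choose v)
  ... | inj₁ r≡0 = begin
    cost v * 2 ^ rk v  ≡⟨ cong (λ r → cost v * 2 ^ r) r≡0 ⟩
    cost v * 1         ≡⟨ ℕ.*-identityʳ (cost v) ⟩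
    cost v             ≤⟨ cost≤n v ⟩
    n                  ≤⟨ ℕ.m≤m+n n (n + 0) ⟩
    2 * n              ∎
    where open ℕ.≤-Reasoning
  ... | inj₂ (j , r≡1+j , low) = begin
    cost v * 2 ^ rk v      ≡⟨ cong (λ r → cost v * 2 ^ r) r≡1+j ⟩
    cost v * (2 * 2 ^ j)   ≡⟨ shuffle (cost v) (2 ^ j) ⟩
    2 * (2 ^ j * cost v)   ≤⟨ ℕ.*-monoʳ-≤ 2 (ℕ.≤-trans (ℕ.*-monoʳ-≤ (2 ^ j) (cost≤degree v)) low) ⟩
    2 * n                  ∎
    where
    open ℕ.≤-Reasoning
    shuffle : ∀ a b → a * (2 * b) ≡ 2 * (b * a)
    shuffle = solve-∀

  -- A vertex of rank j ≤ J costs at most 2 n / 2ʲ, which becomes 4 n · `weight j` after scaling by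
  -- 2ᴶ⁺¹ W. With this scale, a level whose container is not small contributes at most 4 n² in
  -- total. Summing over all levels that exclude v overcounts, but removes the dependence on its
  -- rank.
  excess : Fin n → ℕ → ℕ
  excess v j = ⟦ not (container j I (level j) v) ⟧ * (4 * n * weight j)

  cost-weighted : ∀ v → cost v * (2 ^ suc J * W) ≤ ∑[ j < suc J ] excess v (toℕ j) + 2 * n * W
  cost-weighted v with rk v ℕ.≤? J
  ... | yes r≤J = begin
    cost v * (2 * 2 ^ J * W)                        ≡⟨ cong (λ e → cost v * (2 * 2 ^ e * W)) (ℕ.m+[n∸m]≡n r≤J) ⟨
    cost v * (2 * 2 ^ (rk v + (J ∸ rk v)) * W)      ≡⟨ cong (λ e → cost v * (2 * e * W)) (ℕ.^-distribˡ-+-* 2 (rk v) (J ∸ rk v)) ⟩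
    cost v * (2 * (2 ^ rk v * 2 ^ (J ∸ rk v)) * W)  ≡⟨ shuffle (cost v) (2 ^ rk v) (2 ^ (J ∸ rk v)) W ⟩
    cost v * 2 ^ rk v * (2 * weight (rk v))         ≤⟨ ℕ.*-monoˡ-≤ (2 * weight (rk v)) (cost-rank v) ⟩
    2 * n * (2 * weight (rk v))                     ≡⟨ shuffle′ n (weight (rk v)) ⟩
    1 * (4 * n * weight (rk v))                     ≡⟨ cong (λ b → ⟦ not b ⟧ * (4 * n * weight (rk v))) (excluded-at (choose v) r≤J) ⟨
    excess v (rk v)                                 ≡⟨ cong (excess v) (Fin.toℕ-fromℕ< (s≤s r≤J)) ⟨
    excess v (toℕ (Fin.fromℕ< (s≤s r≤J)))           ≤⟨ term≤∑ (excess v ∘ toℕ) (Fin.fromℕ< (s≤s r≤J)) ⟩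
    ∑[ j < suc J ] excess v (toℕ j)                 ≤⟨ ℕ.m≤m+n _ (2 * n * W) ⟩
    ∑[ j < suc J ] excess v (toℕ j) + 2 * n * W     ∎
    where
    open ℕ.≤-Reasoning
    shuffle : ∀ a b c d → a * (2 * (b * c) * d) ≡ a * b * (2 * (c * d))
    shuffle = solve-∀
    shuffle′ : ∀ a b → 2 * a * (2 * b) ≡ 1 * (4 * a * b)
    shuffle′ = solve-∀
  ... | no r≰J = begin
    cost v * (2 ^ suc J * W)                        ≡⟨ cong (λ r → cost v * (2 ^ r * W)) (ℕ.≤-antisym (ℕ.≰⇒> r≰J) (rank≤ (choose v))) ⟩
    cost v * (2 ^ rk v * W)                         ≡⟨ ℕ.*-assoc (cost v) _ W ⟨
    cost v * 2 ^ rk v * W                           ≤⟨ ℕ.*-monoˡ-≤ W (cost-rank v) ⟩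
    2 * n * W                                       ≤⟨ ℕ.m≤n+m _ _ ⟩
    ∑[ j < suc J ] excess v (toℕ j) + 2 * n * W     ∎
    where open ℕ.≤-Reasoning

  conflicts : ℕ
  conflicts = ∑[ v < n ] ∑[ u < n ] ⟦ conf v (assign v) u (assign u) ⟧

  conflicts≤ : conflicts ≤ 2 * ∑[ v < n ] cost v
  conflicts≤ = begin
    conflicts                                                      ≤⟨ ∑-mono (λ v → ∑-mono (λ u → split v u)) ⟩
    ∑[ v < n ] ∑[ u < n ] (charge v u + charge u v)                ≡⟨ sum-cong-≗ (λ v → ∑-distrib-+ (charge v) (λ u → charge u v)) ⟩
    ∑[ v < n ] (cost v + ∑[ u < n ] charge u v)                    ≡⟨ ∑-distrib-+ cost (λ v → ∑[ u < n ] charge u v) ⟩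
    ∑[ v < n ] cost v + ∑[ v < n ] ∑[ u < n ] charge u v           ≡⟨ cong (∑[ v < n ] cost v +_) (∑-comm (λ v u → charge u v)) ⟩
    ∑[ v < n ] cost v + ∑[ v < n ] cost v                          ≡⟨ cong (∑[ v < n ] cost v +_) (ℕ.+-identityʳ _) ⟨
    2 * ∑[ v < n ] cost v                                          ∎
    where
    open ℕ.≤-Reasoning
    split : ∀ v u → ⟦ conf v (assign v) u (assign u) ⟧ ≤ charge v u + charge u v
    split v u with ℕ.≤-total (rk v) (rk u)
    ... | inj₁ p = ℕ.≤-trans (ℕ.≤-reflexive (sym (trans (cong (_* ⟦ conf v (assign v) u (assign u) ⟧) (1[]-yes (rk v ℕ.≤? rk u) p)) (ℕ.+-identityʳ _))))
      (ℕ.m≤m+n (charge v u) (charge u v))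
    ... | inj₂ p = ℕ.≤-trans (ℕ.≤-reflexive (trans (cong ⟦_⟧ (conf-sym v (assign v) u (assign u)))
        (sym (trans (cong (_* ⟦ conf u (assign u) v (assign v) ⟧) (1[]-yes (rk u ℕ.≤? rk v) p)) (ℕ.+-identityʳ _)))))
      (ℕ.m≤n+m (charge u v) (charge v u))

  few-conflicts : (∀ j → j ≤ J → excluded j I (level j) * weight j ≤ n) → conflicts * 2 ^ J ≤ 6 * (n * n)
  few-conflicts sparse = ℕ.*-cancelʳ-≤ _ _ W (begin
    conflicts * 2 ^ J * W                     ≤⟨ ℕ.*-monoˡ-≤ W (ℕ.*-monoˡ-≤ (2 ^ J) conflicts≤) ⟩
    2 * (∑[ v < n ] cost v) * 2 ^ J * W       ≡⟨ shuffle (∑[ v < n ] cost v) (2 ^ J) W ⟩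
    (∑[ v < n ] cost v) * (2 ^ suc J * W)     ≡⟨ *-distribʳ-sum (2 ^ suc J * W) cost ⟩
    ∑[ v < n ] (cost v * (2 ^ suc J * W))     ≤⟨ ∑-mono cost-weighted ⟩
    ∑[ v < n ] (∑[ j < suc J ] excess v (toℕ j) + 2 * n * W)
      ≡⟨ ∑-distrib-+ (λ v → ∑[ j < suc J ] excess v (toℕ j)) (λ _ → 2 * n * W) ⟩
    ∑[ v < n ] ∑[ j < suc J ] excess v (toℕ j) + ∑[ v < n ] (2 * n * W)
      ≡⟨ cong₂ _+_ (∑-comm (λ v (j : Fin (suc J)) → excess v (toℕ j))) (∑-const n (2 * n * W)) ⟩
    ∑[ j < suc J ] ∑[ v < n ] excess v (toℕ j) + n * (2 * n * W)
      ≤⟨ ℕ.+-monoˡ-≤ (n * (2 * n * W)) (∑-bound {suc J} {c = 4 * n * n} level-excess) ⟩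
    -- The number of levels equals the factor `W` in every weight. After division by `W`, all levels
    -- together give 4 n², and the terms `2 * n * W` of the vertices give 2 n².
    suc J * (4 * n * n) + n * (2 * n * W)     ≡⟨ collect n W ⟩
    6 * (n * n) * W                           ∎)
    where
    open ℕ.≤-Reasoning
    shuffle : ∀ a b c → 2 * a * b * c ≡ a * (2 * b * c)
    shuffle = solve-∀
    collect : ∀ a b → b * (4 * a * a) + a * (2 * a * b) ≡ 6 * (a * a) * b
    collect = solve-∀
    regroup : ∀ a b c → a * (4 * b * c) ≡ 4 * b * (a * c)
    regroup = solve-∀
    level-excess : ∀ (j : Fin (suc J)) → ∑[ v < n ] excess v (toℕ j) ≤ 4 * n * n
    level-excess j = begin
      ∑[ v < n ] excess v (toℕ j)               ≡⟨ *-distribʳ-sum (4 * n * weight (toℕ j)) (λ v → ⟦ not (container (toℕ j) I (level (toℕ j)) v) ⟧) ⟨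
      excluded (toℕ j) I (level (toℕ j)) * (4 * n * weight (toℕ j))   ≡⟨ regroup (excluded (toℕ j) I (level (toℕ j))) n (weight (toℕ j)) ⟩
      4 * n * (excluded (toℕ j) I (level (toℕ j)) * weight (toℕ j))   ≤⟨ ℕ.*-monoʳ-≤ (4 * n) (sparse (toℕ j) (Fin.toℕ≤pred[n] j)) ⟩
      4 * n * n                                 ∎

-- Exponential decay and the union bound over fingerprints

^-distribʳ-* : ∀ m n o → (m * n) ^ o ≡ m ^ o * n ^ o
^-distribʳ-* m n zero    = refl
^-distribʳ-* m n (suc o) = trans (cong (m * n *_) (^-distribʳ-* m n o)) (shuffle m n (m ^ o) (n ^ o))
  where
  shuffle : ∀ a b c d → a * b * (c * d) ≡ a * c * (b * d)
  shuffle = solve-∀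

Bernoulli : ∀ a m → a ^ suc m + suc m * a ^ m ≤ suc a ^ suc m
Bernoulli a zero    = ℕ.≤-reflexive (base a)
  where
  base : ∀ a → a * 1 + 1 ≡ suc a * 1
  base = solve-∀
Bernoulli a (suc m) = begin
  a * (a * p) + suc (suc m) * (a * p)                        ≤⟨ ℕ.m≤m+n _ (suc m * p) ⟩
  a * (a * p) + suc (suc m) * (a * p) + suc m * p            ≡⟨ expand a p (suc m) ⟩
  suc a * (a * p + suc m * p)                                ≤⟨ ℕ.*-monoʳ-≤ (suc a) (Bernoulli a m) ⟩
  suc a * suc a ^ suc m                                      ∎
  where
  open ℕ.≤-Reasoning
  p = a ^ m
  expand : ∀ a p s → a * (a * p) + suc s * (a * p) + s * p ≡ suc a * (a * p + s * p)
  expand = solve-∀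

-- (1 − 1/w)ʷ ≤ 1/2

2*pred^≤^ : ∀ w′ → 2 * w′ ^ suc w′ ≤ suc w′ ^ suc w′
2*pred^≤^ w′ = begin
  w′ * w′ ^ w′ + (w′ * w′ ^ w′ + 0)    ≡⟨ cong (w′ * w′ ^ w′ +_) (ℕ.+-identityʳ _) ⟩
  w′ * w′ ^ w′ + w′ * w′ ^ w′          ≤⟨ ℕ.+-monoʳ-≤ (w′ * w′ ^ w′) (ℕ.*-monoˡ-≤ (w′ ^ w′) (ℕ.n≤1+n w′)) ⟩
  w′ ^ suc w′ + suc w′ * w′ ^ w′       ≤⟨ Bernoulli w′ w′ ⟩
  suc w′ ^ suc w′                      ∎
  where open ℕ.≤-Reasoning

-- The exponent r contains e blocks of length `suc w′`, and each block of factors 1 - 1 / (w′ + 1)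
-- contributes at most 1/2.
pred-decay : ∀ w′ e r → suc w′ * e ≤ r → 2 ^ e * w′ ^ r ≤ suc w′ ^ r
pred-decay w′ e r we≤r = begin
  2 ^ e * w′ ^ r                              ≡⟨ cong (λ r → 2 ^ e * w′ ^ r) (ℕ.m+[n∸m]≡n we≤r) ⟨
  2 ^ e * w′ ^ (w * e + s)                    ≡⟨ cong (2 ^ e *_) (ℕ.^-distribˡ-+-* w′ (w * e) s) ⟩
  2 ^ e * (w′ ^ (w * e) * w′ ^ s)             ≡⟨ ℕ.*-assoc (2 ^ e) _ _ ⟨
  2 ^ e * w′ ^ (w * e) * w′ ^ s               ≡⟨ cong (λ z → 2 ^ e * z * w′ ^ s) (ℕ.^-*-assoc w′ w e) ⟨
  2 ^ e * (w′ ^ w) ^ e * w′ ^ s               ≡⟨ cong (_* w′ ^ s) (^-distribʳ-* 2 (w′ ^ w) e) ⟨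
  (2 * w′ ^ w) ^ e * w′ ^ s                   ≤⟨ ℕ.*-mono-≤ (ℕ.^-monoˡ-≤ e (2*pred^≤^ w′)) (ℕ.^-monoˡ-≤ s (ℕ.n≤1+n w′)) ⟩
  (w ^ w) ^ e * w ^ s                         ≡⟨ cong (_* w ^ s) (ℕ.^-*-assoc w w e) ⟩
  w ^ (w * e) * w ^ s                         ≡⟨ ℕ.^-distribˡ-+-* w (w * e) s ⟨
  w ^ (w * e + s)                             ≡⟨ cong (w ^_) (ℕ.m+[n∸m]≡n we≤r) ⟩
  w ^ r                                       ∎
  where
  open ℕ.≤-Reasoning
  w = suc w′
  s = r ∸ w * e

≤^-self : ∀ x t → .{{NonZero x}} → 1 ≤ t → x ≤ x ^ t
≤^-self x (suc t) _ = ℕ.m≤m*n x (x ^ t) {{ℕ.m^n≢0 x t}}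

freeIn+excluded+size : ∀ {n k} (φ : PartialLabelling n k) (D : Fin n → Bool) →
  (∀ x {i} → lookup φ x ≡ just i → D x ≡ true) →
  freeIn φ D + ∑[ x < n ] ⟦ not (D x) ⟧ + size φ ≡ n
freeIn+excluded+size []            D dom⊆D = refl
freeIn+excluded+size {suc n} (just _ ∷ φ)  D dom⊆D rewrite dom⊆D zero refl =
  trans (ℕ.+-suc _ (size φ)) (cong suc (freeIn+excluded+size φ (D ∘ suc) (dom⊆D ∘ suc)))
freeIn+excluded+size {suc n} (nothing ∷ φ) D dom⊆D with D zero
... | true  = cong suc (freeIn+excluded+size φ (D ∘ suc) (dom⊆D ∘ suc))
... | false = trans (cong (_+ size φ) (ℕ.+-suc (freeIn φ (D ∘ suc)) _)) (cong suc (freeIn+excluded+size φ (D ∘ suc) (dom⊆D ∘ suc)))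

-- The first summand lets the greedy choice reach level J before S is exhausted. The second pays for
-- the union bound: for every level j ≤ J it equals (k 2ʲ) · `weight j` · B, so that avoiding the
-- excluded vertices of a small container has probability at most 2 to the power -B k 2ʲ.
sampleSize : ℕ → ℕ → ℕ → ℕ
sampleSize k J B = k * 2 ^ J + k * 2 ^ J * suc J * B

module UnionBound {n k : ℕ} .{{_ : NonZero k}} (conf : Fin n → Fin k → Fin n → Fin k → Bool) (J B : ℕ) where

  open Containers conf

  open Levels J

  time : ℕ → ℕ
  time j = k * 2 ^ j

  m : ℕ
  m = sampleSize k J B

  -- The last condition says that the container is small. The first two hold for every labelling
  -- that the greedy choice produces; they are recorded here because the union bound ranges over all
  -- partial labellings and has no other access to them.
  Bad : ℕ → Subset k → PartialLabelling n k → Set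
  Bad j I φ = size φ ≡ time j ×
              freeIn φ (container j I φ) + excluded j I φ + time j ≡ n ×
              n ≤ excluded j I φ * weight j

  bad? : ∀ j I φ → Dec (Bad j I φ)
  bad? j I φ = size φ ℕ.≟ time j ×-dec
    (freeIn φ (container j I φ) + excluded j I φ + time j ℕ.≟ n ×-dec n ℕ.≤? excluded j I φ * weight j)

  hit : ℕ → Subset k × PartialLabelling n k → Subset n → ℕ
  hit j (I , φ) S = 1[ bad? j I φ ] * ⟦ fits φ (container j I φ) S ⟧

  fingerprints : ℕ → List (Subset k × PartialLabelling n k)
  fingerprints j = cartesianProduct (subsets k) (partialLabellings n k (time j))

  hits : ℕ → Subset n → ℕ
  hits j S = sum (map (λ f → hit j f S) (fingerprints j))

  -- Once `dom φ` is fixed, the other r sampled vertices must fall among the q free vertices of the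
  -- container, out of `q + e ≡ n ∸ time j`. Smallness of the container gives q ≤ w′ e, so this is
  -- at most a w′ / (w′ + 1) fraction of them.
  ∑hit≤ : ∀ j w′ r → weight j ≡ suc w′ → m ≡ time j + r → ∀ f →
    suc w′ ^ r * sum (map (hit j f) (subsetsOfSize n m)) ≤ w′ ^ r * ((n ∸ time j) C r)
  ∑hit≤ j w′ r w≡ m≡ (I , φ) = bounded (bad? j I φ)
   where
   bounded : (d : Dec (Bad j I φ)) →
     suc w′ ^ r * sum (map (λ S → 1[ d ] * ⟦ fits φ (container j I φ) S ⟧) (subsetsOfSize n m)) ≤ w′ ^ r * ((n ∸ time j) C r)
   bounded (no _) = ℕ.≤-trans (ℕ.≤-reflexive (trans (cong (suc w′ ^ r *_) (sum-map-zero (subsetsOfSize n m) λ _ → refl)) (ℕ.*-zeroʳ (suc w′ ^ r)))) z≤n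
   bounded (yes (size≡ , split , large)) = begin
     suc w′ ^ r * sum (map (λ S → ⟦ fits φ D S ⟧ + 0) (subsetsOfSize n m))
       ≡⟨ cong (suc w′ ^ r *_) (sum-map-cong (subsetsOfSize n m) (λ S → ℕ.+-identityʳ _)) ⟩
     suc w′ ^ r * sum (map (λ S → ⟦ fits φ D S ⟧) (subsetsOfSize n m))
       ≤⟨ ℕ.*-monoʳ-≤ (suc w′ ^ r) (∑-fits m φ D) ⟩
     suc w′ ^ r * shiftedC q m (size φ)
       ≡⟨ cong (suc w′ ^ r *_) (trans (cong₂ (shiftedC q) m≡ size≡) (shiftedC-+ q (time j) r)) ⟩
     suc w′ ^ r * (q C r)
       ≤⟨ C-ratio w′ q (q + e) r ratio ⟩
     w′ ^ r * ((q + e) C r)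
       ≡⟨ cong (λ N → w′ ^ r * (N C r)) (trans (sym (ℕ.m+n∸n≡m (q + e) (time j))) (cong (_∸ time j) split)) ⟩
     w′ ^ r * ((n ∸ time j) C r) ∎
     where
     open ℕ.≤-Reasoning
     D = container j I φ
     q = freeIn φ D
     e = excluded j I φ
     q≤ : q ≤ w′ * e
     q≤ = ℕ.+-cancelʳ-≤ e q (w′ * e) (begin
       q + e                    ≤⟨ ℕ.m≤m+n (q + e) (time j) ⟩
       q + e + time j           ≡⟨ split ⟩
       n                        ≤⟨ large ⟩
       e * weight j             ≡⟨ cong (e *_) w≡ ⟩
       e * suc w′               ≡⟨ trans (ℕ.*-comm e (suc w′)) (ℕ.+-comm e (w′ * e)) ⟩
       w′ * e + e               ∎)
     ratio : suc w′ * q ≤ w′ * (q + e)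
     ratio = ℕ.≤-trans (ℕ.+-monoˡ-≤ (w′ * q) q≤) (ℕ.≤-reflexive (trans (ℕ.+-comm (w′ * e) (w′ * q)) (sym (ℕ.*-distribˡ-+ w′ q e))))

  length-fingerprints : ∀ j → length (fingerprints j) ≡ 2 ^ k * ((n C time j) * k ^ time j)
  length-fingerprints j = trans (length-cartesianProductWith _,_ (subsets k) (partialLabellings n k (time j)))
    (cong₂ _*_ (length-subsets k) (length-partialLabellings n k (time j)))

  module _ (m≤n : m ≤ n) (B-large : 4 * W * k * m ≤ 2 ^ B) where

    -- `C-C≤` turns the choice of a fingerprint domain and of the rest of the sample into (n choose
    -- m) mᵗ. After that n has left the failure probability, and `pred-decay` outweighs the
    -- remaining 2 W 2ᵏ (k m)ᵗ. The factor `2 * W` leaves 1/2 after summing over the W levels.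
    ∑hits≤ : ∀ j → j ≤ J → 2 * W * sum (map (hits j) (subsetsOfSize n m)) ≤ n C m
    ∑hits≤ j j≤J = ℕ.*-cancelˡ-≤ (w ^ r) {{ℕ.m^n≢0 w r}} (begin
      w ^ r * (2 * W * sum (map (hits j) (subsetsOfSize n m)))
        ≡⟨ cong (λ s → w ^ r * (2 * W * s)) (sum-map-comm (λ S f → hit j f S) (subsetsOfSize n m) (fingerprints j)) ⟩
      w ^ r * (2 * W * sum (map (λ f → sum (map (hit j f) (subsetsOfSize n m))) (fingerprints j)))
        ≡⟨ pull (w ^ r) (2 * W) _ ⟩
      2 * W * (w ^ r * sum (map (λ f → sum (map (hit j f) (subsetsOfSize n m))) (fingerprints j)))
        ≤⟨ ℕ.*-monoʳ-≤ (2 * W) (scaled (w ^ r) (λ f → sum (map (hit j f) (subsetsOfSize n m))) (fingerprints j) (∑hit≤ j w′ r w≡ m≡)) ⟩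
      2 * W * (length (fingerprints j) * (w′ ^ r * (N C r)))
        ≡⟨ cong (λ l → 2 * W * (l * (w′ ^ r * (N C r)))) (length-fingerprints j) ⟩
      2 * W * (2 ^ k * ((n C t) * k ^ t) * (w′ ^ r * (N C r)))
        ≡⟨ gather (2 * W) (2 ^ k) (n C t) (k ^ t) (w′ ^ r) (N C r) ⟩
      2 * W * 2 ^ k * k ^ t * w′ ^ r * ((n C t) * (N C r))
        ≤⟨ ℕ.*-monoʳ-≤ (2 * W * 2 ^ k * k ^ t * w′ ^ r) choose≤ ⟩
      2 * W * 2 ^ k * k ^ t * w′ ^ r * ((n C m) * m ^ t)
        ≡⟨ regroup (2 * W) (2 ^ k) (k ^ t) (w′ ^ r) (n C m) (m ^ t) ⟩
      2 * W * 2 ^ k * (k ^ t * m ^ t) * w′ ^ r * (n C m)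
        ≤⟨ ℕ.*-monoˡ-≤ (n C m) (ℕ.≤-trans (ℕ.*-monoˡ-≤ (w′ ^ r) union≤) (pred-decay w′ (B * t) r w*B*t≤r)) ⟩
      w ^ r * (n C m) ∎)
      where
      open ℕ.≤-Reasoning
      t = time j
      t≤m : t ≤ m
      t≤m = ℕ.≤-trans (ℕ.*-monoʳ-≤ k (ℕ.^-monoʳ-≤ 2 j≤J)) (ℕ.m≤m+n (time J) _)
      r = m ∸ t
      N = n ∸ t
      w′ = ℕ.pred (weight j)
      w = suc w′
      instance
        _ = ℕ.m^n≢0 2 (J ∸ j)
        _ = ℕ.m*n≢0 (2 ^ (J ∸ j)) W
        _ = ℕ.m^n≢0 2 j
        _ = ℕ.m*n≢0 k (2 ^ j)
      w≡ : weight j ≡ w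
      w≡ = sym (ℕ.suc-pred (weight j))
      m≡ : m ≡ t + r
      m≡ = sym (ℕ.m+[n∸m]≡n t≤m)
      pull : ∀ a b c → a * (b * c) ≡ b * (a * c)
      pull = solve-∀
      gather : ∀ a b c d e f → a * (b * (c * d) * (e * f)) ≡ a * b * d * e * (c * f)
      gather = solve-∀
      regroup : ∀ a b c d e f → a * b * c * d * (e * f) ≡ a * b * (c * f) * d * e
      regroup = solve-∀
      scaled : ∀ {X : Set} a (f : X → ℕ) (xs : List X) {b} → (∀ x → a * f x ≤ b) → a * sum (map f xs) ≤ length xs * b
      scaled a f []       af≤b = ℕ.≤-trans (ℕ.≤-reflexive (ℕ.*-zeroʳ a)) z≤n
      scaled a f (x ∷ xs) af≤b = ℕ.≤-trans (ℕ.≤-reflexive (ℕ.*-distribˡ-+ a (f x) _)) (ℕ.+-mono-≤ (af≤b x) (scaled a f xs af≤b))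
      choose≤ : (n C t) * (N C r) ≤ (n C m) * m ^ t
      choose≤ = subst₂ (λ x y → (x C t) * (N C r) ≤ (x C y) * y ^ t)
        (ℕ.m+[n∸m]≡n (ℕ.≤-trans t≤m m≤n)) (sym m≡) (C-C≤ t N r)
      1≤t : 1 ≤ t
      1≤t = ℕ.>-nonZero⁻¹ t
      union≤ : 2 * W * 2 ^ k * (k ^ t * m ^ t) ≤ 2 ^ (B * t)
      union≤ = begin
        -- As 1 ≤ t and k ≤ t, the factors `2 * W` and `2 ^ k` are bounded by t-th powers too, and
        -- the base of the product is exactly what `B-large` controls.
        2 * W * 2 ^ k * (k ^ t * m ^ t)                ≤⟨ ℕ.*-monoˡ-≤ (k ^ t * m ^ t) (ℕ.*-mono-≤ (≤^-self (2 * W) t 1≤t) (ℕ.^-monoʳ-≤ 2 (ℕ.m≤m*n k (2 ^ j)))) ⟩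
        (2 * W) ^ t * 2 ^ t * (k ^ t * m ^ t)          ≡⟨ cong₂ _*_ (^-distribʳ-* (2 * W) 2 t) (^-distribʳ-* k m t) ⟨
        (2 * W * 2) ^ t * (k * m) ^ t                  ≡⟨ ^-distribʳ-* (2 * W * 2) (k * m) t ⟨
        (2 * W * 2 * (k * m)) ^ t                      ≡⟨ cong (_^ t) (reassoc W k m) ⟩
        (4 * W * k * m) ^ t                            ≤⟨ ℕ.^-monoˡ-≤ t B-large ⟩
        (2 ^ B) ^ t                                    ≡⟨ ℕ.^-*-assoc 2 B t ⟩
        2 ^ (B * t)                                    ∎
        where
        reassoc : ∀ a b c → 2 * a * 2 * (b * c) ≡ 4 * a * b * c
        reassoc = solve-∀
      w*B*t≤r : w * (B * t) ≤ r
      w*B*t≤r = ℕ.≤-trans (ℕ.≤-reflexive w*B*t≡) (ℕ.≤-trans (ℕ.m≤n+m (time J * W * B) (time J ∸ t))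
        (ℕ.≤-reflexive (sym (ℕ.+-∸-comm (time J * W * B) (ℕ.*-monoʳ-≤ k (ℕ.^-monoʳ-≤ 2 j≤J))))))
        where
        exchange : ∀ a b c d e → a * b * (c * (d * e)) ≡ d * (e * a) * b * c
        exchange = solve-∀
        w*B*t≡ : w * (B * t) ≡ time J * W * B
        w*B*t≡ = begin-equality
          w * (B * t)                               ≡⟨ cong (_* (B * t)) w≡ ⟨
          2 ^ (J ∸ j) * W * (B * (k * 2 ^ j))       ≡⟨ exchange (2 ^ (J ∸ j)) W B k (2 ^ j) ⟩
          k * (2 ^ j * 2 ^ (J ∸ j)) * W * B         ≡⟨ cong (λ z → k * z * W * B) (ℕ.^-distribˡ-+-* 2 j (J ∸ j)) ⟨
          k * 2 ^ (j + (J ∸ j)) * W * B             ≡⟨ cong (λ z → k * 2 ^ z * W * B) (ℕ.m+[n∸m]≡n j≤J) ⟩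
          time J * W * B                            ∎

    half : (p : Subset n → Bool) →
      (∀ {S} → ∣ S ∣ ≡ m → p S ≡ true → ∃[ j ] j ≤ J × ∃[ I ] ∃[ φ ] Bad j I φ × fits φ (container j I φ) S ≡ true) →
      2 * length (filterᵇ p (subsetsOfSize n m)) ≤ n C m
    half p cover = ℕ.*-cancelˡ-≤ W (begin
      W * (2 * length (filterᵇ p (subsetsOfSize n m)))
        ≡⟨ cong (λ l → W * (2 * l)) (length-filterᵇ p (subsetsOfSize n m)) ⟩
      W * (2 * sum (map (⟦_⟧ ∘ p) (subsetsOfSize n m)))
        ≤⟨ ℕ.*-monoʳ-≤ W (ℕ.*-monoʳ-≤ 2 (sum-map-mono (subsetsOfSize n m) covered)) ⟩
      W * (2 * sum (map (λ S → ∑[ j < suc J ] hits (toℕ j) S) (subsetsOfSize n m)))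
        ≡⟨ cong (λ s → W * (2 * s)) (sum-map-∑ {n = suc J} (λ S j → hits (toℕ j) S) (subsetsOfSize n m)) ⟩
      W * (2 * ∑[ j < suc J ] sum (map (hits (toℕ j)) (subsetsOfSize n m)))
        ≡⟨ reassoc W (∑[ j < suc J ] sum (map (hits (toℕ j)) (subsetsOfSize n m))) ⟩
      2 * W * ∑[ j < suc J ] sum (map (hits (toℕ j)) (subsetsOfSize n m))
        ≡⟨ *-distribˡ-sum {suc J} (2 * W) (λ (j : Fin (suc J)) → sum (map (hits (toℕ j)) (subsetsOfSize n m))) ⟩
      ∑[ j < suc J ] (2 * W * sum (map (hits (toℕ j)) (subsetsOfSize n m)))
        ≤⟨ ∑-bound {suc J} {c = n C m} (λ j → ∑hits≤ (toℕ j) (Fin.toℕ≤pred[n] j)) ⟩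
      W * (n C m) ∎)
      where
      open ℕ.≤-Reasoning
      reassoc : ∀ a b → a * (2 * b) ≡ 2 * a * b
      reassoc = solve-∀
      covered : ∀ {S} → S List.∈ subsetsOfSize n m → ⟦ p S ⟧ ≤ ∑[ j < suc J ] hits (toℕ j) S
      covered {S} S∈ = by-value (p S) refl
        where
        counted : ∃[ j ] j ≤ J × ∃[ I ] ∃[ φ ] Bad j I φ × fits φ (container j I φ) S ≡ true → 1 ≤ ∑[ j < suc J ] hits (toℕ j) S
        counted (j , j≤J , I , φ , bad@(size≡ , _) , fit) = begin
          1                                            ≡⟨ cong₂ (λ a b → a * ⟦ b ⟧) (1[]-yes (bad? j I φ) bad) fit ⟨
          hit j (I , φ) S                              ≤⟨ term≤sum-map (λ f → hit j f S) (∈.∈-cartesianProduct⁺ (∈-subsets I) (subst (λ t → φ List.∈ partialLabellings n k t) size≡ (∈-partialLabellings φ))) ⟩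
          hits j S                                     ≡⟨ cong (λ j → hits j S) (Fin.toℕ-fromℕ< (s≤s j≤J)) ⟨
          hits (toℕ (Fin.fromℕ< (s≤s j≤J))) S          ≤⟨ term≤∑ {suc J} (λ (j : Fin (suc J)) → hits (toℕ j) S) (Fin.fromℕ< (s≤s j≤J)) ⟩
          ∑[ j < suc J ] hits (toℕ j) S                ∎
        by-value : ∀ b → p S ≡ b → ⟦ b ⟧ ≤ ∑[ j < suc J ] hits (toℕ j) S
        by-value false _  = z≤n
        by-value true  pS = counted (cover (proj₂ (∈.∈-filter⁻ (λ S → ∣ S ∣ ℕ.≟ m) {xs = subsets n} S∈)) pS)

-- Fingerprints of accepted samples

module Palette {n k : ℕ} .{{_ : NonZero k}} (conf : Fin n → Fin k → Fin n → Fin k → Bool)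
               (conf-sym : ∀ x i y j → conf x i y j ≡ conf y j x i) (J B : ℕ) where

  open Containers conf
  open Levels J
  open UnionBound conf J B

  used? : (S : Subset n) (c : Fin n → Fin k) (i : Fin k) → Dec (∃[ x ] x ∈ S × c x ≡ i)
  used? S c i = Fin.any? λ x → x ∈? S ×-dec c x Fin.≟ i

  palette : Subset n → (Fin n → Fin k) → Subset k
  palette S c = Vec.tabulate (does ∘ used? S c)

  ∈-palette⁺ : ∀ {S c x} → x ∈ S → c x ∈ palette S c
  ∈-palette⁺ {S} {c} {x} x∈S = Vec.lookup⇒[]= (c x) _
    (trans (Vec.lookup∘tabulate _ (c x)) (dec-true (used? S c (c x)) (x , x∈S , refl)))

  ∈-palette⁻ : ∀ {S c i} → i ∈ palette S c → ∃[ x ] x ∈ S × c x ≡ i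
  ∈-palette⁻ {S} {c} {i} i∈ = does⇒ (used? S c i) (trans (sym (Vec.lookup∘tabulate _ i)) (Vec.[]=⇒lookup i∈))

  Valid : Subset n → (Fin n → Fin k) → Set
  Valid S c = ∀ {x y} → x ∈ S → y ∈ S → conf x (c x) y (c y) ≡ false

  conflictCount : (Fin n → Fin k) → ℕ
  conflictCount c = ∑[ x < n ] ∑[ y < n ] ⟦ conf x (c x) y (c y) ⟧

  -- This is the form in which farness reaches the containers, the negation of the conclusion of
  -- `few-conflicts`. The labelling `a` is confined to labels that a valid labelling uses on S,
  -- since only these are known to be pairwise compatible.
  RobustlyInvalid : Set
  RobustlyInvalid = ∀ {S c} → Valid S c → ∀ a → (∀ v → ∃[ x ] x ∈ S × c x ≡ a v) →
    6 * (n * n) < conflictCount a * 2 ^ J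

  covered : RobustlyInvalid → ∀ {S c} → ∣ S ∣ ≡ m → Valid S c →
    ∃[ j ] j ≤ J × ∃[ I ] ∃[ φ ] Bad j I φ × fits φ (container j I φ) S ≡ true
  covered robust {S} {c} ∣S∣≡m valid = decide (Fin.any? λ (j : Fin (suc J)) → bad? (toℕ j) I (level (toℕ j)))
    where
    open ℕ.≤-Reasoning
    I = palette S c
    open Greedy {S} {I} c ∈-palette⁺ valid
    instance
      _ = ℕ.m^n≢0 2 J
      _ = ℕ.m*n≢0 k (2 ^ J)
    -- A vertex of S supplies the default label for the vertices of rank 0, which has to be a used
    -- one.
    0<∣S∣ : 0 < ∣ S ∣
    0<∣S∣ = begin-strict
      0              <⟨ ℕ.>-nonZero⁻¹ (k * 2 ^ J) ⟩
      k * 2 ^ J      ≤⟨ ℕ.m≤m+n (k * 2 ^ J) _ ⟩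
      m              ≡⟨ ∣S∣≡m ⟨
      ∣ S ∣          ∎
    member : ∀ {n} (S : Subset n) → 0 < ∣ S ∣ → ∃ (_∈ S)
    member (inside ∷ S)  _ = zero , Vec.here
    member (outside ∷ S) p = suc (proj₁ (member S p)) , Vec.there (proj₂ (member S p))
    module R = Rounding conf conf-sym {S} {I} c ∈-palette⁺ valid J (∈-palette⁺ (proj₂ (member S 0<∣S∣)))
    sparse : ¬ (∃[ j ] Bad (toℕ {suc J} j) I (level (toℕ j))) → ∀ j → j ≤ J → excluded j I (level j) * weight j ≤ n
    sparse ∄bad j j≤J = ℕ.≮⇒≥ λ large → ∄bad (Fin.fromℕ< (s≤s j≤J) ,
      subst (λ j → Bad j I (level j)) (sym (Fin.toℕ-fromℕ< (s≤s j≤J)))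
        (size≡ , trans (cong (freeIn (level j) D + excluded j I (level j) +_) (sym size≡)) (freeIn+excluded+size (level j) D dom⊆D) , ℕ.<⇒≤ large))
      where
      D = container j I (level j)
      size≡ : size (level j) ≡ k * 2 ^ j
      size≡ = size-level j (begin
        k * 2 ^ j      ≤⟨ ℕ.*-monoʳ-≤ k (ℕ.^-monoʳ-≤ 2 j≤J) ⟩
        k * 2 ^ J      ≤⟨ ℕ.m≤m+n (k * 2 ^ J) _ ⟩
        m              ≡⟨ ∣S∣≡m ⟨
        ∣ S ∣          ∎)
      dom⊆D : ∀ x {i} → lookup (level j) x ≡ just i → D x ≡ true
      dom⊆D x eq = S⊆container j (proj₁ (State.φ-agrees (run (Greedy.time c ∈-palette⁺ valid (suc j))) x eq))

    decide : Dec (∃[ j ] Bad (toℕ {suc J} j) I (level (toℕ j))) →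
      ∃[ j ] j ≤ J × ∃[ I ] ∃[ φ ] Bad j I φ × fits φ (container j I φ) S ≡ true
    decide (yes (j , bad)) = toℕ j , Fin.toℕ≤pred[n] j , I , level (toℕ j) , bad , level-fits (toℕ j)
    decide (no ∄bad)       = contradiction (R.few-conflicts (sparse ∄bad))
      (ℕ.<⇒≱ (robust {S} {c} valid R.assign (∈-palette⁻ ∘ R.assign∈I)))

-- Ratios

/-mono-≤ : ∀ a b c d .{{_ : NonZero b}} .{{_ : NonZero d}} → a * d ≤ c * b → ℤ.+ a / b ℚ.≤ ℤ.+ c / d
/-mono-≤ a (suc b) c (suc d) p = ℚ.toℚᵘ-cancel-≤ (ℚᵘ.≤-respˡ-≃ (ℚᵘ.≃-sym (ℚ.toℚᵘ-fromℚᵘ (ℚᵘ.mkℚᵘ (ℤ.+ a) b)))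
  (ℚᵘ.≤-respʳ-≃ (ℚᵘ.≃-sym (ℚ.toℚᵘ-fromℚᵘ (ℚᵘ.mkℚᵘ (ℤ.+ c) d)))
    (ℚᵘ.*≤* (subst₂ ℤ._≤_ (ℤ.pos-* a (suc d)) (ℤ.pos-* c (suc b)) (ℤ.+≤+ p)))))

/-cancel-≤ : ∀ a b c d .{{_ : NonZero b}} .{{_ : NonZero d}} → ℤ.+ a / b ℚ.≤ ℤ.+ c / d → a * d ≤ c * b
/-cancel-≤ a (suc b) c (suc d) p with ℚᵘ.≤-respˡ-≃ (ℚ.toℚᵘ-fromℚᵘ (ℚᵘ.mkℚᵘ (ℤ.+ a) b))
  (ℚᵘ.≤-respʳ-≃ (ℚ.toℚᵘ-fromℚᵘ (ℚᵘ.mkℚᵘ (ℤ.+ c) d)) (ℚ.toℚᵘ-mono-≤ p))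
... | ℚᵘ.*≤* q = ℤ.drop‿+≤+ (subst₂ ℤ._≤_ (sym (ℤ.pos-* a (suc d))) (sym (ℤ.pos-* c (suc b))) q)

ratio≤1 : ∀ e d .{{_ : NonZero d}} → e ≤ d → ℤ.+ e / d ℚ.≤ 1ℚ
ratio≤1 e d p = /-mono-≤ e d 1 1 (subst₂ _≤_ (sym (ℕ.*-identityʳ e)) (sym (ℕ.*-identityˡ d)) p)

1≤ratio : ∀ e d .{{_ : NonZero d}} → d ≤ e → 1ℚ ℚ.≤ ℤ.+ e / d
1≤ratio e d p = /-mono-≤ 1 1 e d (subst₂ _≤_ (sym (ℕ.*-identityˡ d)) (sym (ℕ.*-identityʳ e)) p)

1≤ratio⁻ : ∀ e d .{{_ : NonZero d}} → 1ℚ ℚ.≤ ℤ.+ e / d → d ≤ e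
1≤ratio⁻ e d p = subst₂ _≤_ (ℕ.*-identityˡ d) (ℕ.*-identityʳ e) (/-cancel-≤ 1 1 e d p)

0≤ratio : ∀ e d .{{_ : NonZero d}} → 0ℚ ℚ.≤ ℤ.+ e / d
0≤ratio e d = /-mono-≤ 0 1 e d z≤n

ratio≤0 : ∀ e d .{{_ : NonZero d}} → e ≤ 0 → ℤ.+ e / d ℚ.≤ 0ℚ
ratio≤0 e d p = /-mono-≤ e d 0 1 (subst (_≤ 0) (sym (ℕ.*-identityʳ e)) p)

ratio≤0⁻ : ∀ e d .{{_ : NonZero d}} → ℤ.+ e / d ℚ.≤ 0ℚ → e ≤ 0
ratio≤0⁻ e d p = subst (_≤ 0) (ℕ.*-identityʳ e) (/-cancel-≤ e d 0 1 p)

-- A density bound in {0 , 1} is either vacuous or forces uniformity: an edge can occur only below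
-- the upper bound 1, a non-edge only above the lower bound 0.
Allows : ℚ → ℚ → Bool → Set
Allows lo hi true  = hi ≡ 1ℚ
Allows lo hi false = lo ≡ 0ℚ

allows? : ∀ lo hi b → Dec (Allows lo hi b)
allows? lo hi true  = hi ℚ.≟ 1ℚ
allows? lo hi false = lo ℚ.≟ 0ℚ

-- A common form of the conditions between two parts and inside one part: `Q` selects the pairs
-- counted by the denominator, `P` the edges among them, and `a` is adjacency.
module _ {X : Set} (xs : List X) {P Q : X → Set} (P? : ∀ z → Dec (P z)) (Q? : ∀ z → Dec (Q z))
         (a : X → Bool) (P⇒ : ∀ {z} → P z → Q z × a z ≡ true) (⇒P : ∀ {z} → Q z → a z ≡ true → P z) where

  private
    e = length (filter P? xs)
    d = length (filter Q? xs)

    e≤d : e ≤ d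
    e≤d = subst₂ _≤_ (sym (length-filter P? xs)) (sym (length-filter Q? xs))
      (sum-map-mono xs λ {z} _ → 1[]-mono (P? z) (Q? z) (proj₁ ∘ P⇒))

    0<e : ∀ {z} → z List.∈ xs → P z → 0 < e
    0<e z∈ pz = ∈.∈-length (∈.∈-filter⁺ P? z∈ pz)

    e<d : ∀ {z} → z List.∈ xs → Q z → a z ≡ false → e < d
    e<d {z} z∈ qz az = begin-strict
      e                                                   ≡⟨ length-filter P? xs ⟩
      sum (map (λ z → 1[ P? z ]) xs)                      <⟨ ℕ.m<m+n (sum (map (λ z → 1[ P? z ]) xs)) (ℕ.<-≤-trans (s≤s z≤n) (subst (_≤ sum (map other xs)) other≡1 (term≤sum-map other z∈))) ⟩
      sum (map (λ z → 1[ P? z ]) xs) + sum (map other xs) ≡⟨ sum-map-+ (λ z → 1[ P? z ]) other xs ⟨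
      sum (map (λ z → 1[ P? z ] + other z) xs)            ≤⟨ sum-map-mono xs (λ {z} _ → split z) ⟩
      sum (map (λ z → 1[ Q? z ]) xs)                      ≡⟨ length-filter Q? xs ⟨
      d                                                   ∎
      where
      open ℕ.≤-Reasoning
      other : X → ℕ
      other z = 1[ Q? z ×-dec a z Bool.≟ false ]
      other≡1 : other z ≡ 1
      other≡1 = 1[]-yes (Q? z ×-dec a z Bool.≟ false) (qz , az)
      split : ∀ z → 1[ P? z ] + other z ≤ 1[ Q? z ]
      split z with P? z
      ... | yes pz = ℕ.≤-trans (ℕ.≤-reflexive (cong suc (1[]-no (Q? z ×-dec a z Bool.≟ false)
                       (λ (_ , az) → contradiction (trans (sym (proj₂ (P⇒ pz))) az) λ ()))))
                       (ℕ.≤-reflexive (sym (1[]-yes (Q? z) (proj₁ (P⇒ pz)))))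
      ... | no _   = 1[]-mono (Q? z ×-dec a z Bool.≟ false) (Q? z) proj₁

  ratioWithin⇒ : ∀ {lo hi} → lo ≡ 0ℚ ⊎ lo ≡ 1ℚ → hi ≡ 0ℚ ⊎ hi ≡ 1ℚ → RatioWithin lo hi e d →
    ∀ {z} → z List.∈ xs → Q z → Allows lo hi (a z)
  ratioWithin⇒ {lo} {hi} lo? hi? within {z} z∈ qz = allowed (a z) refl lo? hi? {{d≢0}} (within {{d≢0}})
    where
    -- The pair z itself shows that the denominator is positive, so the condition is not vacuous.
    d≢0 : NonZero d
    d≢0 = ℕ.>-nonZero (∈.∈-length (∈.∈-filter⁺ Q? z∈ qz))
    allowed : ∀ b → a z ≡ b → lo ≡ 0ℚ ⊎ lo ≡ 1ℚ → hi ≡ 0ℚ ⊎ hi ≡ 1ℚ →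
      .{{_ : NonZero d}} → lo ℚ.≤ ℤ.+ e / d × ℤ.+ e / d ℚ.≤ hi → Allows lo hi b
    allowed true  az _           (inj₂ hi≡1) _           = hi≡1
    allowed true  az _           (inj₁ refl) (_ , e/d≤0) = contradiction (ratio≤0⁻ e d e/d≤0) (ℕ.<⇒≱ (0<e z∈ (⇒P qz az)))
    allowed false az (inj₁ lo≡0) _           _           = lo≡0
    allowed false az (inj₂ refl) _           (1≤e/d , _) = contradiction (1≤ratio⁻ e d 1≤e/d) (ℕ.<⇒≱ (e<d z∈ qz az))

  ⇒ratioWithin : ∀ {lo hi} → lo ≡ 0ℚ ⊎ lo ≡ 1ℚ → hi ≡ 0ℚ ⊎ hi ≡ 1ℚ →
    (∀ {z} → Q z → Allows lo hi (a z)) → RatioWithin lo hi e d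
  ⇒ratioWithin {lo} {hi} lo? hi? allows = lower lo? , upper hi?
    where
    lower : .{{_ : NonZero d}} → lo ≡ 0ℚ ⊎ lo ≡ 1ℚ → lo ℚ.≤ ℤ.+ e / d
    lower (inj₁ refl) = 0≤ratio e d
    lower (inj₂ refl) = 1≤ratio e d (ℕ.≤-reflexive (cong length (List.filter-≐ Q? P? ((λ qz → ⇒P qz (present (allows qz))) , proj₁ ∘ P⇒) xs)))
      where
      present : ∀ {b hi} → Allows 1ℚ hi b → b ≡ true
      present {true} _ = refl
    upper : .{{_ : NonZero d}} → hi ≡ 0ℚ ⊎ hi ≡ 1ℚ → ℤ.+ e / d ℚ.≤ hi
    upper (inj₂ refl) = ratio≤1 e d e≤d
    upper (inj₁ refl) = ratio≤0 e d (ℕ.≮⇒≥ λ 0<e → absurd (positive xs (subst (0 <_) (length-filter P? xs) 0<e)))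
      where
      positive : ∀ xs → 0 < sum (map (λ z → 1[ P? z ]) xs) → ∃ P
      positive (z ∷ xs) p with P? z
      ... | yes pz = z , pz
      ... | no _   = positive xs p
      absurd : ¬ ∃ P
      absurd (z , pz) with a z | allows (proj₁ (P⇒ pz)) | proj₂ (P⇒ pz)
      ... | true | () | _

-- The denominators as numbers of vertex pairs

∣∣-∑ : (A : Subset n) → ∣ A ∣ ≡ ∑[ x < n ] 1[ x ∈? A ]
∣∣-∑ []            = refl
∣∣-∑ (inside ∷ A)  = cong suc (∣∣-∑ A)
∣∣-∑ (outside ∷ A) = ∣∣-∑ A

∣∣*∣∣ : (A B : Subset n) →
  ∣ A ∣ * ∣ B ∣ ≡ length (filter (λ (x , y) → x ∈? A ×-dec y ∈? B) (vertexPairs n))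
∣∣*∣∣ {n} A B = begin
  ∣ A ∣ * ∣ B ∣                                       ≡⟨ cong₂ _*_ (∣∣-∑ A) (∣∣-∑ B) ⟩
  (∑[ x < n ] 1[ x ∈? A ]) * (∑[ y < n ] 1[ y ∈? B ]) ≡⟨ *-distribʳ-sum (∑[ y < n ] 1[ y ∈? B ]) (λ x → 1[ x ∈? A ]) ⟩
  ∑[ x < n ] (1[ x ∈? A ] * ∑[ y < n ] 1[ y ∈? B ])   ≡⟨ sum-cong-≗ (λ x → *-distribˡ-sum 1[ x ∈? A ] (λ y → 1[ y ∈? B ])) ⟩
  ∑[ x < n ] ∑[ y < n ] (1[ x ∈? A ] * 1[ y ∈? B ])   ≡⟨ sum-cong-≗ (λ x → sum-cong-≗ λ y → 1[]-× (x ∈? A) (y ∈? B)) ⟨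
  ∑[ x < n ] ∑[ y < n ] 1[ x ∈? A ×-dec y ∈? B ]      ≡⟨ length-filter-vertexPairs {n} (λ (x , y) → x ∈? A ×-dec y ∈? B) ⟨
  length (filter (λ (x , y) → x ∈? A ×-dec y ∈? B) (vertexPairs n)) ∎
  where open ≡-Reasoning

∑-pairs-C2 : (A : Subset n) →
  ∑[ x < n ] ∑[ y < n ] 1[ x Fin.<? y ×-dec x ∈? A ×-dec y ∈? A ] ≡ ∣ A ∣ C 2
∑-pairs-C2 []            = refl
∑-pairs-C2 {suc n} (inside ∷ A) = begin
  ∑[ y < n ] 1[ y ∈? A ] + ∑[ x < n ] ∑[ y < n ] 1[ x Fin.<? y ×-dec x ∈? A ×-dec y ∈? A ]
                           ≡⟨ cong₂ _+_ (sym (∣∣-∑ A)) (∑-pairs-C2 A) ⟩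
  ∣ A ∣ + ∣ A ∣ C 2        ≡⟨ cong (_+ ∣ A ∣ C 2) (nC1≡n ∣ A ∣) ⟨
  ∣ A ∣ C 1 + ∣ A ∣ C 2    ≡⟨ nCk+nC[k+1]≡[n+1]C[k+1] ∣ A ∣ 1 ⟩
  suc ∣ A ∣ C 2            ∎
  where open ≡-Reasoning
∑-pairs-C2 {suc n} (outside ∷ A) = trans
  (cong (_+ ∑[ x < n ] ∑[ y < n ] 1[ x Fin.<? y ×-dec x ∈? A ×-dec y ∈? A ]) (∑-zero {n} λ _ → refl))
  (∑-pairs-C2 A)

∣∣C2 : (A : Subset n) →
  ∣ A ∣ C 2 ≡ length (filter (λ (x , y) → x Fin.<? y ×-dec x ∈? A ×-dec y ∈? A) (vertexPairs n))
∣∣C2 {n} A = sym (trans (length-filter-vertexPairs {n} (λ (x , y) → x Fin.<? y ×-dec x ∈? A ×-dec y ∈? A)) (∑-pairs-C2 A))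

∈-vertexPairs : (x y : Fin n) → (x , y) List.∈ vertexPairs n
∈-vertexPairs x y = ∈.∈-cartesianProduct⁺ (∈.∈-allFin x) (∈.∈-allFin y)

∈-part⁺ : ∀ (c : Fin n → Fin k) x → x ∈ part c (c x)
∈-part⁺ c x = Vec.lookup⇒[]= x _ (trans (Vec.lookup∘tabulate _ x) (dec-true (c x Fin.≟ c x) refl))

∈-part⁻ : ∀ (c : Fin n → Fin k) {x i} → x ∈ part c i → c x ≡ i
∈-part⁻ c {x} {i} x∈ = does⇒ (c x Fin.≟ i) (trans (sym (Vec.lookup∘tabulate _ x)) (Vec.[]=⇒lookup x∈))

-- Semi-homogeneous conditions are conditions on single pairs of vertices.

module SemiHomogeneousProperty {k : ℕ} (P : PartitionParameters k) (homogeneous : SemiHomogeneous P) where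

  open PartitionParameters P

  Permits : Fin k → Fin k → Bool → Set
  Permits i j = Allows (ℓ i j) (u i j)

  permits? : ∀ i j b → Dec (Permits i j b)
  permits? i j = allows? (ℓ i j) (u i j)

  Proper : Graph n → (Fin n → Fin k) → Set
  Proper G c = ∀ x y → x ≢ y → Permits (c x) (c y) (adj G x y)

  between⇒ : (G : Graph n) {c : Fin n → Fin k} → IsGoodPartition P G c → ∀ x y → c x ≢ c y → Permits (c x) (c y) (adj G x y)
  between⇒ {n} G {c} good x y i≢j = ratioWithin⇒ (vertexPairs n) _ (λ (v , w) → v ∈? V (c x) ×-dec w ∈? V (c y)) (λ (v , w) → adj G v w)
    (λ (p , q , r) → (p , q) , r) (λ (p , q) r → p , q , r)
    (proj₁ (homogeneous _ _)) (proj₂ (homogeneous _ _))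
    (subst (RatioWithin (ℓ (c x) (c y)) (u (c x) (c y)) (edgesBetween G (V (c x)) (V (c y)))) (∣∣*∣∣ (V (c x)) (V (c y))) (between (c x) (c y) i≢j))
    (∈-vertexPairs x y) (∈-part⁺ c x , ∈-part⁺ c y)
    where open IsGoodPartition good

  within⇒ : (G : Graph n) {c : Fin n → Fin k} → IsGoodPartition P G c → ∀ x y → x Fin.< y → c x ≡ c y → Permits (c x) (c y) (adj G x y)
  within⇒ {n} G {c} good x y x<y i≡j = subst (λ j → Permits (c x) j (adj G x y)) i≡j
    (ratioWithin⇒ (vertexPairs n) _ (λ (v , w) → v Fin.<? w ×-dec v ∈? V (c x) ×-dec w ∈? V (c x)) (λ (v , w) → adj G v w)
      (λ (o , p , q , r) → (o , p , q) , r) (λ (o , p , q) r → o , p , q , r)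
      (proj₁ (homogeneous _ _)) (proj₂ (homogeneous _ _))
      (subst (RatioWithin (ℓ (c x) (c x)) (u (c x) (c x)) (edgesInside G (V (c x)))) (∣∣C2 (V (c x))) (within (c x)))
      (∈-vertexPairs x y) (x<y , ∈-part⁺ c x , subst (λ j → y ∈ part c j) (sym i≡j) (∈-part⁺ c y)))
    where open IsGoodPartition good

  good⇒proper : (G : Graph n) {c : Fin n → Fin k} → IsGoodPartition P G c → Proper G c
  good⇒proper G {c} good x y x≢y with c x Fin.≟ c y
  ... | no i≢j = between⇒ G good x y i≢j
  ... | yes i≡j with Fin.<-cmp x y
  ...   | tri≈ _ x≡y _ = contradiction x≡y x≢y
  ...   | tri< x<y _ _ = within⇒ G good x y x<y i≡j
  ...   | tri> _ _ y<x = subst₂ (λ i j → Permits i j (adj G x y)) (sym i≡j) i≡j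
    (subst (Permits (c y) (c x)) (Graph.symmetric G y x) (within⇒ G good y x y<x (sym i≡j)))

  proper⇒good : (G : Graph n) {c : Fin n → Fin k} → Proper G c → IsGoodPartition P G c
  proper⇒good {n} G {c} proper = record
    { between = λ i j i≢j → subst (RatioWithin (ℓ i j) (u i j) (edgesBetween G (V i) (V j))) (sym (∣∣*∣∣ (V i) (V j)))
        (⇒ratioWithin (vertexPairs n) _ (λ (v , w) → v ∈? V i ×-dec w ∈? V j) (λ (v , w) → adj G v w)
          (λ (p , q , r) → (p , q) , r) (λ (p , q) r → p , q , r)
          (proj₁ (homogeneous _ _)) (proj₂ (homogeneous _ _))
          (λ {(v , w)} (v∈ , w∈) → subst₂ (λ i j → Permits i j (adj G v w)) (∈-part⁻ c v∈) (∈-part⁻ c w∈)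
            (proper v w λ { refl → i≢j (trans (sym (∈-part⁻ c v∈)) (∈-part⁻ c w∈)) })))
    ; within = λ i → subst (RatioWithin (ℓ i i) (u i i) (edgesInside G (V i))) (sym (∣∣C2 (V i)))
        (⇒ratioWithin (vertexPairs n) _ (λ (v , w) → v Fin.<? w ×-dec v ∈? V i ×-dec w ∈? V i) (λ (v , w) → adj G v w)
          (λ (o , p , q , r) → (o , p , q) , r) (λ (o , p , q) r → o , p , q , r)
          (proj₁ (homogeneous _ _)) (proj₂ (homogeneous _ _))
          (λ {(v , w)} (v<w , v∈ , w∈) → subst₂ (λ i j → Permits i j (adj G v w)) (∈-part⁻ c v∈) (∈-part⁻ c w∈)
            (proper v w λ { refl → Fin.<-irrefl refl v<w })))
    }
    where
    V : Fin k → Subset n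
    V = part c

  proper? : (G : Graph n) (c : Fin n → Fin k) → Dec (Proper G c)
  proper? G c = Fin.all? λ x → Fin.all? λ y → ¬? (x Fin.≟ y) →-dec permits? (c x) (c y) (adj G x y)

  proper-cong : (G : Graph n) {c c′ : Fin n → Fin k} → (∀ x → c x ≡ c′ x) → Proper G c → Proper G c′
  proper-cong G c≗c′ proper x y x≢y = subst₂ (λ i j → Permits i j (adj G x y)) (c≗c′ x) (c≗c′ y) (proper x y x≢y)

  -- The labellings are searched through their codes in a finite type. Decoding the code of c yields
  -- a function that agrees with c pointwise, whence the appeal to `proper-cong`.
  partitionable? : (G : Graph n) → Dec (∃ (Proper {n} G))
  partitionable? {n} G = map′ (λ (i , p) → Fin.finToFun i , p)
    (λ (c , p) → Fin.funToFin c , proper-cong G (λ x → sym (Fin.finToFun-funToFin c x)) p)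
    (Fin.any? λ i → proper? G (Fin.finToFun {k} {n} i))

  proper-≅ : (G H : Graph n) → G ≅ H → ∃ (Proper H) → ∃ (Proper G)
  proper-≅ G H (π , iso) (c , proper) = c ∘ (π ⟨$⟩ʳ_) , λ x y x≢y →
    subst (Permits _ _) (sym (iso x y)) (proper _ _ λ eq → x≢y (trans (sym (inverseˡ π)) (trans (cong (π ⟨$⟩ˡ_) eq) (inverseˡ π))))

  ≅-sym : (G H : Graph n) → G ≅ H → H ≅ G
  ≅-sym G H (π , iso) = Perm.flip π , λ x y →
    trans (cong₂ (adj H) (sym (inverseʳ π {x})) (sym (inverseʳ π {y}))) (sym (iso (π ⟨$⟩ˡ x) (π ⟨$⟩ˡ y)))

  tester : ℕ → CanonicalTester
  tester s = record
    { sampleComplexity = s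
    ; accepts   = λ G → does (partitionable? G)
    ; accepts-≅ = λ G H G≅H → does-⇔ (mk⇔ (proper-≅ H G (≅-sym G H G≅H)) (proper-≅ G H G≅H)) (partitionable? G) (partitionable? H)
    }

  -- A pair of labels admitting no adjacency at all (its two conditions
  -- contradict each other) conflicts at every pair of vertices.

  Ok : Fin k → Fin k → Bool → Set
  Ok i j b = Permits i j b × Permits j i b

  ok? : ∀ i j b → Dec (Ok i j b)
  ok? i j b = permits? i j b ×-dec permits? j i b

  Compatible : Fin k → Fin k → Set
  Compatible i j = ∃ (Ok i j)

  -- On the diagonal a single pair of bounds is involved, and `ℓ≤u` excludes lower bound 1 with
  -- upper bound 0. Off the diagonal two unrelated pairs of bounds meet, and nothing similar holds.
  compatible-refl : ∀ i → Compatible i i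
  compatible-refl i with proj₁ (homogeneous i i) | proj₂ (homogeneous i i)
  ... | inj₁ ℓ≡0 | _        = false , ℓ≡0 , ℓ≡0
  ... | inj₂ _   | inj₂ u≡1 = true , u≡1 , u≡1
  ... | inj₂ ℓ≡1 | inj₁ u≡0 = contradiction (subst₂ ℚ._≤_ ℓ≡1 u≡0 (ℓ≤u i i)) λ { (ℚ.*≤* (ℤ.+≤+ ())) }

  conflict? : (G : Graph n) → ∀ x i y j → Dec (x ≢ y × ¬ Ok i j (adj G x y))
  conflict? G x i y j = ¬? (x Fin.≟ y) ×-dec ¬? (ok? i j (adj G x y))

  conf : Graph n → Fin n → Fin k → Fin n → Fin k → Bool
  conf G x i y j = does (conflict? G x i y j)

  conf-sym : (G : Graph n) → ∀ x i y j → conf G x i y j ≡ conf G y j x i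
  conf-sym G x i y j = does-⇔ (mk⇔ (flip x i y j) (flip y j x i)) (conflict? G x i y j) (conflict? G y j x i)
    where
    flip : ∀ x i y j → x ≢ y × ¬ Ok i j (adj G x y) → y ≢ x × ¬ Ok j i (adj G y x)
    flip x i y j (x≢y , ¬ok) = x≢y ∘ sym , λ (p , q) → ¬ok (subst (Permits i j) (Graph.symmetric G y x) q , subst (Permits j i) (Graph.symmetric G y x) p)

  -- Compatible labels that reject one adjacency value admit the other, so flipping exactly the
  -- conflicting pairs makes the labelling proper.
  module Repair (G : Graph n) (c : Fin n → Fin k) (compatible : ∀ x y → Compatible (c x) (c y)) where

    flipped : Fin n → Fin n → Bool
    flipped x y = if conf G x (c x) y (c y) then not (adj G x y) else adj G x y

    repaired : Graph n
    repaired = record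
      { adj = flipped
      ; symmetric = λ x y → cong₂ (λ b a → if b then not a else a) (conf-sym G x (c x) y (c y)) (Graph.symmetric G x y)
      ; irreflexive = λ x → trans (cong (λ b → if b then not (adj G x x) else adj G x x) (dec-false (conflict? G x (c x) x (c x)) (λ (x≢x , _) → x≢x refl)))
          (Graph.irreflexive G x)
      }

    other : ∀ {i j} b → Compatible i j → ¬ Ok i j b → Ok i j (not b)
    other true  (true  , ok) ¬ok = contradiction ok ¬ok
    other true  (false , ok) ¬ok = ok
    other false (true  , ok) ¬ok = ok
    other false (false , ok) ¬ok = contradiction ok ¬ok

    repaired-proper : Proper repaired c
    repaired-proper x y x≢y = permitted (ok? (c x) (c y) (adj G x y))
      where
      permitted : Dec (Ok (c x) (c y) (adj G x y)) → Permits (c x) (c y) (flipped x y)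
      permitted (yes ok) = subst (λ b → Permits (c x) (c y) (if b then not (adj G x y) else adj G x y))
        (sym (dec-false (conflict? G x (c x) y (c y)) (λ (_ , ¬ok) → ¬ok ok))) (proj₁ ok)
      permitted (no ¬ok) = subst (λ b → Permits (c x) (c y) (if b then not (adj G x y) else adj G x y))
        (sym (dec-true (conflict? G x (c x) y (c y)) (x≢y , ¬ok))) (proj₁ (other (adj G x y) (compatible x y) ¬ok))

    repair-distance : editDistance G repaired ≤ ∑[ x < n ] ∑[ y < n ] ⟦ conf G x (c x) y (c y) ⟧
    repair-distance = ℕ.≤-trans
      (ℕ.≤-reflexive (length-filter-vertexPairs {n} (λ (x , y) → x Fin.<? y ×-dec ¬? (adj G x y Bool.≟ flipped x y))))
      (∑-mono λ x → ∑-mono λ y → 1[]-mono (x Fin.<? y ×-dec ¬? (adj G x y Bool.≟ flipped x y)) (conflict? G x (c x) y (c y))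
        (λ (_ , differ) → changed x y (conflict? G x (c x) y (c y)) differ))
      where
      changed : ∀ x y (d : Dec (x ≢ y × ¬ Ok (c x) (c y) (adj G x y))) → adj G x y ≢ (if does d then not (adj G x y) else adj G x y) →
        x ≢ y × ¬ Ok (c x) (c y) (adj G x y)
      changed x y (yes p) _ = p
      changed x y (no _)  differ = contradiction refl differ

-- Induced subgraphs

element-injective : (S : Subset n) → ∀ {i j} → element S i ≡ element S j → i ≡ j
element-injective (inside ∷ S)  {zero}  {zero}  eq = refl
element-injective (inside ∷ S)  {suc i} {suc j} eq = cong suc (element-injective S (Fin.suc-injective eq))
element-injective (outside ∷ S) {i}     {j}     eq = element-injective S (Fin.suc-injective eq)

index : (S : Subset n) → ∀ {x} → x ∈ S → Fin ∣ S ∣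
index (inside ∷ S)  Vec.here      = zero
index (inside ∷ S)  (Vec.there p) = suc (index S p)
index (outside ∷ S) (Vec.there p) = index S p

element-index : (S : Subset n) → ∀ {x} (p : x ∈ S) → element S (index S p) ≡ x
element-index (inside ∷ S)  Vec.here      = refl
element-index (inside ∷ S)  (Vec.there p) = cong suc (element-index S p)
element-index (outside ∷ S) (Vec.there p) = cong suc (element-index S p)

editDistance-refl : (G : Graph n) → editDistance G G ≡ 0
editDistance-refl {n} G = trans (length-filter-vertexPairs {n} (λ (x , y) → x Fin.<? y ×-dec ¬? (adj G x y Bool.≟ adj G x y)))
  (∑-zero λ x → ∑-zero λ y → 1[]-no (x Fin.<? y ×-dec ¬? (adj G x y Bool.≟ adj G x y)) λ (_ , differ) → differ refl)

-- Edits are counted at pairs x < y, and these pairs and their reverses are distinct among the n²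
-- ordered pairs.
2*editDistance≤ : (G H : Graph n) → 2 * editDistance G H ≤ n * n
2*editDistance≤ {n} G H = begin
  2 * editDistance G H                                                   ≡⟨ cong (2 *_) (length-filter-vertexPairs {n} (λ (x , y) → x Fin.<? y ×-dec ¬? (adj G x y Bool.≟ adj H x y))) ⟩
  2 * ∑[ x < n ] ∑[ y < n ] 1[ x Fin.<? y ×-dec ¬? (adj G x y Bool.≟ adj H x y) ]
    ≤⟨ ℕ.*-monoʳ-≤ 2 (∑-mono λ x → ∑-mono λ y → 1[]-mono (x Fin.<? y ×-dec ¬? (adj G x y Bool.≟ adj H x y)) (x Fin.<? y) proj₁) ⟩
  2 * ∑[ x < n ] ∑[ y < n ] 1[ x Fin.<? y ]                              ≡⟨ cong (∑[ x < n ] ∑[ y < n ] 1[ x Fin.<? y ] +_) (ℕ.+-identityʳ _) ⟩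
  ∑[ x < n ] ∑[ y < n ] 1[ x Fin.<? y ] + ∑[ x < n ] ∑[ y < n ] 1[ x Fin.<? y ]
    ≡⟨ cong (∑[ x < n ] ∑[ y < n ] 1[ x Fin.<? y ] +_) (∑-comm {n} {n} (λ x y → 1[ x Fin.<? y ])) ⟩
  ∑[ x < n ] ∑[ y < n ] 1[ x Fin.<? y ] + ∑[ x < n ] ∑[ y < n ] 1[ y Fin.<? x ]
    ≡⟨ ∑-distrib-+ {n} (λ x → ∑[ y < n ] 1[ x Fin.<? y ]) (λ x → ∑[ y < n ] 1[ y Fin.<? x ]) ⟨
  ∑[ x < n ] (∑[ y < n ] 1[ x Fin.<? y ] + ∑[ y < n ] 1[ y Fin.<? x ])
    ≡⟨ sum-cong-≗ {n} (λ x → sym (∑-distrib-+ {n} (λ y → 1[ x Fin.<? y ]) (λ y → 1[ y Fin.<? x ]))) ⟩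
  ∑[ x < n ] ∑[ y < n ] (1[ x Fin.<? y ] + 1[ y Fin.<? x ])
    ≤⟨ ∑-bound {n} (λ x → ℕ.≤-trans (∑-bound {n} {c = 1} (λ y → asymmetric x y)) (ℕ.≤-reflexive (ℕ.*-identityʳ n))) ⟩
  n * n                                                                  ∎
  where
  open ℕ.≤-Reasoning
  asymmetric : ∀ (x y : Fin n) → 1[ x Fin.<? y ] + 1[ y Fin.<? x ] ≤ 1
  asymmetric x y with x Fin.<? y
  ... | yes x<y = ℕ.≤-reflexive (cong₂ _+_ (1[]-yes (x Fin.<? y) x<y) (1[]-no (y Fin.<? x) (Fin.<-asym x<y)))
  ... | no x≮y  = subst (λ b → b + 1[ y Fin.<? x ] ≤ 1) (sym (1[]-no (x Fin.<? y) x≮y)) (⟦⟧≤1 (does (y Fin.<? x)))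

-- Rejection of far graphs

module Soundness {k : ℕ} .{{_ : NonZero k}} (P : PartitionParameters k) (homogeneous : SemiHomogeneous P) where

  open SemiHomogeneousProperty P homogeneous

  -- The containers are set up for labellings of all vertices, while an accepted sample labels only
  -- S; `i₀` is a filler outside S.
  extend : (S : Subset n) → Fin k → (Fin ∣ S ∣ → Fin k) → Fin n → Fin k
  extend S i₀ c x with x ∈? S
  ... | yes x∈S = c (index S x∈S)
  ... | no _    = i₀

  extend-proper : (G : Graph n) (S : Subset n) (i₀ : Fin k) (c : Fin ∣ S ∣ → Fin k) → Proper (induced G S) c →
    ∀ {x y} → x ∈ S → y ∈ S → x ≢ y → Permits (extend S i₀ c x) (extend S i₀ c y) (adj G x y)
  extend-proper G S i₀ c proper {x} {y} x∈S y∈S x≢y with x ∈? S | y ∈? S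
  ... | no x∉S | _     = contradiction x∈S x∉S
  ... | yes _ | no y∉S = contradiction y∈S y∉S
  ... | yes p | yes q  = subst₂ (λ v w → Permits (c (index S p)) (c (index S q)) (adj G v w)) (element-index S p) (element-index S q)
    (proper (index S p) (index S q) λ eq → x≢y (trans (sym (element-index S p)) (trans (cong (element S) eq) (element-index S q))))

  module _ (G : Graph n) (J B D : ℕ) where

    open Levels J using (W)
    open UnionBound (conf G) J B using (m; half)
    open Palette (conf G) (conf-sym G) J B

    extend-valid : ∀ {S i₀ c} → Proper (induced G S) c → Valid S (extend S i₀ c)
    extend-valid {S} {i₀} {c} proper {x} {y} x∈S y∈S = dec-false (conflict? G x _ y _) λ (x≢y , ¬ok) →
      ¬ok (extend-proper G S i₀ c proper x∈S y∈S x≢y ,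
           subst (Permits _ _) (Graph.symmetric G y x) (extend-proper G S i₀ c proper y∈S x∈S (x≢y ∘ sym)))

    module _ .{{_ : NonZero n}} (8*D≤2^J : 8 * D ≤ 2 ^ J)
             (far : ∀ H c → Proper H c → n * n ≤ D * editDistance G H) where

      -- Any two labels of `a` occur together on S without conflict, hence are compatible, and
      -- repairing the conflicts of `a` gives a graph with the property. Farness then bounds their
      -- number from below. The constant 8 in place of 6 makes the inequality strict.
      robust : RobustlyInvalid
      robust {S} {c} valid a a∈c = begin-strict
        6 * (n * n)                        <⟨ ℕ.*-monoˡ-< (n * n) {{ℕ.m*n≢0 n n}} (ℕ.m≤n+m 7 1) ⟩
        8 * (n * n)                        ≤⟨ ℕ.*-monoʳ-≤ 8 (far repaired a repaired-proper) ⟩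
        8 * (D * editDistance G repaired)  ≡⟨ ℕ.*-assoc 8 D _ ⟨
        8 * D * editDistance G repaired    ≤⟨ ℕ.*-mono-≤ 8*D≤2^J repair-distance ⟩
        2 ^ J * conflictCount a            ≡⟨ ℕ.*-comm (2 ^ J) _ ⟩
        conflictCount a * 2 ^ J            ∎
        where
        open ℕ.≤-Reasoning
        used-compatible : ∀ {x y} → x ∈ S → y ∈ S → Compatible (c x) (c y)
        used-compatible {x} {y} x∈S y∈S with x Fin.≟ y | ok? (c x) (c y) (adj G x y)
        -- The same vertex may witness both labels; then they are equal, and a label is compatible
        -- with itself.
        ... | yes refl | _      = compatible-refl (c x)
        ... | no _     | yes ok = adj G x y , ok
        ... | no x≢y   | no ¬ok = contradiction (trans (sym (valid x∈S y∈S)) (dec-true (conflict? G x (c x) y (c y)) (x≢y , ¬ok))) λ ()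
        open Repair G a (λ v w → subst₂ Compatible (proj₂ (proj₂ (a∈c v))) (proj₂ (proj₂ (a∈c w))) (used-compatible (proj₁ (proj₂ (a∈c v))) (proj₁ (proj₂ (a∈c w)))))

      accepts-S : Subset n → Bool
      accepts-S S = does (partitionable? (induced G S))

      i₀ : Fin k
      i₀ = Fin.fromℕ< (ℕ.>-nonZero⁻¹ k)

      -- An accepted partition of the full vertex set would put G at distance 0 from the property,
      -- which is not far as n > 0. This covers samples as large as the graph, while the union bound
      -- assumes m ≤ n.
      rejects-⊤ : ∀ S → ∣ S ∣ ≡ n → accepts-S S ≡ false
      rejects-⊤ S ∣S∣≡n = dec-false (partitionable? (induced G S)) λ (c , proper) → ℕ.<⇒≱ (ℕ.>-nonZero⁻¹ (n * n) {{ℕ.m*n≢0 n n}})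
        (ℕ.≤-trans (far G (extend S i₀ c) (λ x y → extend-proper G S i₀ c proper (full x) (full y)))
          (ℕ.≤-reflexive (trans (cong (D *_) (editDistance-refl G)) (ℕ.*-zeroʳ D))))
        where
        full : ∀ x → x ∈ S
        full x = subst (x ∈_) (sym (∣p∣≡n⇒p≡⊤ ∣S∣≡n)) ∈⊤

      few-accepted : 4 * W * k * m ≤ 2 ^ B →
        2 * length (filterᵇ accepts-S (subsetsOfSize n (m ⊓ n))) ≤ n C (m ⊓ n)
      few-accepted B-large = by-cases (ℕ.≤-total m n)
        where
        open ℕ.≤-Reasoning
        rejected : ∀ {S} → S List.∈ subsetsOfSize n n → ⟦ accepts-S S ⟧ ≤ 0
        rejected {S} S∈ = ℕ.≤-reflexive (cong ⟦_⟧ (rejects-⊤ S (proj₂ (∈.∈-filter⁻ (λ S → ∣ S ∣ ℕ.≟ n) {xs = subsets n} S∈))))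
        all-rejected : 2 * length (filterᵇ accepts-S (subsetsOfSize n n)) ≤ n C n
        all-rejected = begin
          2 * length (filterᵇ accepts-S (subsetsOfSize n n))            ≡⟨ cong (2 *_) (length-filterᵇ accepts-S (subsetsOfSize n n)) ⟩
          2 * sum (map (⟦_⟧ ∘ accepts-S) (subsetsOfSize n n))           ≤⟨ ℕ.*-monoʳ-≤ 2 (sum-map-mono (subsetsOfSize n n) rejected) ⟩
          2 * sum (map (λ _ → 0) (subsetsOfSize n n))                   ≡⟨ cong (2 *_) (sum-map-zero (subsetsOfSize n n) λ _ → refl) ⟩
          0                                                             ≤⟨ z≤n ⟩
          n C n                                                         ∎
        few-of-size : ℕ → Set
        few-of-size s = 2 * length (filterᵇ accepts-S (subsetsOfSize n s)) ≤ n C s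
        by-cases : m ≤ n ⊎ n ≤ m → few-of-size (m ⊓ n)
        by-cases (inj₁ m≤n) = subst few-of-size (sym (ℕ.m≤n⇒m⊓n≡m m≤n)) (half m≤n B-large accepts-S
          λ {S} ∣S∣≡m acc → covered robust {S} ∣S∣≡m (extend-valid {S} {i₀} (proj₂ (does⇒ (partitionable? (induced G S)) acc))))
        by-cases (inj₂ n≤m) = subst few-of-size (sym (ℕ.m≥n⇒m⊓n≡n n≤m)) all-rejected

-- Probabilities

probability-≤½ : {A : Set} (xs : List A) (p : A → Bool) → 2 * length (filterᵇ p xs) ≤ length xs →
  probability xs p ℚ.≤ ℤ.+ 1 / 2
probability-≤½ []       p _ = 0≤ratio 1 2
probability-≤½ (x ∷ xs) p few = /-mono-≤ (length (filterᵇ p (x ∷ xs))) (length (x ∷ xs)) 1 2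
  (subst₂ _≤_ (ℕ.*-comm 2 (length (filterᵇ p (x ∷ xs)))) (sym (ℕ.*-identityˡ (length (x ∷ xs)))) few)

1≤probability : {A : Set} (xs : List A) (p : A → Bool) → 0 < length xs → (∀ x → p x ≡ true) → 1ℚ ℚ.≤ probability xs p
1≤probability (x ∷ xs) p _ all = 1≤ratio (length (filterᵇ p (x ∷ xs))) (length (x ∷ xs)) (ℕ.≤-reflexive (everything (x ∷ xs)))
  where
  everything : ∀ xs → length xs ≡ length (filterᵇ p xs)
  everything []       = refl
  everything (x ∷ xs) rewrite all x = cong suc (everything xs)

0<C : ∀ {k n} → k ≤ n → 0 < n C k
0<C {zero}  {n}     _         = s≤s z≤n
0<C {suc k} {suc n} (s≤s k≤n) = ℕ.<-≤-trans (0<C k≤n) (ℕ.≤-trans (ℕ.m≤m+n (n C k) _) (ℕ.≤-reflexive (nCk+nC[k+1]≡[n+1]C[k+1] n k)))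

-- Rational arithmetic

toℚᵘ-/ : ∀ a b .{{_ : NonZero b}} → ℚ.toℚᵘ (ℤ.+ a / b) ℚᵘ.≃ (ℤ.+ a ℚᵘ./ b)
toℚᵘ-/ a (suc b) = ℚ.toℚᵘ-fromℚᵘ (ℚᵘ.mkℚᵘ (ℤ.+ a) b)

/-* : ∀ a b c d .{{_ : NonZero b}} .{{_ : NonZero d}} →
      (ℤ.+ a / b) *ℚ (ℤ.+ c / d) ≡ _/_ (ℤ.+ (a * c)) (b * d) {{ℕ.m*n≢0 b d}}
/-* a (suc b) c (suc d) = ℚ.toℚᵘ-injective (begin
  ℚ.toℚᵘ ((ℤ.+ a / suc b) *ℚ (ℤ.+ c / suc d))             ≈⟨ ℚ.toℚᵘ-homo-* (ℤ.+ a / suc b) (ℤ.+ c / suc d) ⟩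
  ℚ.toℚᵘ (ℤ.+ a / suc b) ℚᵘ.* ℚ.toℚᵘ (ℤ.+ c / suc d)      ≈⟨ ℚᵘ.*-cong (toℚᵘ-/ a (suc b)) (toℚᵘ-/ c (suc d)) ⟩
  (ℤ.+ a ℚᵘ./ suc b) ℚᵘ.* (ℤ.+ c ℚᵘ./ suc d)              ≡⟨ cong (ℚᵘ._/ (suc b * suc d)) (ℤ.pos-* a c) ⟨
  ℤ.+ (a * c) ℚᵘ./ (suc b * suc d)                        ≈⟨ toℚᵘ-/ (a * c) (suc b * suc d) ⟨
  ℚ.toℚᵘ (ℤ.+ (a * c) / (suc b * suc d))                  ∎)
  where open ℚᵘ.≃-Reasoning

fromℕ-* : ∀ a b → fromℕ (a * b) ≡ fromℕ a *ℚ fromℕ b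
fromℕ-* a b = sym (/-* a 1 b 1)

fromℕ-+ : ∀ a b → fromℕ (a + b) ≡ fromℕ a +ℚ fromℕ b
fromℕ-+ a b = ℚ.toℚᵘ-injective (begin
  ℚ.toℚᵘ (fromℕ (a + b))                          ≈⟨ toℚᵘ-/ (a + b) 1 ⟩
  ℤ.+ (a + b) ℚᵘ./ 1                              ≡⟨ cong (ℚᵘ._/ 1) (trans (ℤ.pos-+ a b) (sym (cong₂ ℤ._+_ (ℤ.*-identityʳ (ℤ.+ a)) (ℤ.*-identityʳ (ℤ.+ b))))) ⟩
  (ℤ.+ a ℚᵘ./ 1) ℚᵘ.+ (ℤ.+ b ℚᵘ./ 1)              ≈⟨ ℚᵘ.+-cong (toℚᵘ-/ a 1) (toℚᵘ-/ b 1) ⟨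
  ℚ.toℚᵘ (fromℕ a) ℚᵘ.+ ℚ.toℚᵘ (fromℕ b)          ≈⟨ ℚ.toℚᵘ-homo-+ (fromℕ a) (fromℕ b) ⟨
  ℚ.toℚᵘ (fromℕ a +ℚ fromℕ b)                     ∎)
  where open ℚᵘ.≃-Reasoning

fromℕ-mono-≤ : ∀ {a b} → a ≤ b → fromℕ a ≤ℚ fromℕ b
fromℕ-mono-≤ {a} {b} a≤b = /-mono-≤ a 1 b 1 (ℕ.*-monoˡ-≤ 1 a≤b)

fromℕ-cancel-≤ : ∀ {a b} → fromℕ a ≤ℚ fromℕ b → a ≤ b
fromℕ-cancel-≤ {a} {b} p = ℕ.*-cancelʳ-≤ a b 1 (/-cancel-≤ a 1 b 1 p)

0≤fromℕ : ∀ a → 0ℚ ≤ℚ fromℕ a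
0≤fromℕ a = fromℕ-mono-≤ {0} {a} z≤n

0<fromℕ : ∀ a .{{_ : NonZero a}} → 0ℚ <ℚ fromℕ a
0<fromℕ (suc a) = ℚ.<-≤-trans {0ℚ} {1ℚ} (ℚ.*<* (ℤ.+<+ (s≤s z≤n))) (fromℕ-mono-≤ {1} {suc a} (s≤s z≤n))

*ℚ-monoˡ : ∀ {p q} r → 0ℚ ≤ℚ r → p ≤ℚ q → p *ℚ r ≤ℚ q *ℚ r
*ℚ-monoˡ r 0≤r = ℚ.*-monoʳ-≤-nonNeg r {{ℚ.nonNegative 0≤r}}

*ℚ-monoʳ : ∀ {p q} r → 0ℚ ≤ℚ r → p ≤ℚ q → r *ℚ p ≤ℚ r *ℚ q
*ℚ-monoʳ r 0≤r = ℚ.*-monoˡ-≤-nonNeg r {{ℚ.nonNegative 0≤r}}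

*ℚ-mono : ∀ {p q r s} → 0ℚ ≤ℚ r → 0ℚ ≤ℚ q → p ≤ℚ q → r ≤ℚ s → p *ℚ r ≤ℚ q *ℚ s
*ℚ-mono {q = q} {r} 0≤r 0≤q p≤q r≤s = ℚ.≤-trans (*ℚ-monoˡ r 0≤r p≤q) (*ℚ-monoʳ q 0≤q r≤s)

0≤* : ∀ {p q} → 0ℚ ≤ℚ p → 0ℚ ≤ℚ q → 0ℚ ≤ℚ p *ℚ q
0≤* {p} {q} 0≤p 0≤q = subst (_≤ℚ p *ℚ q) (ℚ.*-zeroˡ q) (*ℚ-monoˡ q 0≤q 0≤p)

*ℚ-cancelʳ : ∀ {p q} r → 0ℚ <ℚ r → p *ℚ r ≤ℚ q *ℚ r → p ≤ℚ q
*ℚ-cancelʳ r 0<r = ℚ.*-cancelʳ-≤-pos r {{ℚ.positive 0<r}}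

1/n*n : ∀ n .{{_ : NonZero n}} → (ℤ.+ 1 / n) *ℚ fromℕ n ≡ 1ℚ
1/n*n n = trans (/-* 1 n n 1) (ℚ.≤-antisym
  (/-mono-≤ (1 * n) (n * 1) 1 1 (ℕ.≤-reflexive eq)) (/-mono-≤ 1 1 (1 * n) (n * 1) (ℕ.≤-reflexive (sym eq))))
  where
  instance _ = ℕ.m*n≢0 n 1
  eq : 1 * n * 1 ≡ 1 * (n * 1)
  eq = ℕ.*-assoc 1 n 1

-- Partial sums of the exponential series

expTerm-! : ∀ j b → expTerm (suc j) b *ℚ fromℕ (suc j !) ≡ expTerm j b *ℚ fromℕ (j !) *ℚ b
expTerm-! j b = begin
  T *ℚ (b *ℚ i) *ℚ fromℕ (suc j * j !)        ≡⟨ cong (T *ℚ (b *ℚ i) *ℚ_) (fromℕ-* (suc j) (j !)) ⟩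
  T *ℚ (b *ℚ i) *ℚ (s *ℚ f)                   ≡⟨ solve 5 (λ T b i s f → T :* (b :* i) :* (s :* f) := i :* s :* (T :* f :* b)) refl T b i s f ⟩
  i *ℚ s *ℚ (T *ℚ f *ℚ b)                     ≡⟨ cong (_*ℚ (T *ℚ f *ℚ b)) (1/n*n (suc j)) ⟩
  1ℚ *ℚ (T *ℚ f *ℚ b)                         ≡⟨ ℚ.*-identityˡ _ ⟩
  T *ℚ f *ℚ b                                 ∎
  where
  open ≡-Reasoning
  T = expTerm j b
  i = ℤ.+ 1 / suc j
  s = fromℕ (suc j)
  f = fromℕ (j !)

expTerm-!≤ : ∀ {b P} → 0ℚ ≤ℚ b → b ≤ℚ fromℕ P → ∀ j → expTerm j b *ℚ fromℕ (j !) ≤ℚ fromℕ (P ^ j)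
expTerm-!≤ 0≤b b≤P zero    = ℚ.≤-refl
expTerm-!≤ {b} {P} 0≤b b≤P (suc j) = begin
  expTerm (suc j) b *ℚ fromℕ (suc j !)      ≡⟨ expTerm-! j b ⟩
  expTerm j b *ℚ fromℕ (j !) *ℚ b           ≤⟨ *ℚ-mono 0≤b (0≤fromℕ (P ^ j)) (expTerm-!≤ 0≤b b≤P j) b≤P ⟩
  fromℕ (P ^ j) *ℚ fromℕ P                  ≡⟨ fromℕ-* (P ^ j) P ⟨
  fromℕ (P ^ j * P)                         ≡⟨ cong fromℕ (ℕ.*-comm (P ^ j) P) ⟩
  fromℕ (P ^ suc j)                         ∎
  where open ℚ.≤-Reasoning

C≤2^ : ∀ n k → n C k ≤ 2 ^ n
C≤2^ n       zero    = ℕ.m^n>0 2 n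
C≤2^ zero    (suc k) = ℕ.≤-trans (ℕ.≤-reflexive (k>n⇒nCk≡0 {0} {suc k} (s≤s z≤n))) z≤n
C≤2^ (suc n) (suc k) = begin
  suc n C suc k           ≡⟨ nCk+nC[k+1]≡[n+1]C[k+1] n k ⟨
  n C k + n C suc k       ≤⟨ ℕ.+-mono-≤ (C≤2^ n k) (C≤2^ n (suc k)) ⟩
  2 ^ n + 2 ^ n           ≡⟨ cong (2 ^ n +_) (ℕ.+-identityʳ (2 ^ n)) ⟨
  2 ^ suc n               ∎
  where open ℕ.≤-Reasoning

^*!≤! : ∀ a j → a ^ j * a ! ≤ (j + a) !
^*!≤! a zero    = ℕ.≤-reflexive (ℕ.*-identityˡ (a !))
^*!≤! a (suc j) = begin
  a * a ^ j * a !           ≡⟨ ℕ.*-assoc a (a ^ j) (a !) ⟩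
  a * (a ^ j * a !)         ≤⟨ ℕ.*-mono-≤ (ℕ.m≤n+m a (suc j)) (^*!≤! a j) ⟩
  suc (j + a) * (j + a) !   ∎
  where open ℕ.≤-Reasoning

^≤2^*! : ∀ a j → a ^ j ≤ 2 ^ (j + a) * j !
^≤2^*! a j = ℕ.*-cancelʳ-≤ _ _ (a !) {{a ℕ.!≢0}} (begin
  a ^ j * a !                       ≤⟨ ^*!≤! a j ⟩
  (j + a) !                         ≡⟨ C-!-! j a ⟨
  ((j + a) C j) * (j ! * a !)       ≤⟨ ℕ.*-monoˡ-≤ (j ! * a !) (C≤2^ (j + a) j) ⟩
  2 ^ (j + a) * (j ! * a !)         ≡⟨ ℕ.*-assoc (2 ^ (j + a)) (j !) (a !) ⟨
  2 ^ (j + a) * j ! * a !           ∎)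
  where open ℕ.≤-Reasoning

-- Pʲ / j! ≤ 2⁴ᴾ / 2ʲ, since (4P)ʲ / j! ≤ (4P+j choose j) ≤ 2⁴ᴾ⁺ʲ.

2^*^≤ : ∀ P j → 2 ^ j * P ^ j ≤ 2 ^ (4 * P) * j !
2^*^≤ P j = ℕ.*-cancelˡ-≤ (2 ^ j) {{ℕ.m^n≢0 2 j}} (begin
  2 ^ j * (2 ^ j * P ^ j)        ≡⟨ ℕ.*-assoc (2 ^ j) (2 ^ j) (P ^ j) ⟨
  2 ^ j * 2 ^ j * P ^ j          ≡⟨ cong (_* P ^ j) (^-distribʳ-* 2 2 j) ⟨
  4 ^ j * P ^ j                  ≡⟨ ^-distribʳ-* 4 P j ⟨
  (4 * P) ^ j                    ≤⟨ ^≤2^*! (4 * P) j ⟩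
  2 ^ (j + 4 * P) * j !          ≡⟨ cong (_* j !) (ℕ.^-distribˡ-+-* 2 j (4 * P)) ⟩
  2 ^ j * 2 ^ (4 * P) * j !      ≡⟨ ℕ.*-assoc (2 ^ j) (2 ^ (4 * P)) (j !) ⟩
  2 ^ j * (2 ^ (4 * P) * j !)    ∎)
  where open ℕ.≤-Reasoning

expTerm-2^≤ : ∀ {b P} → 0ℚ ≤ℚ b → b ≤ℚ fromℕ P → ∀ j → expTerm j b *ℚ fromℕ (2 ^ j) ≤ℚ fromℕ (2 ^ (4 * P))
expTerm-2^≤ {b} {P} 0≤b b≤P j = *ℚ-cancelʳ (fromℕ (j !)) (0<fromℕ (j !) {{j ℕ.!≢0}}) (begin
  T *ℚ fromℕ (2 ^ j) *ℚ fromℕ (j !)        ≡⟨ solve 3 (λ T p f → T :* p :* f := p :* (T :* f)) refl T (fromℕ (2 ^ j)) (fromℕ (j !)) ⟩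
  fromℕ (2 ^ j) *ℚ (T *ℚ fromℕ (j !))      ≤⟨ *ℚ-monoʳ (fromℕ (2 ^ j)) (0≤fromℕ (2 ^ j)) (expTerm-!≤ {b} {P} 0≤b b≤P j) ⟩
  fromℕ (2 ^ j) *ℚ fromℕ (P ^ j)           ≡⟨ fromℕ-* (2 ^ j) (P ^ j) ⟨
  fromℕ (2 ^ j * P ^ j)                    ≤⟨ fromℕ-mono-≤ (2^*^≤ P j) ⟩
  fromℕ (2 ^ (4 * P) * j !)                ≡⟨ fromℕ-* (2 ^ (4 * P)) (j !) ⟩
  fromℕ (2 ^ (4 * P)) *ℚ fromℕ (j !)       ∎)
  where
  open ℚ.≤-Reasoning
  T = expTerm j b

expTerm-4^≤ : ∀ {b} → 0ℚ ≤ℚ b → b ≤ℚ ℤ.+ 1 / 4 → ∀ j → expTerm j b *ℚ fromℕ (4 ^ j) ≤ℚ fromℕ 1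
expTerm-4^≤ 0≤b b≤¼ zero    = ℚ.≤-refl
expTerm-4^≤ {b} 0≤b b≤¼ (suc j) = begin
  T *ℚ (b *ℚ i) *ℚ fromℕ (4 * 4 ^ j)       ≡⟨ cong (T *ℚ (b *ℚ i) *ℚ_) (fromℕ-* 4 (4 ^ j)) ⟩
  T *ℚ (b *ℚ i) *ℚ (fromℕ 4 *ℚ p)          ≡⟨ solve 5 (λ T b i c p → T :* (b :* i) :* (c :* p) := T :* p :* (b :* c :* i)) refl T b i (fromℕ 4) p ⟩
  T *ℚ p *ℚ (b *ℚ fromℕ 4 *ℚ i)            ≤⟨ *ℚ-mono (0≤* (0≤* 0≤b (0≤fromℕ 4)) (0≤ratio 1 (suc j))) (0≤fromℕ 1) (expTerm-4^≤ 0≤b b≤¼ j) b*4*i≤1 ⟩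
  fromℕ 1 *ℚ fromℕ 1                       ≡⟨ fromℕ-* 1 1 ⟨
  fromℕ 1                                  ∎
  where
  open ℚ.≤-Reasoning
  T = expTerm j b
  i = ℤ.+ 1 / suc j
  p = fromℕ (4 ^ j)
  b*4*i≤1 : b *ℚ fromℕ 4 *ℚ i ≤ℚ fromℕ 1
  b*4*i≤1 = begin
    b *ℚ fromℕ 4 *ℚ i                  ≤⟨ *ℚ-mono (0≤ratio 1 (suc j)) (0≤fromℕ 1) (ℚ.≤-trans (*ℚ-monoˡ (fromℕ 4) (0≤fromℕ 4) b≤¼) (ℚ.≤-reflexive (1/n*n 4))) (ratio≤1 1 (suc j) (s≤s z≤n)) ⟩
    fromℕ 1 *ℚ fromℕ 1                 ≡⟨ fromℕ-* 1 1 ⟨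
    fromℕ 1                            ∎

expSum-geometric : ∀ {b} r M → (∀ j → expTerm j b *ℚ fromℕ (suc r ^ j) ≤ℚ fromℕ M) →
  ∀ N → expSum N b *ℚ fromℕ r ≤ℚ fromℕ (M * suc r)
expSum-geometric {b} r M small N = *ℚ-cancelʳ (fromℕ (suc r ^ N)) (0<fromℕ (suc r ^ N) {{ℕ.m^n≢0 (suc r) N}}) (begin
  expSum N b *ℚ fromℕ r *ℚ fromℕ (suc r ^ N)                            ≡⟨ ℚ.+-identityʳ _ ⟨
  expSum N b *ℚ fromℕ r *ℚ fromℕ (suc r ^ N) +ℚ 0ℚ                      ≤⟨ ℚ.+-monoʳ-≤ (expSum N b *ℚ fromℕ r *ℚ fromℕ (suc r ^ N)) (0≤fromℕ (M * suc r)) ⟩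
  expSum N b *ℚ fromℕ r *ℚ fromℕ (suc r ^ N) +ℚ fromℕ (M * suc r)       ≤⟨ invariant N ⟩
  fromℕ (M * suc r) *ℚ fromℕ (suc r ^ N)                                ∎)
  where
  open ℚ.≤-Reasoning
  -- The added `M * suc r` represents the tail of the geometric series; without it the induction
  -- would not close.
  invariant : ∀ N → expSum N b *ℚ fromℕ r *ℚ fromℕ (suc r ^ N) +ℚ fromℕ (M * suc r) ≤ℚ fromℕ (M * suc r) *ℚ fromℕ (suc r ^ N)
  invariant zero    = ℚ.≤-reflexive (begin-equality
    0ℚ *ℚ fromℕ r *ℚ fromℕ 1 +ℚ fromℕ (M * suc r)    ≡⟨ cong (_+ℚ fromℕ (M * suc r)) (trans (cong (_*ℚ fromℕ 1) (ℚ.*-zeroˡ (fromℕ r))) (ℚ.*-zeroˡ (fromℕ 1))) ⟩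
    0ℚ +ℚ fromℕ (M * suc r)                          ≡⟨ ℚ.+-identityˡ _ ⟩
    fromℕ (M * suc r)                                ≡⟨ ℚ.*-identityʳ _ ⟨
    fromℕ (M * suc r) *ℚ fromℕ 1                     ∎)
  invariant (suc N) = begin
    (E +ℚ T) *ℚ r₁ *ℚ fromℕ (suc r * suc r ^ N) +ℚ fromℕ (M * suc r)
      ≡⟨ cong₂ (λ u v → (E +ℚ T) *ℚ r₁ *ℚ u +ℚ v) (fromℕ-* (suc r) (suc r ^ N)) (fromℕ-* M (suc r)) ⟩
    (E +ℚ T) *ℚ r₁ *ℚ (s *ℚ p) +ℚ m₁ *ℚ s
      ≡⟨ solve 6 (λ E T r s p m → (E :+ T) :* r :* (s :* p) :+ m :* s := s :* (E :* r :* p :+ T :* p :* r :+ m)) refl E T r₁ s p m₁ ⟩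
    s *ℚ (E *ℚ r₁ *ℚ p +ℚ T *ℚ p *ℚ r₁ +ℚ m₁)
      ≤⟨ *ℚ-monoʳ s (0≤fromℕ (suc r)) (ℚ.+-monoˡ-≤ m₁ (ℚ.+-monoʳ-≤ (E *ℚ r₁ *ℚ p) (*ℚ-monoˡ r₁ (0≤fromℕ r) (small N)))) ⟩
    s *ℚ (E *ℚ r₁ *ℚ p +ℚ m₁ *ℚ r₁ +ℚ m₁)
      ≡⟨ cong (s *ℚ_) (trans (ℚ.+-assoc (E *ℚ r₁ *ℚ p) (m₁ *ℚ r₁) m₁) (cong (E *ℚ r₁ *ℚ p +ℚ_) (sym m*s))) ⟩
    s *ℚ (E *ℚ r₁ *ℚ p +ℚ fromℕ (M * suc r))
      ≤⟨ *ℚ-monoʳ s (0≤fromℕ (suc r)) (invariant N) ⟩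
    s *ℚ (fromℕ (M * suc r) *ℚ p)
      ≡⟨ solve 3 (λ s m p → s :* (m :* p) := m :* (s :* p)) refl s (fromℕ (M * suc r)) p ⟩
    fromℕ (M * suc r) *ℚ (s *ℚ p)
      ≡⟨ cong (fromℕ (M * suc r) *ℚ_) (fromℕ-* (suc r) (suc r ^ N)) ⟨
    fromℕ (M * suc r) *ℚ fromℕ (suc r * suc r ^ N) ∎
    where
    E = expSum N b
    T = expTerm N b
    r₁ = fromℕ r
    s = fromℕ (suc r)
    p = fromℕ (suc r ^ N)
    m₁ = fromℕ M
    m*s : fromℕ (M * suc r) ≡ m₁ *ℚ r₁ +ℚ m₁
    m*s = trans (cong fromℕ (trans (ℕ.*-suc M r) (ℕ.+-comm M (M * r)))) (trans (fromℕ-+ (M * r) M) (cong (_+ℚ m₁) (fromℕ-* M r)))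

-- The series with terms 2⁴ᴾ / 2ʲ sums to at most 2 · 2⁴ᴾ. This stands in for a comparison of e with
-- a power of 2 and is what relates ln to base-2 logarithms.
expSum≤2^ : ∀ {b P} → 0ℚ ≤ℚ b → b ≤ℚ fromℕ P → ∀ N → expSum N b ≤ℚ fromℕ (2 ^ suc (4 * P))
expSum≤2^ {b} {P} 0≤b b≤P N = subst₂ _≤ℚ_ (ℚ.*-identityʳ (expSum N b)) (cong fromℕ (ℕ.*-comm (2 ^ (4 * P)) 2))
  (expSum-geometric 1 (2 ^ (4 * P)) (expTerm-2^≤ {b} {P} 0≤b b≤P) N)

-- For b ≤ 1/4 the terms are at most 4⁻ʲ, with sum at most 4/3. It serves to keep ln (k / ε) away
-- from 0 once k / ε exceeds 4/3.
expSum-small : ∀ {b} → 0ℚ ≤ℚ b → b ≤ℚ ℤ.+ 1 / 4 → ∀ N → expSum N b *ℚ fromℕ 3 ≤ℚ fromℕ 4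
expSum-small 0≤b b≤¼ = expSum-geometric 3 1 (expTerm-4^≤ 0≤b b≤¼)

ℚ<⇒≱ : ∀ {p q} → p <ℚ q → ¬ (q ≤ℚ p)
ℚ<⇒≱ p<q q≤p = ℚ.<-irrefl refl (ℚ.<-≤-trans p<q q≤p)

-- Reals

lower-closed : ∀ ε {q r} → r <ℝ ε → q ≤ℚ r → q <ℝ ε
lower-closed ε {q} {r} r<ε q≤r with ℚ.<-cmp q r
... | tri< q<r _ _  = Equivalence.from (ℝ.lower-rounded ε q) (r , q<r , r<ε)
... | tri≈ _ refl _ = r<ε
... | tri> _ _ r<q  = contradiction q≤r (ℚ<⇒≱ r<q)

<ℝ-ℝ< : ∀ ε {q r} → q <ℝ ε → ε ℝ< r → q ≤ℚ r
<ℝ-ℝ< ε {q} {r} q<ε ε<r with q ℚ.≤? r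
... | yes q≤r = q≤r
... | no q≰r  = contradiction (lower-closed ε q<ε (ℚ.<⇒≤ (ℚ.≰⇒> q≰r)) , ε<r) (ℝ.disjoint ε r)

1/suc< : ∀ n .{{_ : NonZero n}} → ℤ.+ 1 / suc n <ℚ ℤ.+ 1 / n
1/suc< n = ℚ.≰⇒> λ p → ℕ.<⇒≱ (ℕ.n<1+n n) (ℕ.*-cancelˡ-≤ 1 (/-cancel-≤ 1 n 1 (suc n) p))

reciprocal-below : ∀ {r} → 0ℚ <ℚ r → ∃[ N ] (∀ D .{{_ : NonZero D}} → N ≤ D → ℤ.+ 1 / D ≤ℚ r)
reciprocal-below {mkℚ (ℤ.+ zero) d c}  0<r = contradiction 0<r λ { (ℚ.*<* (ℤ.+<+ ())) }
reciprocal-below {mkℚ ℤ.-[1+ p ] d c} 0<r = contradiction 0<r λ { (ℚ.*<* ()) }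
reciprocal-below {r@(mkℚ (ℤ.+ suc p) d c)} 0<r = suc d , λ D N≤D →
  subst (ℤ.+ 1 / D ≤ℚ_) (ℚ.↥p/↧p≡p r)
    (/-mono-≤ 1 D (suc p) (suc d) (ℕ.*-mono-≤ {1} {suc p} (s≤s z≤n) N≤D))

-- Comparing ε with a single reciprocal is not decidable. Locatedness only separates 1 / (D + 3)
-- from 1 / (D + 2), so the bracket spans two consecutive gaps.
bracket : ∀ ε → 0ℚ <ℝ ε → ε ℝ< 1ℚ → ∃[ D ] (ℤ.+ 1 / suc (suc (suc D))) <ℝ ε × ε ℝ< (ℤ.+ 1 / suc D)
bracket ε 0<ε ε<1 = from-rational (Equivalence.to (ℝ.lower-rounded ε 0ℚ) 0<ε)
  where
  Bracketed : Set
  Bracketed = ∃[ D ] (ℤ.+ 1 / suc (suc (suc D))) <ℝ ε × ε ℝ< (ℤ.+ 1 / suc D)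

  module _ {r} (r<ε : r <ℝ ε) {N} (below : ∀ D .{{_ : NonZero D}} → N ≤ D → ℤ.+ 1 / D ≤ℚ r) where

    search : ∀ fuel D → N ≤ fuel + suc D → ε ℝ< (ℤ.+ 1 / suc D) → Bracketed
    -- With the fuel spent, 1 / (D + 1) is at most the positive rational r below ε, against the
    -- upper bound on ε.
    search zero       D N≤ ε< = contradiction (lower-closed ε r<ε (below (suc D) N≤) , ε<) (ℝ.disjoint ε _)
    search (suc fuel) D N≤ ε< = continue (ℝ.located ε (1/suc< (suc (suc D))))
      where
      continue : (ℤ.+ 1 / suc (suc (suc D))) <ℝ ε ⊎ ε ℝ< (ℤ.+ 1 / suc (suc D)) → Bracketed
      continue (inj₁ <ε)  = D , <ε , ε<
      continue (inj₂ ε<′) = search fuel (suc D) (ℕ.≤-trans N≤ (ℕ.≤-reflexive (sym (ℕ.+-suc fuel (suc D))))) ε<′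

  from-rational : (∃[ r ] 0ℚ <ℚ r × r <ℝ ε) → Bracketed
  from-rational (r , 0<r , r<ε) = search r<ε (proj₂ (reciprocal-below 0<r)) (proj₁ (reciprocal-below 0<r)) 0 (ℕ.m≤m+n _ 1) ε<1

quotient-nonNeg : ∀ {k ε} x → quotient k ε x → 0ℚ ≤ℚ x
quotient-nonNeg {k} x (e , 0<e , _ , k<xe) =
  *ℚ-cancelʳ e 0<e (subst (_≤ℚ x *ℚ e) (sym (ℚ.*-zeroˡ e)) (ℚ.≤-trans (0≤fromℕ k) (ℚ.<⇒≤ k<xe)))

quotient-bound : ∀ {k ε r} x → ε ℝ< r → quotient k ε x → fromℕ k ≤ℚ x *ℚ r
quotient-bound {k} {ε} x ε<r k/ε<x@(e , _ , e<ε , k<xe) =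
  ℚ.≤-trans (ℚ.<⇒≤ k<xe) (*ℚ-monoʳ x (quotient-nonNeg {k} {ε} x k/ε<x) (<ℝ-ℝ< ε e<ε ε<r))

-- Numerical bounds

⌈log₂⌉-spec : ∀ n → ∃[ a ] suc n ≤ 2 ^ a × 2 ^ a ≤ 2 * suc n
⌈log₂⌉-spec zero = 0 , ℕ.≤-refl , s≤s z≤n
⌈log₂⌉-spec (suc n) with ⌈log₂⌉-spec n
... | a , n≤ , ≤n with suc (suc n) ℕ.≤? 2 ^ a
...   | yes n<  = a , n< , ℕ.≤-trans ≤n (ℕ.*-monoʳ-≤ 2 (ℕ.n≤1+n (suc n)))
...   | no  n≮  = suc a , ℕ.≤-trans (ℕ.+-mono-≤ {1} (s≤s z≤n) n≤) (ℕ.≤-trans (ℕ.+-mono-≤ (ℕ.m^n>0 2 a) ℕ.≤-refl) (ℕ.≤-reflexive (cong (2 ^ a +_) (sym (ℕ.+-identityʳ _)))))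
                , ℕ.*-monoʳ-≤ 2 (ℕ.<⇒≤ (ℕ.≰⇒> n≮))

n≤2^n : ∀ n → n ≤ 2 ^ n
n≤2^n zero    = z≤n
n≤2^n (suc n) = ℕ.≤-trans (ℕ.+-mono-≤ (ℕ.m^n>0 2 n) (n≤2^n n)) (ℕ.≤-reflexive (cong (2 ^ n +_) (sym (ℕ.+-identityʳ _))))

ceiling : ∀ {b} N → 0ℚ <ℚ b → b ≤ℚ fromℕ N → ∃[ P ] b ≤ℚ fromℕ (suc P) × fromℕ P ≤ℚ b
ceiling zero    0<b b≤N = contradiction b≤N (ℚ<⇒≱ 0<b)
ceiling {b} (suc N) 0<b b≤N = decide (b ℚ.≤? fromℕ N)
  where
  decide : Dec (b ≤ℚ fromℕ N) → ∃[ P ] b ≤ℚ fromℕ (suc P) × fromℕ P ≤ℚ b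
  decide (yes b≤) = ceiling N 0<b b≤
  decide (no b≰)  = N , b≤N , ℚ.<⇒≤ (ℚ.≰⇒> b≰)

natural-above : ∀ b → ∃[ N ] b ≤ℚ fromℕ N
natural-above b@(mkℚ (ℤ.+ p) d c) = p , subst (_≤ℚ fromℕ p) (ℚ.↥p/↧p≡p b) (/-mono-≤ p (suc d) p 1 (ℕ.*-monoʳ-≤ p (s≤s z≤n)))
natural-above b@(mkℚ ℤ.-[1+ p ] d c) = 0 , ℚ.*≤* ℤ.-≤+

-- The number J + 1 of levels, the exponent β in the size of the sample,
-- and L, which is log₂ (k D) up to constants.

record Schedule (k D : ℕ) : Set where
  field
    J β L    : ℕ
    8*D≤2^J  : 8 * (2 + D) ≤ 2 ^ J
    β-large  : 4 * suc J * k * sampleSize k J β ≤ 2 ^ β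
    size≤    : sampleSize k J β ≤ 5328 * (k * D) * (L * L)
    L≤       : ∀ P → k * D ≤ 2 ^ suc (4 * suc P) → L ≤ 9 * suc P

^-cancelʳ-≤ : ∀ {x y} → 2 ^ x ≤ 2 ^ y → x ≤ y
^-cancelʳ-≤ p = ℕ.≮⇒≥ λ y<x → ℕ.<⇒≱ (ℕ.^-monoʳ-< 2 (s≤s (s≤s z≤n)) y<x) p

-- Five factors are at most 2ᴸ up to constants: `W` twice, k, `T` and `B`. The constants multiply to
-- 2¹⁷, from 8 for the expression itself, 8 for each `W`, 8 for `T` and 32 for `B`.
union-bound-size : ∀ W k T B L .{{_ : NonZero W}} .{{_ : NonZero B}} →
  W ≤ 2 ^ (L + 3) → k ≤ 2 ^ L → T ≤ 2 ^ (L + 3) → B ≤ 2 ^ (L + 5) →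
  4 * W * k * (T + T * W * B) ≤ 2 ^ (5 * L + 17)
union-bound-size W k T B L W≤ k≤ T≤ B≤ = begin
  4 * W * k * (T + T * W * B)                   ≤⟨ ℕ.*-monoʳ-≤ (4 * W * k) (ℕ.+-monoˡ-≤ (T * W * B) (ℕ.≤-trans (ℕ.m≤m*n T W) (ℕ.m≤m*n (T * W) B))) ⟩
  4 * W * k * (T * W * B + T * W * B)           ≡⟨ collect W k T B ⟩
  8 * (W * (k * (T * (W * B))))                 ≤⟨ ℕ.*-monoʳ-≤ 8 (ℕ.*-mono-≤ W≤′ (ℕ.*-mono-≤ k≤ (ℕ.*-mono-≤ T≤′ (ℕ.*-mono-≤ W≤′ B≤′)))) ⟩
  8 * (p * 8 * (p * (p * 8 * (p * 8 * (p * 32))))) ≡⟨ expand p ⟩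
  p * (p * (p * (p * (p * 1)))) * 2 ^ 17        ≡⟨ cong (_* 2 ^ 17) (ℕ.^-*-assoc 2 L 5) ⟩
  2 ^ (L * 5) * 2 ^ 17                          ≡⟨ ℕ.^-distribˡ-+-* 2 (L * 5) 17 ⟨
  2 ^ (L * 5 + 17)                              ≡⟨ cong (λ e → 2 ^ (e + 17)) (ℕ.*-comm L 5) ⟩
  2 ^ (5 * L + 17)                              ∎
  where
  open ℕ.≤-Reasoning
  p = 2 ^ L
  W≤′ : W ≤ p * 8
  W≤′ = ℕ.≤-trans W≤ (ℕ.≤-reflexive (ℕ.^-distribˡ-+-* 2 L 3))
  T≤′ : T ≤ p * 8
  T≤′ = ℕ.≤-trans T≤ (ℕ.≤-reflexive (ℕ.^-distribˡ-+-* 2 L 3))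
  B≤′ : B ≤ p * 32
  B≤′ = ℕ.≤-trans B≤ (ℕ.≤-reflexive (ℕ.^-distribˡ-+-* 2 L 5))
  collect : ∀ W k T B → 4 * W * k * (T * W * B + T * W * B) ≡ 8 * (W * (k * (T * (W * B))))
  collect = solve-∀
  expand : ∀ p → 8 * (p * 8 * (p * (p * 8 * (p * 8 * (p * 32))))) ≡ p * (p * (p * (p * (p * 1)))) * 131072
  expand = solve-∀

scaled≤2^ : ∀ c e L → c ≤ 2 ^ e → c * L ≤ 2 ^ (L + e)
scaled≤2^ c e L c≤ = ℕ.≤-trans (ℕ.*-mono-≤ c≤ (n≤2^n L))
  (ℕ.≤-reflexive (trans (ℕ.*-comm (2 ^ e) (2 ^ L)) (sym (ℕ.^-distribˡ-+-* 2 L e))))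

module _ (k D κ δ : ℕ) .{{_ : NonZero D}} (k≤2^κ : k ≤ 2 ^ κ) (2^κ≤2k : 2 ^ κ ≤ 2 * k)
         (2+D≤2^δ : 2 + D ≤ 2 ^ δ) (2^δ≤4+2D : 2 ^ δ ≤ 2 * (2 + D)) where

  private
    L = κ + δ

    2^δ≤6D : 2 ^ δ ≤ 6 * D
    2^δ≤6D = begin
      2 ^ δ                  ≤⟨ 2^δ≤4+2D ⟩
      2 * (2 * 1 + D)        ≤⟨ ℕ.*-monoʳ-≤ 2 (ℕ.+-monoˡ-≤ D (ℕ.*-monoʳ-≤ 2 (ℕ.>-nonZero⁻¹ D))) ⟩
      2 * (2 * D + D)        ≡⟨ collect D ⟩
      6 * D                  ∎
      where
      open ℕ.≤-Reasoning
      collect : ∀ D → 2 * (2 * D + D) ≡ 6 * D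
      collect = solve-∀

    1≤L : 1 ≤ L
    1≤L = ℕ.≤-trans (positive δ (ℕ.≤-trans (ℕ.m≤m+n 2 D) 2+D≤2^δ)) (ℕ.m≤n+m δ κ)
      where
      positive : ∀ δ → 2 ≤ 2 ^ δ → 1 ≤ δ
      positive zero    (s≤s ())
      positive (suc δ) _ = s≤s z≤n

    1+J≤5L : 4 + δ ≤ 5 * L
    1+J≤5L = ℕ.≤-trans (ℕ.+-mono-≤ (ℕ.*-monoʳ-≤ 4 1≤L) (ℕ.m≤n+m δ κ)) (ℕ.≤-reflexive (ℕ.+-comm (4 * L) L))

    k*2^J≤2^ : k * 2 ^ (3 + δ) ≤ 2 ^ (L + 3)
    k*2^J≤2^ = begin
      k * 2 ^ (3 + δ)        ≤⟨ ℕ.*-monoˡ-≤ (2 ^ (3 + δ)) k≤2^κ ⟩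
      2 ^ κ * 2 ^ (3 + δ)    ≡⟨ ℕ.^-distribˡ-+-* 2 κ (3 + δ) ⟨
      2 ^ (κ + (3 + δ))      ≡⟨ cong (2 ^_) (reorder κ δ) ⟩
      2 ^ (L + 3)            ∎
      where
      open ℕ.≤-Reasoning
      reorder : ∀ a b → a + (3 + b) ≡ a + b + 3
      reorder = solve-∀

    k*2^J≤ : k * 2 ^ (3 + δ) ≤ 48 * (k * D)
    k*2^J≤ = begin
      k * 2 ^ (3 + δ)         ≡⟨ cong (k *_) (ℕ.^-distribˡ-+-* 2 3 δ) ⟩
      k * (8 * 2 ^ δ)         ≤⟨ ℕ.*-monoʳ-≤ k (ℕ.*-monoʳ-≤ 8 2^δ≤6D) ⟩
      k * (8 * (6 * D))       ≡⟨ reassoc k D ⟩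
      48 * (k * D)            ∎
      where
      open ℕ.≤-Reasoning
      reassoc : ∀ k D → k * (8 * (6 * D)) ≡ 48 * (k * D)
      reassoc = solve-∀

    -- The constant is 48 · 111. Here 48 = 8 · 6 comes from 2ᴶ = 8 · 2ᵟ and 2ᵟ ≤ 6 D, and 111 = 1 +
    -- 5 · 22 from J + 1 ≤ 5 L and β = 22 L.
    size-bound : ∀ T W L x → 1 ≤ L → W ≤ 5 * L → T ≤ 48 * x → T + T * W * (22 * L) ≤ 5328 * x * (L * L)
    size-bound T W L x 1≤L W≤5L T≤48x = begin
      T + T * W * (22 * L)                         ≤⟨ ℕ.+-monoʳ-≤ T (ℕ.*-monoˡ-≤ (22 * L) (ℕ.*-monoʳ-≤ T W≤5L)) ⟩
      T + T * (5 * L) * (22 * L)                   ≡⟨ factor T L ⟩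
      T * (1 * 1 + 110 * (L * L))                  ≤⟨ ℕ.*-mono-≤ T≤48x (ℕ.+-monoˡ-≤ (110 * (L * L)) (ℕ.*-mono-≤ 1≤L 1≤L)) ⟩
      48 * x * (L * L + 110 * (L * L))             ≡⟨ total x (L * L) ⟩
      5328 * x * (L * L)                           ∎
      where
      open ℕ.≤-Reasoning
      factor : ∀ T L → T + T * (5 * L) * (22 * L) ≡ T * (1 * 1 + 110 * (L * L))
      factor = solve-∀
      total : ∀ x y → 48 * x * (y + 110 * y) ≡ 5328 * x * y
      total = solve-∀

    22L-large : ∀ {x} L → 1 ≤ L → x ≤ 2 ^ (5 * L + 17) → x ≤ 2 ^ (22 * L)
    22L-large {x} L 1≤L x≤ = ℕ.≤-trans x≤ (ℕ.^-monoʳ-≤ 2 (begin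
      5 * L + 17 * 1        ≤⟨ ℕ.+-monoʳ-≤ (5 * L) (ℕ.*-monoʳ-≤ 17 1≤L) ⟩
      5 * L + 17 * L        ≡⟨ ℕ.*-distribʳ-+ L 5 17 ⟨
      22 * L                ∎))
      where open ℕ.≤-Reasoning

    -- Rounding both logarithms up loses a factor 12 ≤ 2⁴, so 2ᴸ is at most 2⁴ times the given
    -- bound, and the exponent 4 P + 9 is at most 9 (P + 1).
    log-bound : ∀ P → k * D ≤ 2 ^ suc (4 * suc P) → L ≤ 9 * suc P
    log-bound P kD≤ = ℕ.≤-trans (^-cancelʳ-≤ (begin
      2 ^ L                            ≡⟨ ℕ.^-distribˡ-+-* 2 κ δ ⟩
      2 ^ κ * 2 ^ δ                    ≤⟨ ℕ.*-mono-≤ 2^κ≤2k 2^δ≤6D ⟩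
      2 * k * (6 * D)                  ≡⟨ reassoc k D ⟩
      12 * (k * D)                     ≤⟨ ℕ.*-mono-≤ (ℕ.m≤m+n 12 4) kD≤ ⟩
      2 ^ 4 * 2 ^ suc (4 * suc P)      ≡⟨ ℕ.^-distribˡ-+-* 2 4 (suc (4 * suc P)) ⟨
      2 ^ (4 + suc (4 * suc P))        ∎)) (ℕ.≤-trans (ℕ.m≤m+n (4 + suc (4 * suc P)) (5 * P)) (ℕ.≤-reflexive (collect P)))
      where
      open ℕ.≤-Reasoning
      reassoc : ∀ k D → 2 * k * (6 * D) ≡ 12 * (k * D)
      reassoc = solve-∀
      collect : ∀ P → 4 + suc (4 * suc P) + 5 * P ≡ 9 * suc P
      collect = solve-∀

  mkSchedule : Schedule k D
  mkSchedule = record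
    -- The 3 supplies the factor 8 in `8*D≤2^J`. The requirement on β is implicit, as the sample
    -- size is itself linear in β; but that factor enters only through its logarithm, so 5 L + 17
    -- bounds the exponent, and 1 ≤ L turns this into 22 L.
    { J = 3 + δ
    ; β = 22 * L
    ; L = L
    ; 8*D≤2^J = ℕ.≤-trans (ℕ.*-monoʳ-≤ 8 2+D≤2^δ) (ℕ.≤-reflexive (sym (ℕ.^-distribˡ-+-* 2 3 δ)))
    ; β-large = 22L-large L 1≤L (union-bound-size (4 + δ) k (k * 2 ^ (3 + δ)) (22 * L) L {{_}} {{ℕ.m*n≢0 22 L {{_}} {{ℕ.>-nonZero 1≤L}}}}
        (ℕ.≤-trans 1+J≤5L (scaled≤2^ 5 3 L (ℕ.m≤m+n 5 3)))
        (ℕ.≤-trans k≤2^κ (ℕ.^-monoʳ-≤ 2 (ℕ.m≤m+n κ δ))) k*2^J≤2^ (scaled≤2^ 22 5 L (ℕ.m≤m+n 22 10)))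
    ; size≤ = size-bound (k * 2 ^ (3 + δ)) (4 + δ) L (k * D) 1≤L 1+J≤5L k*2^J≤
    ; L≤ = log-bound
    }

schedule : ∀ k D → Schedule (suc k) (suc D)
schedule k D with ⌈log₂⌉-spec k | ⌈log₂⌉-spec (suc (suc D))
... | κ , k≤ , ≤k | δ , D≤ , ≤D = mkSchedule (suc k) (suc D) κ δ k≤ ≤k D≤ ≤D

-- Comparison of the sample size with k / ε and its logarithm

module Complexity {k D : ℕ} .{{_ : NonZero k}} .{{_ : NonZero D}} (s : Schedule k D) {ε : ℝ}
                  (ε<1/D : ε ℝ< (ℤ.+ 1 / D)) (ε<⅗ : ε ℝ< (ℤ.+ 3 / 5)) where

  open Schedule s

  kD≤ : ∀ x → quotient k ε x → fromℕ (k * D) ≤ℚ x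
  kD≤ x k/ε<x = begin
    fromℕ (k * D)                             ≡⟨ fromℕ-* k D ⟩
    fromℕ k *ℚ fromℕ D                      ≤⟨ *ℚ-monoˡ (fromℕ D) (0≤fromℕ D) (quotient-bound {k} {ε} x ε<1/D k/ε<x) ⟩
    x *ℚ (ℤ.+ 1 / D) *ℚ fromℕ D         ≡⟨ ℚ.*-assoc x (ℤ.+ 1 / D) (fromℕ D) ⟩
    x *ℚ ((ℤ.+ 1 / D) *ℚ fromℕ D)       ≡⟨ cong (x *ℚ_) (1/n*n D) ⟩
    x *ℚ 1ℚ                                       ≡⟨ ℚ.*-identityʳ x ⟩
    x                                             ∎
    where open ℚ.≤-Reasoning

  5≤3x : ∀ x → quotient k ε x → fromℕ 5 ≤ℚ x *ℚ fromℕ 3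
  5≤3x x k/ε<x = begin
    fromℕ 5                             ≤⟨ fromℕ-mono-≤ (ℕ.m≤n*m 5 k) ⟩
    fromℕ (k * 5)                       ≡⟨ fromℕ-* k 5 ⟩
    fromℕ k *ℚ fromℕ 5                  ≤⟨ *ℚ-monoˡ (fromℕ 5) (0≤fromℕ 5) (quotient-bound {k} {ε} x ε<⅗ k/ε<x) ⟩
    x *ℚ (ℤ.+ 3 / 5) *ℚ fromℕ 5         ≡⟨ ℚ.*-assoc x (ℤ.+ 3 / 5) (fromℕ 5) ⟩
    x *ℚ fromℕ 3                        ∎
    where open ℚ.≤-Reasoning

  -- `L≤` uses an integer P + 1 above b, which is within a constant factor of b only if b is not too
  -- small. As k / ε is at least 5/3 and the exponential series at 1/4 is at most 4/3, b is at least
  -- 1/4. Hence P + 1 ≤ b + 4 b, and 45 = 9 · 5.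
  L≤45b : ∀ {b} → ln (quotient k ε) b → fromℕ L ≤ℚ fromℕ 45 *ℚ b
  L≤45b {b} (0<b , N , k/ε<s) = from-ceiling (ceiling (proj₁ (natural-above b)) 0<b (proj₂ (natural-above b)))
    where
    open ℚ.≤-Reasoning
    0≤b : 0ℚ ≤ℚ b
    0≤b = ℚ.<⇒≤ 0<b
    ¼≤b : ℤ.+ 1 / 4 ≤ℚ b
    ¼≤b = ℚ.≮⇒≥ λ b<¼ → ℕ.<⇒≱ (ℕ.n<1+n 4)
      (fromℕ-cancel-≤ {5} {4} (ℚ.≤-trans (5≤3x (expSum N b) k/ε<s) (expSum-small 0≤b (ℚ.<⇒≤ b<¼) N)))
    1+P≤5b : ∀ P → fromℕ P ≤ℚ b → fromℕ (suc P) ≤ℚ fromℕ 5 *ℚ b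
    1+P≤5b P P≤b = begin
      fromℕ (1 + P)                               ≡⟨ fromℕ-+ 1 P ⟩
      fromℕ 4 *ℚ (ℤ.+ 1 / 4) +ℚ fromℕ P           ≤⟨ ℚ.+-mono-≤ (*ℚ-monoʳ (fromℕ 4) (0≤fromℕ 4) ¼≤b) P≤b ⟩
      fromℕ 4 *ℚ b +ℚ b                           ≡⟨ cong (fromℕ 4 *ℚ b +ℚ_) (ℚ.*-identityˡ b) ⟨
      fromℕ 4 *ℚ b +ℚ 1ℚ *ℚ b                     ≡⟨ ℚ.*-distribʳ-+ b (fromℕ 4) 1ℚ ⟨
      fromℕ 5 *ℚ b                                ∎
    from-ceiling : (∃[ P ] b ≤ℚ fromℕ (suc P) × fromℕ P ≤ℚ b) → fromℕ L ≤ℚ fromℕ 45 *ℚ b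
    from-ceiling (P , b≤1+P , P≤b) = begin
      fromℕ L                           ≤⟨ fromℕ-mono-≤ (L≤ P (fromℕ-cancel-≤ (ℚ.≤-trans (kD≤ (expSum N b) k/ε<s) (expSum≤2^ {b} {suc P} 0≤b b≤1+P N)))) ⟩
      fromℕ (9 * suc P)                 ≡⟨ fromℕ-* 9 (suc P) ⟩
      fromℕ 9 *ℚ fromℕ (suc P)          ≤⟨ *ℚ-monoʳ (fromℕ 9) (0≤fromℕ 9) (1+P≤5b P P≤b) ⟩
      fromℕ 9 *ℚ (fromℕ 5 *ℚ b)         ≡⟨ ℚ.*-assoc (fromℕ 9) (fromℕ 5) b ⟨
      fromℕ 9 *ℚ fromℕ 5 *ℚ b           ≡⟨ cong (_*ℚ b) (fromℕ-* 9 5) ⟨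
      fromℕ 45 *ℚ b                     ∎

  complexity : sampleSize k J β ≤ 5328 * (45 * 45) · quotient k ε · ln (quotient k ε) ²
  complexity a b k/ε<a ln<b = begin
    fromℕ (sampleSize k J β)                                             ≤⟨ fromℕ-mono-≤ size≤ ⟩
    fromℕ (5328 * (k * D) * (L * L))                         ≡⟨ trans (fromℕ-* (5328 * (k * D)) (L * L)) (cong₂ _*ℚ_ (fromℕ-* 5328 (k * D)) (fromℕ-* L L)) ⟩
    c *ℚ fromℕ (k * D) *ℚ (fromℕ L *ℚ fromℕ L)               ≤⟨ *ℚ-mono (0≤* (0≤fromℕ L) (0≤fromℕ L)) (0≤* (0≤fromℕ 5328) 0≤a) (*ℚ-monoʳ c (0≤fromℕ 5328) (kD≤ a k/ε<a))
                                                            (*ℚ-mono (0≤fromℕ L) (0≤* (0≤fromℕ 45) 0≤b) (L≤45b ln<b) (L≤45b ln<b)) ⟩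
    c *ℚ a *ℚ (d *ℚ b *ℚ (d *ℚ b))                      ≡⟨ solve 4 (λ c a d b → c :* a :* (d :* b :* (d :* b)) := c :* (d :* d) :* (a :* (b :* b))) refl c a d b ⟩
    c *ℚ (d *ℚ d) *ℚ (a *ℚ (b *ℚ b))                    ≡⟨ cong (_*ℚ (a *ℚ (b *ℚ b))) (trans (cong (c *ℚ_) (sym (fromℕ-* 45 45))) (sym (fromℕ-* 5328 (45 * 45)))) ⟩
    fromℕ (5328 * (45 * 45)) *ℚ (a *ℚ (b *ℚ b))         ∎
    where
    open ℚ.≤-Reasoning
    c = fromℕ 5328
    d = fromℕ 45
    0≤a = quotient-nonNeg {k} {ε} a k/ε<a
    0≤b = ℚ.<⇒≤ (proj₁ ln<b)

-- Acceptance probabilities of the tester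

module Testing {k : ℕ} .{{_ : NonZero k}} (P : PartitionParameters k) (homogeneous : SemiHomogeneous P)
               (Π : GraphProperty) (describes : Describes P Π) (ε : ℝ) where

  open SemiHomogeneousProperty P homogeneous
  open Soundness P homogeneous

  proper⇒Π : (H : Graph n) {c : Fin n → Fin k} → Proper H c → Π H
  proper⇒Π H {c} proper = Equivalence.from (describes H) (c , proper⇒good H proper)

  -- Density bounds in general do not pass to induced subgraphs, but permissions on single pairs do.
  -- A good partition of G therefore restricts to every sample, and the error is one-sided.
  tester-complete : ∀ s (G : Graph n) → Π G → 1ℚ ≤ℚ acceptanceProbability (tester s) G
  tester-complete {n} s G ΠG = 1≤probability (subsetsOfSize n (s ⊓ n)) (λ S → does (partitionable? (induced G S)))
    (subst (0 <_) (sym (length-subsetsOfSize n (s ⊓ n))) (0<C (ℕ.m⊓n≤n s n)))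
    (λ S → dec-true (partitionable? (induced G S)) (restrict S (Equivalence.to (describes G) ΠG)))
    where
    restrict : ∀ S → (∃[ c ] IsGoodPartition P G c) → ∃ (Proper (induced G S))
    restrict S (c , good) = c ∘ element S ,
      λ x y x≢y → good⇒proper G good (element S x) (element S y) (x≢y ∘ element-injective S)

  far-distance : ∀ D {n} (G : Graph n) → (ℤ.+ 1 / suc D) <ℝ ε → Far ε Π G →
    ∀ H c → Proper H c → n * n ≤ suc D * editDistance G H
  far-distance D {n} G 1/D<ε far H c proper = fromℕ-cancel-≤ (begin
    fromℕ (n * n)                                             ≡⟨ ℚ.*-identityˡ _ ⟨
    1ℚ *ℚ fromℕ (n * n)                                       ≡⟨ cong (_*ℚ fromℕ (n * n)) (1/n*n (suc D)) ⟨
    (ℤ.+ 1 / suc D) *ℚ fromℕ (suc D) *ℚ fromℕ (n * n)         ≡⟨ solve 3 (λ i d m → i :* d :* m := d :* (i :* m)) refl (ℤ.+ 1 / suc D) (fromℕ (suc D)) (fromℕ (n * n)) ⟩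
    fromℕ (suc D) *ℚ ((ℤ.+ 1 / suc D) *ℚ fromℕ (n * n))       ≡⟨ cong (λ z → fromℕ (suc D) *ℚ ((ℤ.+ 1 / suc D) *ℚ fromℕ (n * z))) (ℕ.*-identityʳ n) ⟨
    fromℕ (suc D) *ℚ ((ℤ.+ 1 / suc D) *ℚ fromℕ (n ^ 2))       ≤⟨ *ℚ-monoʳ (fromℕ (suc D)) (0≤fromℕ (suc D)) (far H (proper⇒Π H proper) (ℤ.+ 1 / suc D) 1/D<ε) ⟩
    fromℕ (suc D) *ℚ fromℕ (editDistance G H)                 ≡⟨ fromℕ-* (suc D) (editDistance G H) ⟨
    fromℕ (suc D * editDistance G H)                          ∎)
    where open ℚ.≤-Reasoning

  tester-sound : ∀ D (s : Schedule k (suc D)) .{{_ : NonZero n}} → (ℤ.+ 1 / suc (suc (suc D))) <ℝ ε → (G : Graph n) → Far ε Π G →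
    acceptanceProbability (tester (sampleSize k (Schedule.J s) (Schedule.β s))) G ≤ℚ ℤ.+ 1 / 2
  tester-sound {n} D s 1/E<ε G far = probability-≤½ (subsetsOfSize n (m ⊓ n)) (λ S → does (partitionable? (induced G S)))
    (subst (2 * length (filterᵇ (λ S → does (partitionable? (induced G S))) (subsetsOfSize n (m ⊓ n))) ≤_)
      (sym (length-subsetsOfSize n (m ⊓ n)))
      (few-accepted G J β (suc (suc (suc D))) 8*D≤2^J (far-distance (suc (suc D)) G 1/E<ε far) β-large))
    where
    open Schedule s
    m = sampleSize k J β

  -- Edit distances are at most n²/2, so that no samples are needed.

  nothing-far : .{{_ : NonZero n}} → (ℤ.+ 1 / 2) <ℝ ε → (G : Graph n) → ¬ Far ε Π G
  nothing-far {n} ½<ε G far = from-rational (Equivalence.to (ℝ.lower-rounded ε (ℤ.+ 1 / 2)) ½<ε)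
    where
    open ℚ.≤-Reasoning
    i₁ : Fin k
    i₁ = Fin.fromℕ< (ℕ.>-nonZero⁻¹ k)
    -- Putting all vertices into one part shows that some graph with the property always exists: a
    -- label is compatible with itself.
    open Repair G (λ _ → i₁) (λ _ _ → compatible-refl i₁)
    doubled : ∀ r → r <ℝ ε → r *ℚ fromℕ (n * n) *ℚ fromℕ 2 ≤ℚ (ℤ.+ 1 / 2) *ℚ fromℕ (n * n) *ℚ fromℕ 2
    doubled r r<ε = begin
      r *ℚ fromℕ (n * n) *ℚ fromℕ 2                    ≡⟨ cong (λ z → r *ℚ fromℕ (n * z) *ℚ fromℕ 2) (ℕ.*-identityʳ n) ⟨
      r *ℚ fromℕ (n ^ 2) *ℚ fromℕ 2                    ≤⟨ *ℚ-monoˡ (fromℕ 2) (0≤fromℕ 2) (far repaired (proper⇒Π repaired repaired-proper) r r<ε) ⟩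
      fromℕ (editDistance G repaired) *ℚ fromℕ 2       ≡⟨ fromℕ-* (editDistance G repaired) 2 ⟨
      fromℕ (editDistance G repaired * 2)              ≡⟨ cong fromℕ (ℕ.*-comm (editDistance G repaired) 2) ⟩
      fromℕ (2 * editDistance G repaired)              ≤⟨ fromℕ-mono-≤ (2*editDistance≤ G repaired) ⟩
      fromℕ (n * n)                                    ≡⟨ ℚ.*-identityˡ _ ⟨
      1ℚ *ℚ fromℕ (n * n)                              ≡⟨ cong (_*ℚ fromℕ (n * n)) (1/n*n 2) ⟨
      (ℤ.+ 1 / 2) *ℚ fromℕ 2 *ℚ fromℕ (n * n)          ≡⟨ solve 3 (λ i d m → i :* d :* m := i :* m :* d) refl (ℤ.+ 1 / 2) (fromℕ 2) (fromℕ (n * n)) ⟩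
      (ℤ.+ 1 / 2) *ℚ fromℕ (n * n) *ℚ fromℕ 2          ∎
    from-rational : ¬ (∃[ r ] (ℤ.+ 1 / 2) <ℚ r × r <ℝ ε)
    from-rational (r , ½<r , r<ε) = ℚ<⇒≱ ½<r (*ℚ-cancelʳ (fromℕ (n * n)) (0<fromℕ (n * n) {{ℕ.m*n≢0 n n}})
      (*ℚ-cancelʳ (fromℕ 2) (0<fromℕ 2) (doubled r r<ε)))

-- Large and small ε

½<⅗ : ℤ.+ 1 / 2 <ℚ ℤ.+ 3 / 5
½<⅗ = ℚ.*<* (ℤ.+<+ (ℕ.m≤m+n 6 0))

no-samples : ∀ K k ε → 0 ≤ K · quotient k ε · ln (quotient k ε) ²
no-samples K k ε a b k/ε<a (0<b , _) =
  0≤* (0≤fromℕ K) (0≤* (quotient-nonNeg {k} {ε} a k/ε<a) (0≤* (ℚ.<⇒≤ 0<b) (ℚ.<⇒≤ 0<b)))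

corollary3 : Σ[ c₀ ∈ ℚ ] Σ[ c₁ ∈ ℚ ] (0ℚ ≤ℚ c₀ × c₀ <ℚ c₁ × c₁ ≤ℚ 1ℚ ×
    (Σ[ K ∈ ℕ ]
    (∀ (k n : ℕ) → 1 ℕ.≤ k → 1 ℕ.≤ n →
    ∀ (ε : ℝ) → 0ℚ <ℝ ε → ε ℝ< 1ℚ →
    ∀ (Π : GraphProperty) → SHPP k Π →
    Σ[ T ∈ CanonicalTester ]
    (IsTester c₀ c₁ ε Π n T ×
    (CanonicalTester.sampleComplexity T ≤ K · quotient k ε · ln (quotient k ε) ²)))))
corollary3 = ℤ.+ 1 / 2 , 1ℚ , 0≤ratio 1 2 , ℚ.*<* (ℤ.+<+ (ℕ.m≤m+n 2 0)) , ℚ.≤-refl , 5328 * (45 * 45) , testers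
  where
  testers : ∀ (k n : ℕ) → 1 ℕ.≤ k → 1 ℕ.≤ n → ∀ (ε : ℝ) → 0ℚ <ℝ ε → ε ℝ< 1ℚ → ∀ (Π : GraphProperty) → SHPP k Π →
    Σ[ T ∈ CanonicalTester ] (IsTester (ℤ.+ 1 / 2) 1ℚ ε Π n T ×
      (CanonicalTester.sampleComplexity T ≤ 5328 * (45 * 45) · quotient k ε · ln (quotient k ε) ²))
  -- The order between ε and 1/2 is not decidable, so `located` offers two overlapping ranges.
  -- Staying below 3/5 < 3/4 keeps k / ε above 4/3, as the lower bound on the logarithm requires.
  testers (suc k) (suc n) _ _ ε 0<ε ε<1 Π (P , homogeneous , describes) = by-cases (ℝ.located ε ½<⅗)
    where
    open Testing P homogeneous Π describes ε
    open SemiHomogeneousProperty P homogeneous using (tester)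

    Goal : Set
    Goal = Σ[ T ∈ CanonicalTester ] (IsTester (ℤ.+ 1 / 2) 1ℚ ε Π (suc n) T ×
      (CanonicalTester.sampleComplexity T ≤ 5328 * (45 * 45) · quotient (suc k) ε · ln (quotient (suc k) ε) ²))

    sampling : ∃[ D ] (ℤ.+ 1 / suc (suc (suc D))) <ℝ ε × ε ℝ< (ℤ.+ 1 / suc D) → ε ℝ< (ℤ.+ 3 / 5) → Goal
    sampling (D , 1/E<ε , ε<1/D) ε<⅗ = tester m
      , record { complete = tester-complete m ; sound = tester-sound D s 1/E<ε }
      , Complexity.complexity s {ε} ε<1/D ε<⅗
      where
      s = schedule k D
      m = sampleSize (suc k) (Schedule.J s) (Schedule.β s)

    by-cases : (ℤ.+ 1 / 2) <ℝ ε ⊎ ε ℝ< (ℤ.+ 3 / 5) → Goal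
    by-cases (inj₁ ½<ε) = tester 0
      , record { complete = tester-complete 0 ; sound = λ G far → contradiction far (nothing-far ½<ε G) }
      , no-samples (5328 * (45 * 45)) (suc k) ε
    by-cases (inj₂ ε<⅗) = sampling (bracket ε 0<ε ε<1) ε<⅗
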